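{- For any class of treewidth-bounded graphs with no more than $k$ terminals, there is an $O(n\cdot k^{2k+4}\cdot\mathcal D^{O(k^4)})$-time algorithm for solving the diameter $\mathcal D$-bounded minimum $c$-cost spanning tree problem, where $n$ is the number of nodes.
   Context: Diameter $\mathcal D$-bounded minimum $c$-cost spanning tree problem: given an undirected graph $G$ with two integral (nonnegative) edge-cost functions $d$ and $c$ and a bound $\mathcal D$, find a spanning tree of minimum total $c$-cost among the spanning trees whose diameter under the $d$-cost (maximum $d$-distance in the tree between two nodes) is at most $\mathcal D$. A class of treewidth-bounded graphs $\Gamma$ is inductively defined as follows. (1) The number of primitive graphs in $\Gamma$ is finite. (2) Each graph in $\Gamma$ has an ordered set of special nodes called terminals; the number of terminals in each graph is bounded by a constant, say $k$. (3) There is a finite collection of binary composition rules that operate only at terminals, either by identifying two terminals or adding an edge between terminals. A composition rule also determines the terminals of the resulting graph, which must be a subset of the terminals of the two graphs being composed. The given graph is assumed to be accompanied by a parse tree, of size linear in the number of nodes, specifying how it is constructed using the rules. -}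

module Defs where

open import Data.Bool using (if_then_else_)
open import Data.Fin using (Fin; toℕ; punchOut; _↑ˡ_; _↑ʳ_)
open import Data.Fin.Properties using (_≟_)
open import Data.Fin.Subset using (Subset; _∈_)
open import Data.List as List using (List; []; _∷_)
open import Data.List.Relation.Unary.Unique.Propositional as ListU using ()
open import Data.Maybe using (Maybe; just; nothing)
open import Data.Nat using (ℕ; suc; _+_; _∸_; _≤_; NonZero)
open import Data.Nat.ListAction using (sum)
open import Data.Product using (∃-syntax; _×_; _,_; proj₁; proj₂)
open import Data.Sum using (_⊎_)
open import Data.Vec as Vec using (Vec; []; _∷_; lookup)
open import Data.Vec.Relation.Unary.Unique.Propositional as VecU using ()
open import Function using (id)
open import Relation.Binary.PropositionalEquality using (_≡_; _≢_)
open import Relation.Nullary using (¬_; yes; no)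

-- Finite undirected multigraphs: edges are named, and the order in which
-- the two ends of an edge are listed is irrelevant (see Joins).  Gluing
-- terminals may create parallel edges and loops, so these are allowed.

record Graph : Set where
  field
    nodes : ℕ
    edges : ℕ
    ends  : Vec (Fin nodes × Fin nodes) edges

Joins : (G : Graph) → let open Graph G in Fin edges → Fin nodes → Fin nodes → Set
Joins G e u v = (lookup ends e ≡ (u , v)) ⊎ (lookup ends e ≡ (v , u))
  where open Graph G

-- Everything about the subgraph of G that has all the nodes of G and
-- whose edges are those in S.

module Subgraph (G : Graph) (S : Subset (Graph.edges G)) where
  open Graph G

  data Walk : Fin nodes → Fin nodes → Set where
    []   : ∀ {u} → Walk u u
    step : ∀ {u v w} (e : Fin edges) → e ∈ S → Joins G e u v → Walk v w → Walk u w

  walkEdges : ∀ {u v} → Walk u v → List (Fin edges)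
  walkEdges []             = []
  walkEdges (step e _ _ w) = e ∷ walkEdges w

  -- The nodes visited, without the last one.
  walkNodes : ∀ {u v} → Walk u v → List (Fin nodes)
  walkNodes []                 = []
  walkNodes (step {u} _ _ _ w) = u ∷ walkNodes w

  Connected : Set
  Connected = ∀ u v → Walk u v

  -- A loop is a cycle, and so is a pair of parallel edges.
  IsCycle : ∀ {u} → Walk u u → Set
  IsCycle w = walkEdges w ≢ [] × ListU.Unique (walkEdges w) × ListU.Unique (walkNodes w)

  Acyclic : Set
  Acyclic = ∀ {u} (w : Walk u u) → ¬ IsCycle w

  IsSpanningTree : Set
  IsSpanningTree = Connected × Acyclic

  module _ (d : Vec ℕ edges) where

    walkLength : ∀ {u v} → Walk u v → ℕ
    walkLength w = sum (List.map (lookup d) (walkEdges w))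

    IsDistance : Fin nodes → Fin nodes → ℕ → Set
    IsDistance u v δ =
      (∃[ w ] walkLength {u} {v} w ≡ δ) × (∀ (w : Walk u v) → δ ≤ walkLength w)

    IsDiameter : ℕ → Set
    IsDiameter Δ =
      (∃[ u ] ∃[ v ] IsDistance u v Δ) × (∀ u v δ → IsDistance u v δ → δ ≤ Δ)

totalCost : ∀ {m} → Vec ℕ m → Subset m → ℕ
totalCost c S = Vec.sum (Vec.zipWith (λ x inS → if inS then x else 0) c S)

-- The terminals are listed in order.  Repetitions occur only while a
-- composition rule is being carried out: Primitive and Rule below make
-- the terminals of every graph of a class pairwise distinct.

record TGraph (t : ℕ) : Set where
  field
    graph     : Graph
    terminals : Vec (Fin (Graph.nodes graph)) t
  open Graph graph public

discrete : (t : ℕ) → TGraph t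
discrete t = record
  { graph     = record { nodes = t ; edges = 0 ; ends = [] }
  ; terminals = Vec.allFin t
  }

-- Disjoint union; the terminals of the first graph come first.
_⊍_ : ∀ {s t} → TGraph s → TGraph t → TGraph (s + t)
G ⊍ H = record
  { graph = record
    { nodes = G.nodes + H.nodes
    ; edges = G.edges + H.edges
    ; ends  = Vec.map (λ (u , v) → (u ↑ˡ H.nodes) , (v ↑ˡ H.nodes)) G.ends
              Vec.++ Vec.map (λ (u , v) → (G.nodes ↑ʳ u) , (G.nodes ↑ʳ v)) H.ends
    }
  ; terminals = Vec.map (_↑ˡ H.nodes) G.terminals Vec.++ Vec.map (G.nodes ↑ʳ_) H.terminals
  }
  where
  module G = TGraph G
  module H = TGraph H

-- The quotient of Fin n that identifies i and j and nothing else: if they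
-- differ, j is sent to where i goes, and the place of j is removed.
identified : ∀ {n} → Fin n → Fin n → ∃[ m ] (Fin n → Fin m)
identified {suc n} i j with j ≟ i
... | yes _   = suc n , id
... | no j≢i = n , redirect
  where
  redirect : Fin (suc n) → Fin n
  redirect v with j ≟ v
  ... | yes _   = punchOut j≢i
  ... | no j≢v = punchOut j≢v

data Op (t : ℕ) : Set where
  identify : (i j : Fin t) → Op t
  addEdge  : (i j : Fin t) → Op t

applyOp : ∀ {t} → TGraph t → Op t → TGraph t
applyOp G (identify i j) = record
  { graph = record
    { nodes = proj₁ quotient
    ; edges = edges
    ; ends  = Vec.map (λ (u , v) → proj₂ quotient u , proj₂ quotient v) ends
    }
  ; terminals = Vec.map (proj₂ quotient) terminals
  }
  where
  open TGraph G
  quotient = identified (lookup terminals i) (lookup terminals j)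
applyOp G (addEdge i j) = record
  { graph = record
    { nodes = nodes
    ; edges = suc edges
    ; ends  = (lookup terminals i , lookup terminals j) ∷ ends
    }
  ; terminals = terminals
  }
  where open TGraph G

applyOps : ∀ {t} → TGraph t → List (Op t) → TGraph t
applyOps = List.foldl applyOp

retain : ∀ {t r} → Vec (Fin t) r → TGraph t → TGraph r
retain keep G = record { graph = graph ; terminals = Vec.map (lookup terminals) keep }
  where open TGraph G

record Primitive (k : ℕ) : Set where
  field
    arity    : ℕ
    arity≤k  : arity ≤ k
    tgraph   : TGraph arity
    nonempty : NonZero (TGraph.nodes tgraph)
    distinct : VecU.Unique (TGraph.terminals tgraph)

-- A rule composes a graph with `left` terminals and one with `right`
-- terminals.  Numbers below `left` in Fin (left + right) denote terminals
-- of the first graph, the others terminals of the second.  Which of them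
-- get identified depends on the rule alone, so that `distinct`, which
-- speaks about the rule acting on bare terminals, says that the terminals
-- of any composed graph are pairwise distinct.
record Rule (k : ℕ) : Set where
  field
    left right out : ℕ
    out≤k    : out ≤ k
    ops      : List (Op (left + right))
    keep     : Vec (Fin (left + right)) out
    distinct : VecU.Unique
                 (TGraph.terminals (retain keep (applyOps (discrete (left + right)) ops)))

compose : ∀ {k} (R : Rule k) → let open Rule R in TGraph left → TGraph right → TGraph out
compose R G H = retain keep (applyOps (G ⊍ H) ops)
  where open Rule R

record GraphClass (k : ℕ) : Set where
  field
    startGraphs : List (Primitive k)
    rules      : List (Rule k)

  start : Fin (List.length startGraphs) → Primitive k
  start = List.lookup startGraphs

  rule : Fin (List.length rules) → Rule k
  rule = List.lookup rules

module _ {k : ℕ} (Γ : GraphClass k) where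
  open GraphClass Γ

  data ParseTree : ℕ → Set where
    leaf : (i : Fin (List.length startGraphs)) → ParseTree (Primitive.arity (start i))
    node : (r : Fin (List.length rules)) →
           ParseTree (Rule.left (rule r)) → ParseTree (Rule.right (rule r)) →
           ParseTree (Rule.out (rule r))

module _ {k : ℕ} {Γ : GraphClass k} where
  open GraphClass Γ

  size : ∀ {t} → ParseTree Γ t → ℕ
  size (leaf _)     = 1
  size (node _ S T) = suc (size S + size T)

  ⟦_⟧ : ∀ {t} → ParseTree Γ t → TGraph t
  ⟦ leaf i ⟧     = Primitive.tgraph (start i)
  ⟦ node r S T ⟧ = compose (rule r) ⟦ S ⟧ ⟦ T ⟧

record Instance {k : ℕ} (Γ : GraphClass k) : Set where
  field
    {terms} : ℕ
    parse   : ParseTree Γ terms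

  G : Graph
  G = TGraph.graph ⟦ parse ⟧

  open Graph G public

  field
    d c : Vec ℕ edges
    𝒟   : ℕ

  Feasible : Subset edges → Set
  Feasible S = IsSpanningTree × ∃[ Δ ] (IsDiameter d Δ × Δ ≤ 𝒟)
    where open Subgraph G S

  -- The answer `nothing` claims that no spanning tree meets the bound.
  IsSolution : Maybe (Subset edges) → Set
  IsSolution (just S) = Feasible S × (∀ S′ → Feasible S′ → totalCost c S ≤ totalCost c S′)
  IsSolution nothing  = ∀ S → ¬ Feasible S

-- Algorithms are programs in a first-order, call-by-value language with
-- mutually recursive functions, whose data are natural numbers and pairs.
-- Every evaluation step costs one unit.  A random access machine with
-- unit-cost addition and subtraction carries out a step in constant time
-- (for a fixed program) by representing pairs as pointers to two cells, so
-- that a time bound here is one for such machines too.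

data Val : Set where
  num : ℕ → Val
  _∙_ : Val → Val → Val

infixr 5 _∙_

-- Expressions with x variables, over functions with the given arities.
data Exp {f : ℕ} (arities : Vec ℕ f) (x : ℕ) : Set where
  var       : Fin x → Exp arities x
  lit       : ℕ → Exp arities x
  add monus : (a b : Exp arities x) → Exp arities x
  pair      : (a b : Exp arities x) → Exp arities x
  fst snd   : (a : Exp arities x) → Exp arities x
  ifZero    : (a b b′ : Exp arities x) → Exp arities x
  ifPair    : (a b b′ : Exp arities x) → Exp arities x
  bind      : (a : Exp arities x) (b : Exp arities (suc x)) → Exp arities x
  call      : (g : Fin f) → Vec (Exp arities x) (lookup arities g) → Exp arities x

record Program : Set where
  field
    functions : ℕ
    arities   : Vec ℕ functions
    body      : (g : Fin functions) → Exp arities (lookup arities g)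
    main      : Exp arities 1

module Semantics (P : Program) where
  open Program P

  -- ρ ⊢ a ⇓ v ⟨ τ ⟩ : in environment ρ, a evaluates to v in time τ.

  infix 4 _⊢_⇓_⟨_⟩ _⊢*_⇓_⟨_⟩

  mutual

    data _⊢_⇓_⟨_⟩ {x} (ρ : Vec Val x) : Exp arities x → Val → ℕ → Set where
      var     : ∀ {i} → ρ ⊢ var i ⇓ lookup ρ i ⟨ 1 ⟩
      lit     : ∀ {n} → ρ ⊢ lit n ⇓ num n ⟨ 1 ⟩
      add     : ∀ {a b m n σ τ} → ρ ⊢ a ⇓ num m ⟨ σ ⟩ → ρ ⊢ b ⇓ num n ⟨ τ ⟩ →
                ρ ⊢ add a b ⇓ num (m + n) ⟨ 1 + σ + τ ⟩
      monus   : ∀ {a b m n σ τ} → ρ ⊢ a ⇓ num m ⟨ σ ⟩ → ρ ⊢ b ⇓ num n ⟨ τ ⟩ →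
                ρ ⊢ monus a b ⇓ num (m ∸ n) ⟨ 1 + σ + τ ⟩
      pair    : ∀ {a b v w σ τ} → ρ ⊢ a ⇓ v ⟨ σ ⟩ → ρ ⊢ b ⇓ w ⟨ τ ⟩ →
                ρ ⊢ pair a b ⇓ v ∙ w ⟨ 1 + σ + τ ⟩
      fst     : ∀ {a v w τ} → ρ ⊢ a ⇓ v ∙ w ⟨ τ ⟩ → ρ ⊢ fst a ⇓ v ⟨ 1 + τ ⟩
      snd     : ∀ {a v w τ} → ρ ⊢ a ⇓ v ∙ w ⟨ τ ⟩ → ρ ⊢ snd a ⇓ w ⟨ 1 + τ ⟩
      zeroYes : ∀ {a b b′ v σ τ} → ρ ⊢ a ⇓ num 0 ⟨ σ ⟩ → ρ ⊢ b ⇓ v ⟨ τ ⟩ →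
                ρ ⊢ ifZero a b b′ ⇓ v ⟨ 1 + σ + τ ⟩
      zeroNo  : ∀ {a b b′ n v σ τ} → ρ ⊢ a ⇓ num (suc n) ⟨ σ ⟩ → ρ ⊢ b′ ⇓ v ⟨ τ ⟩ →
                ρ ⊢ ifZero a b b′ ⇓ v ⟨ 1 + σ + τ ⟩
      pairYes : ∀ {a b b′ u w v σ τ} → ρ ⊢ a ⇓ u ∙ w ⟨ σ ⟩ → ρ ⊢ b ⇓ v ⟨ τ ⟩ →
                ρ ⊢ ifPair a b b′ ⇓ v ⟨ 1 + σ + τ ⟩
      pairNo  : ∀ {a b b′ n v σ τ} → ρ ⊢ a ⇓ num n ⟨ σ ⟩ → ρ ⊢ b′ ⇓ v ⟨ τ ⟩ →
                ρ ⊢ ifPair a b b′ ⇓ v ⟨ 1 + σ + τ ⟩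
      bind    : ∀ {a b u v σ τ} → ρ ⊢ a ⇓ u ⟨ σ ⟩ → (u ∷ ρ) ⊢ b ⇓ v ⟨ τ ⟩ →
                ρ ⊢ bind a b ⇓ v ⟨ 1 + σ + τ ⟩
      call    : ∀ {g as vs v σ τ} → ρ ⊢* as ⇓ vs ⟨ σ ⟩ → vs ⊢ body g ⇓ v ⟨ τ ⟩ →
                ρ ⊢ call g as ⇓ v ⟨ 1 + σ + τ ⟩

    data _⊢*_⇓_⟨_⟩ {x} (ρ : Vec Val x) :
           ∀ {y} → Vec (Exp arities x) y → Vec Val y → ℕ → Set where
      []  : ρ ⊢* [] ⇓ [] ⟨ 0 ⟩
      _∷_ : ∀ {y a v σ τ} {as : Vec (Exp arities x) y} {vs} →
            ρ ⊢ a ⇓ v ⟨ σ ⟩ → ρ ⊢* as ⇓ vs ⟨ τ ⟩ →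
            ρ ⊢* (a ∷ as) ⇓ (v ∷ vs) ⟨ σ + τ ⟩

_on_⇓_⟨_⟩ : Program → Val → Val → ℕ → Set
P on v ⇓ w ⟨ τ ⟩ = (v ∷ []) ⊢ Program.main P ⇓ w ⟨ τ ⟩
  where open Semantics P

encodeVec : ∀ {A : Set} {m} → (A → Val) → Vec A m → Val
encodeVec f []       = num 0
encodeVec f (x ∷ xs) = f x ∙ encodeVec f xs

encodeFin : ∀ {n} → Fin n → Val
encodeFin i = num (toℕ i)

encodeGraph : Graph → Val
encodeGraph G = num nodes ∙ encodeVec (λ (u , v) → encodeFin u ∙ encodeFin v) ends
  where open Graph G

encodeParse : ∀ {k} {Γ : GraphClass k} {t} → ParseTree Γ t → Val
encodeParse (leaf i)     = encodeFin i
encodeParse (node r S T) = encodeFin r ∙ encodeParse S ∙ encodeParse T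

encodeInstance : ∀ {k} {Γ : GraphClass k} → Instance Γ → Val
encodeInstance I =
  encodeGraph G ∙ encodeParse parse ∙ encodeVec num d ∙ encodeVec num c ∙ num 𝒟
  where open Instance I

encodeAnswer : ∀ {m} → Maybe (Subset m) → Val
encodeAnswer nothing  = num 0
encodeAnswer (just S) = num 1 ∙ encodeVec (λ inS → num (if inS then 1 else 0)) S

SolvesWithin : ∀ {k} {Γ : GraphClass k} → Program → Instance Γ → ℕ → Set
SolvesWithin P I T =
  ∃[ answer ] ∃[ τ ] ( P on encodeInstance I ⇓ encodeAnswer answer ⟨ τ ⟩
                     × Instance.IsSolution I answer
                     × τ ≤ T )

{-# OPTIONS --safe #-}
-- A selection of edges is summarised by which terminals coincide, which are
-- connected, at what distance, and by the eccentricity of every terminal in its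
-- component.  In a forest, joining terminals i and j of different components by
-- a bridge of length w (0 for an identification) changes no distance between
-- connected vertices and creates the distances d(x,i) + w + d(j,y), the largest
-- being ecc i + w + ecc j.  So the summary can be updated from itself alone, and
-- a selection that exceeds 𝒟 once, closes a cycle, or cuts off a component from
-- the terminals can be discarded for good.  At most k terminals admit at most
-- (𝒟 + 2) ^ 4k² summaries; a table holds a cheapest selection for each, and the
-- table of a parse tree node is obtained from all pairs of entries below it.
module Submission where

open import Defs
open import Data.Bool using (Bool; true; false; if_then_else_)
open import Data.Empty using (⊥; ⊥-elim)
open import Data.Fin as Fin using (Fin; zero; suc; toℕ; splitAt; punchIn; punchOut; _↑ˡ_; _↑ʳ_)
open import Data.Fin.Properties as Finₚ using ()
open import Data.Fin.Subset as Subset using (Subset)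
open import Data.List as List using (List; []; _∷_; _++_; length)
open import Data.List.Membership.Propositional using () renaming (_∈_ to _∈ˡ_)
open import Data.List.Membership.Propositional.Properties as ∈ˡ using ()
open import Data.List.Properties as Listₚ using ()
open import Data.List.Relation.Unary.All as All using (All; []; _∷_)
open import Data.List.Relation.Unary.AllPairs using (AllPairs; []; _∷_)
open import Data.List.Relation.Unary.Any using (here; there; any?)
open import Data.List.Relation.Unary.Unique.Propositional as ListU using ()
open import Data.Maybe using (Maybe; just; nothing)
open import Data.Nat using (ℕ; zero; suc; _+_; _∸_; _*_; _^_; _⊔_; _≤_; _<_; z≤n; s≤s; NonZero; >-nonZero; >-nonZero⁻¹)
open import Data.Nat.Properties as ℕ using
  ( ≤-refl; ≤-trans; ≤-reflexive; ≤-antisym; m≤m+n; m≤n+m; +-assoc; +-comm; +-mono-≤; +-monoˡ-≤; +-monoʳ-≤; *-mono-≤; *-monoˡ-≤; *-monoʳ-≤ )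
open import Data.Nat.Solver using (module +-*-Solver)
open import Data.Product using (∃-syntax; Σ-syntax; _×_; _,_; proj₁; proj₂)
open import Data.Sum using (_⊎_; inj₁; inj₂; [_,_]′)
open import Data.Unit using (⊤)
open import Data.Vec as Vec using (Vec; []; _∷_; lookup; toList; here; there)
open import Data.Vec.Properties as Vecₚ using ()
open import Function using (id; _∘_; flip)
open import Level as Level using (Lift)
open import Relation.Binary.Definitions using (DecidableEquality)
open import Relation.Binary.PropositionalEquality
  using (_≡_; _≢_; refl; sym; trans; cong; cong₂; subst; subst₂; module ≡-Reasoning)
open import Relation.Nullary using (¬_; yes; no; contradiction)

-- Discarding is safe only if nothing discarded below can be part of anything kept above. Each
-- operation is therefore treated in two directions: one computes the new summary, the other carries
-- `Alive` from the result back to the operands. Soundness of the tables rests on the first,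
-- completeness on both.
--
-- Distances and eccentricities are carried along as witnesses; a search for shortest paths occurs
-- only where `Alive` is compared with the stated notion of diameter.
--
-- The code for a rule sees two entries and the labels of the edges that the rule adds, never the
-- names of edges. `build` presents the graph so that the edge labels come in preorder of the parse
-- tree, and one pass over the tree consumes them.
--
-- The exponent 20 is 5 times 4. With tables of at most B entries, B * B pairs of entries yield
-- O(B^2) candidates, and the length of every loop and table inside a parse tree node is bounded by
-- such a count: B for the outer loop, B^2 for the inner one, B^2 for one insertion. The result is
-- B^5 with B at most (𝒟 + 2)^(4k²).

Edges : Set → Set
Edges V = List (V × V × ℕ)

mapEnds : {V W : Set} → (V → W) → Edges V → Edges W
mapEnds π = List.map λ (u , v , w) → π u , π v , w

data Link {V : Set} (E : Edges V) : V → V → ℕ → Set where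
  along   : ∀ {u v w} → (u , v , w) ∈ˡ E → Link E u v w
  against : ∀ {u v w} → (u , v , w) ∈ˡ E → Link E v u w

-- Path E x y ℓ: there is a walk of length at most ℓ.
data Path {V : Set} (E : Edges V) (x y : V) (ℓ : ℕ) : Set where
  stop : x ≡ y → Path E x y ℓ
  go   : ∀ {z w m} → Link E x z w → Path E z y m → w + m ≤ ℓ → Path E x y ℓ

Conn : {V : Set} → Edges V → V → V → Set
Conn E x y = ∃[ ℓ ] Path E x y ℓ

flipLink : ∀ {V : Set} {E : Edges V} {x y w} → Link E x y w → Link E y x w
flipLink (along p)   = against p
flipLink (against p) = along p

module _ {V : Set} {E : Edges V} where

  weaken : ∀ {x y ℓ m} → ℓ ≤ m → Path E x y ℓ → Path E x y m
  weaken ℓ≤m (stop eq)   = stop eq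
  weaken ℓ≤m (go l p le) = go l p (≤-trans le ℓ≤m)

  _⧺_ : ∀ {x y z a b} → Path E x y a → Path E y z b → Path E x z (a + b)
  stop refl ⧺ q = weaken (m≤n+m _ _) q
  _⧺_ {a = a} {b} (go {w = w} {m} l p le) q = go l (p ⧺ q)
    (subst (_≤ a + b) (+-assoc w m b) (+-monoˡ-≤ b le))

  single : ∀ {x y w} → Link E x y w → Path E x y w
  single l = go l (stop {ℓ = 0} refl) (≤-reflexive (ℕ.+-identityʳ _))

  flipPath : ∀ {x y ℓ} → Path E x y ℓ → Path E y x ℓ
  flipPath (stop eq) = stop (sym eq)
  flipPath {ℓ = ℓ} (go {w = w} {m} l p le) =
    weaken (subst (_≤ ℓ) (+-comm w m) le) (flipPath p ⧺ single (flipLink l))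

  conn-refl : ∀ {x} → Conn E x x
  conn-refl = 0 , stop refl

  conn-sym : ∀ {x y} → Conn E x y → Conn E y x
  conn-sym (_ , p) = _ , flipPath p

  conn-trans : ∀ {x y z} → Conn E x y → Conn E y z → Conn E x z
  conn-trans (_ , p) (_ , q) = _ , p ⧺ q

mapPath : ∀ {V W : Set} {E : Edges V} {F : Edges W} (π : V → W) →
          (∀ {x y w} → Link E x y w → Link F (π x) (π y) w) →
          ∀ {x y ℓ} → Path E x y ℓ → Path F (π x) (π y) ℓ
mapPath π f (stop eq)   = stop (cong π eq)
mapPath π f (go l p le) = go (f l) (mapPath π f p) le

mapEnds-link : ∀ {V W : Set} {E : Edges V} (π : V → W) →
               ∀ {x y w} → Link E x y w → Link (mapEnds π E) (π x) (π y) w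
mapEnds-link π (along p)   = along (∈ˡ.∈-map⁺ _ p)
mapEnds-link π (against p) = against (∈ˡ.∈-map⁺ _ p)

mapEnds-path : ∀ {V W : Set} {E : Edges V} (π : V → W) →
               ∀ {x y ℓ} → Path E x y ℓ → Path (mapEnds π E) (π x) (π y) ℓ
mapEnds-path π = mapPath π (mapEnds-link π)

mapEnds-link⁻ : ∀ {V W : Set} {E : Edges V} (π : V → W) →
                ∀ {p q w} → Link (mapEnds π E) p q w →
                ∃[ x ] ∃[ y ] (π x ≡ p × π y ≡ q × Link E x y w)
mapEnds-link⁻ π (along e) with ∈ˡ.∈-map⁻ _ e
... | (u , v , w) , e′ , refl = u , v , refl , refl , along e′
mapEnds-link⁻ π (against e) with ∈ˡ.∈-map⁻ _ e
... | (u , v , w) , e′ , refl = v , u , refl , refl , against e′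

link-cons : ∀ {V : Set} {E : Edges V} {e x y w} → Link E x y w → Link (e ∷ E) x y w
link-cons (along p)   = along (there p)
link-cons (against p) = against (there p)

path-cons : ∀ {V : Set} {E : Edges V} {e x y ℓ} → Path E x y ℓ → Path (e ∷ E) x y ℓ
path-cons = mapPath id link-cons

conn-cons : ∀ {V : Set} {E : Edges V} {e x y} → Conn E x y → Conn (e ∷ E) x y
conn-cons (_ , p) = _ , path-cons p

-- Joining i and j by a bridge of length w.

Via : {V : Set} → Edges V → V → V → ℕ → V → V → ℕ → Set
Via E i j w x y ℓ = ∃[ a ] ∃[ b ] (Path E x i a × Path E j y b × a + w + b ≤ ℓ)

-- Up to shortening, a path uses the bridge at most once: a second use would return to an end
-- already visited, and the detour in between can be cut out.
Cross : {V : Set} → Edges V → V → V → ℕ → V → V → ℕ → Set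
Cross E i j w x y ℓ = Path E x y ℓ ⊎ Via E i j w x y ℓ ⊎ Via E j i w x y ℓ

module _ {V : Set} {E : Edges V} where

  cross-swap : ∀ {i j w x y ℓ} → Cross E i j w x y ℓ → Cross E j i w x y ℓ
  cross-swap (inj₁ p)        = inj₁ p
  cross-swap (inj₂ (inj₁ v)) = inj₂ (inj₂ v)
  cross-swap (inj₂ (inj₂ v)) = inj₂ (inj₁ v)

  via-go : ∀ {i j w x z y v m ℓ} → Link E x z v → Via E i j w z y m → v + m ≤ ℓ →
           Via E i j w x y ℓ
  via-go {w = w} {v = v} {m} {ℓ} l (a , b , p , q , le) le′ =
    v + a , b , go l p ≤-refl , q , ≤-trans (≤-reflexive eq) (≤-trans (+-monoʳ-≤ v le) le′)
    where
    eq : v + a + w + b ≡ v + (a + w + b)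
    eq = trans (cong (_+ b) (+-assoc v a w)) (+-assoc v (a + w) b)

  cross-go : ∀ {i j w x z y v m ℓ} → Link E x z v → Cross E i j w z y m → v + m ≤ ℓ →
             Cross E i j w x y ℓ
  cross-go l (inj₁ p)        le = inj₁ (go l p le)
  cross-go l (inj₂ (inj₁ v)) le = inj₂ (inj₁ (via-go l v le))
  cross-go l (inj₂ (inj₂ v)) le = inj₂ (inj₂ (via-go l v le))

  cross-bridge : ∀ {i j w y m ℓ} → Cross E i j w j y m → w + m ≤ ℓ → Cross E i j w i y ℓ
  cross-bridge (inj₁ p) le = inj₂ (inj₁ (0 , _ , stop refl , p , le))
  cross-bridge {w = w} {m = m} (inj₂ (inj₁ (a , b , _ , q , le))) le′ =
    inj₂ (inj₁ (0 , b , stop refl , q ,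
      ≤-trans (+-monoˡ-≤ b (m≤n+m w a)) (≤-trans le (≤-trans (m≤n+m m w) le′))))
  cross-bridge {w = w} {m = m} (inj₂ (inj₂ (a , b , _ , q , le))) le′ =
    inj₁ (weaken (≤-trans (m≤n+m b (a + w)) (≤-trans le (≤-trans (m≤n+m m w) le′))) q)

  cons-cross : ∀ {i j w x y ℓ} → Path ((i , j , w) ∷ E) x y ℓ → Cross E i j w x y ℓ
  cons-cross (stop eq) = inj₁ (stop eq)
  cons-cross (go (along (here refl)) p le)    = cross-bridge (cons-cross p) le
  cons-cross (go (along (there e)) p le)      = cross-go (along e) (cons-cross p) le
  cons-cross (go (against (here refl)) p le)  =
    cross-swap (cross-bridge (cross-swap (cons-cross p)) le)
  cons-cross (go (against (there e)) p le)    = cross-go (against e) (cons-cross p) le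

Glues : {V W : Set} → (V → W) → V → V → Set
Glues π i j = ∀ {x y} → π x ≡ π y → x ≡ y ⊎ (x ≡ i × y ≡ j) ⊎ (x ≡ j × y ≡ i)

-- Gluing acts as a bridge of length 0. The path is lifted link by link; whenever it enters the
-- glued vertex at one preimage and leaves at the other, `cross-bridge` absorbs the jump. Arbitrary
-- preimages of both ends are allowed, because the induction meets both.
glue-cross : ∀ {V W : Set} {E : Edges V} {π : V → W} {i j} → Glues π i j →
             ∀ {p q ℓ} → Path (mapEnds π E) p q ℓ →
             ∀ {x y} → π x ≡ p → π y ≡ q → Cross E i j 0 x y ℓ
glue-cross glues (stop refl) px py with glues (trans px (sym py))
... | inj₁ refl                 = inj₁ (stop refl)
... | inj₂ (inj₁ (refl , refl)) = inj₂ (inj₁ (0 , 0 , stop refl , stop refl , z≤n))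
... | inj₂ (inj₂ (refl , refl)) = inj₂ (inj₂ (0 , 0 , stop refl , stop refl , z≤n))
glue-cross {π = π} glues (go l p le) px py with mapEnds-link⁻ π l
... | x₀ , z , px₀ , pz , l′ with cross-go l′ (glue-cross glues p pz py) le
... | c with glues (trans px (sym px₀))
... | inj₁ refl                 = c
... | inj₂ (inj₁ (refl , refl)) = cross-bridge c ≤-refl
... | inj₂ (inj₂ (refl , refl)) = cross-swap (cross-bridge (cross-swap c) ≤-refl)

ViaConn : {V : Set} → Edges V → V → V → V → V → Set
ViaConn E i j x y = Conn E x i × Conn E j y

CrossConn : {V : Set} → Edges V → V → V → V → V → Set
CrossConn E i j x y = Conn E x y ⊎ ViaConn E i j x y ⊎ ViaConn E j i x y

cross-conn : ∀ {V : Set} {E : Edges V} {i j w x y ℓ} →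
             Cross E i j w x y ℓ → CrossConn E i j x y
cross-conn (inj₁ p)                          = inj₁ (_ , p)
cross-conn (inj₂ (inj₁ (_ , _ , p , q , _))) = inj₂ (inj₁ ((_ , p) , (_ , q)))
cross-conn (inj₂ (inj₂ (_ , _ , p , q , _))) = inj₂ (inj₂ ((_ , p) , (_ , q)))

-- Forests, described by adding one edge at a time.

Forest : {V : Set} → Edges V → Set
Forest []                = ⊤
Forest ((u , v , _) ∷ E) = ¬ Conn E u v × Forest E

-- If an edge closed a cycle only after gluing, the path between its ends would cross from `i` to
-- `j`. Together with the edge itself it would connect `i` and `j` before gluing.
glue-forest : ∀ {V W : Set} {π : V → W} {i j} (E : Edges V) → Glues π i j →
              Forest E → ¬ Conn E i j → Forest (mapEnds π E)
glue-forest [] glues f i≁j = _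
glue-forest ((u , v , w) ∷ E) glues (u≁v , f) i≁j =
  (λ (_ , p) → bad (cross-conn (glue-cross glues p refl refl))) ,
  glue-forest E glues f (i≁j ∘ conn-cons)
  where
  uv : Conn ((u , v , w) ∷ E) u v
  uv = _ , single (along (here refl))

  bad : ¬ CrossConn E _ _ u v
  bad (inj₁ c)              = u≁v c
  bad (inj₂ (inj₁ (c , d))) =
    i≁j (conn-trans (conn-sym (conn-cons c)) (conn-trans uv (conn-sym (conn-cons d))))
  bad (inj₂ (inj₂ (c , d))) =
    i≁j (conn-trans (conn-cons d) (conn-trans (conn-sym uv) (conn-cons c)))

forest-unglue : ∀ {V W : Set} {π : V → W} (E : Edges V) → Forest (mapEnds π E) → Forest E
forest-unglue []      f         = _
forest-unglue {π = π} (e ∷ E) (u≁v , f) =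
  (λ (_ , p) → u≁v (_ , mapEnds-path π p)) , forest-unglue E f

-- A path from `i` to `j` would become a cycle. In the induction it crosses the front edge at most
-- once; if it does, its two remaining pieces, joined at the glued vertex, connect the ends of that
-- edge without it.
glue-apart : ∀ {V W : Set} {π : V → W} {i j} (E : Edges V) → i ≢ j → π i ≡ π j →
             Forest (mapEnds π E) → ¬ Conn E i j
glue-apart [] i≢j eq f (_ , stop i≡j)           = i≢j i≡j
glue-apart [] i≢j eq f (_ , go (along ()) _ _)
glue-apart [] i≢j eq f (_ , go (against ()) _ _)
glue-apart {π = π} {i} {j} ((u , v , w) ∷ E) i≢j eq (u≁v , f) (_ , p) = bad (cross-conn (cons-cross p))
  where
  E′ = mapEnds π E

  ij : Conn E′ (π i) (π j)
  ij = 0 , stop eq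

  lift : ∀ {x y} → Conn E x y → Conn E′ (π x) (π y)
  lift (_ , p) = _ , mapEnds-path π p

  bad : ¬ CrossConn E u v i j
  bad (inj₁ c)              = glue-apart E i≢j eq f c
  bad (inj₂ (inj₁ (c , d))) =
    u≁v (conn-trans (conn-sym (lift c)) (conn-trans ij (conn-sym (lift d))))
  bad (inj₂ (inj₂ (c , d))) =
    u≁v (conn-trans (lift d) (conn-trans (conn-sym ij) (lift c)))

-- Distances and eccentricities.

Dist : {V : Set} → Edges V → V → V → ℕ → Set
Dist E x y δ = Path E x y δ × (∀ {ℓ} → Path E x y ℓ → δ ≤ ℓ)

Ecc : {V : Set} → Edges V → V → ℕ → Set
Ecc E x m = (∃[ y ] Dist E x y m) × (∀ {y} → Conn E x y → Path E x y m)

dist-sym : ∀ {V : Set} {E : Edges V} {x y δ} → Dist E x y δ → Dist E y x δ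
dist-sym (p , min) = flipPath p , min ∘ flipPath

-- π realises the bridge of length w between i and j, which were not connected before.
record Merge {V W : Set} (E : Edges V) (E′ : Edges W) (π : V → W) (i j : V) (w : ℕ) : Set where
  field
    fwd    : ∀ {x y ℓ} → Path E x y ℓ → Path E′ (π x) (π y) ℓ
    bridge : Path E′ (π i) (π j) w
    bwd    : ∀ {x y ℓ} → Path E′ (π x) (π y) ℓ → Cross E i j w x y ℓ
    onto   : ∀ y → ∃[ x ] π x ≡ y
    apart  : ¬ Conn E i j

  lift : ∀ {x y} → Conn E x y → Conn E′ (π x) (π y)
  lift (_ , p) = _ , fwd p

  conn⁻ : ∀ {x y} → Conn E′ (π x) (π y) → CrossConn E i j x y
  conn⁻ (_ , p) = cross-conn (bwd p)

  conn⁺ : ∀ {x y} → CrossConn E i j x y → Conn E′ (π x) (π y)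
  conn⁺ (inj₁ c)              = lift c
  conn⁺ (inj₂ (inj₁ (c , d))) = conn-trans (lift c) (conn-trans (w , bridge) (lift d))
  conn⁺ (inj₂ (inj₂ (c , d))) =
    conn-trans (lift c) (conn-trans (w , flipPath bridge) (lift d))

  -- A crossing between vertices that were already connected would connect `i` with `j`, so every
  -- competing path is an old one.
  dist-old : ∀ {x y δ} → Dist E x y δ → Dist E′ (π x) (π y) δ
  dist-old {x} {y} {δ} (p , min) = fwd p , λ q → least (bwd q)
    where
    least : ∀ {ℓ} → Cross E i j w x y ℓ → δ ≤ ℓ
    least (inj₁ q) = min q
    least (inj₂ (inj₁ (_ , _ , q , r , _))) =
      ⊥-elim (apart (_ , flipPath q ⧺ (p ⧺ flipPath r)))
    least (inj₂ (inj₂ (_ , _ , q , r , _))) =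
      ⊥-elim (apart (_ , r ⧺ (flipPath p ⧺ q)))

  via-least : ∀ {x y a b ℓ} → Dist E x i a → Dist E j y b → Path E′ (π x) (π y) ℓ → a + w + b ≤ ℓ
  via-least {x} {y} {a} {b} (p , minp) (q , minq) r = least (bwd r)
    where
    least : ∀ {ℓ} → Cross E i j w x y ℓ → a + w + b ≤ ℓ
    least (inj₁ r) = ⊥-elim (apart (_ , flipPath p ⧺ (r ⧺ flipPath q)))
    least (inj₂ (inj₁ (_ , _ , r , s , le))) =
      ≤-trans (+-mono-≤ (+-monoˡ-≤ w (minp r)) (minq s)) le
    least (inj₂ (inj₂ (_ , _ , r , s , _))) = ⊥-elim (apart (_ , flipPath p ⧺ r))

  dist-via : ∀ {x y a b} → Dist E x i a → Dist E j y b → Dist E′ (π x) (π y) (a + w + b)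
  dist-via da db = ((fwd (proj₁ da) ⧺ bridge) ⧺ fwd (proj₁ db)) , via-least da db

  -- The new vertices reachable from x lie behind j.
  ecc-via : ∀ {x m a n M} → Dist E x i a → Ecc E x m → Ecc E j n →
            m ≤ M → a + w + n ≤ M → (M ≡ m ⊎ M ≡ a + w + n) → Ecc E′ (π x) M
  ecc-via {x} {m} {a} {n} {M} dx ((y , dy) , far) ((z , dz) , farj) m≤M v≤M which =
    attained which , λ {p} → below p
    where
    attained : (M ≡ m ⊎ M ≡ a + w + n) → ∃[ p ] Dist E′ (π x) p M
    attained (inj₁ refl) = π y , dist-old dy
    attained (inj₂ refl) = π z , dist-via dx dz

    below : ∀ p → Conn E′ (π x) p → Path E′ (π x) p M
    below p c with onto p
    ... | y , refl with conn⁻ c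
    ... | inj₁ d              = weaken m≤M (fwd (far d))
    ... | inj₂ (inj₁ (_ , d)) = weaken v≤M ((fwd (proj₁ dx) ⧺ bridge) ⧺ fwd (farj d))
    ... | inj₂ (inj₂ (d , _)) = ⊥-elim (apart (conn-trans (conn-sym (_ , proj₁ dx)) d))

  ecc-old : ∀ {x m} → ¬ Conn E x i → ¬ Conn E x j → Ecc E x m → Ecc E′ (π x) m
  ecc-old {x} {m} x≁i x≁j ((y , dy) , far) = (π y , dist-old dy) , λ {p} → below p
    where
    below : ∀ p → Conn E′ (π x) p → Path E′ (π x) p m
    below p c with onto p
    ... | y , refl with conn⁻ c
    ... | inj₁ d              = fwd (far d)
    ... | inj₂ (inj₁ (d , _)) = ⊥-elim (x≁i d)
    ... | inj₂ (inj₂ (d , _)) = ⊥-elim (x≁j d)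

swap : ∀ {V W : Set} {E : Edges V} {E′ : Edges W} {π i j w} →
       Merge E E′ π i j w → Merge E E′ π j i w
swap M = record
  { fwd = fwd ; bridge = flipPath bridge ; bwd = cross-swap ∘ bwd
  ; onto = onto ; apart = apart ∘ conn-sym }
  where open Merge M

cons-merge : ∀ {V : Set} {E : Edges V} {i j w} → ¬ Conn E i j →
             Merge E ((i , j , w) ∷ E) id i j w
cons-merge apart = record
  { fwd = path-cons ; bridge = single (along (here refl)) ; bwd = cons-cross
  ; onto = λ y → y , refl ; apart = apart }

glue-merge : ∀ {V W : Set} {E : Edges V} {π : V → W} {i j} → Glues π i j → π i ≡ π j →
             (∀ y → ∃[ x ] π x ≡ y) → ¬ Conn E i j → Merge E (mapEnds π E) π i j 0
glue-merge {π = π} glues eq onto apart = record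
  { fwd = mapEnds-path π ; bridge = stop eq ; bwd = λ p → glue-cross glues p refl refl
  ; onto = onto ; apart = apart }

-- Numerical truth values and arithmetic expressions.

data Ref : ℕ → Set → Set₁ where
  holds  : ∀ {P} → P → Ref 1 P
  fails : ∀ {P} → ¬ P → Ref 0 P

ref-map : ∀ {n P Q} → (P → Q) → (Q → P) → Ref n P → Ref n Q
ref-map f g (holds p)   = holds (f p)
ref-map f g (fails ¬p) = fails (¬p ∘ g)

ref≤1 : ∀ {n P} → Ref n P → n ≤ 1
ref≤1 (holds _)  = ≤-refl
ref≤1 (fails _) = z≤n

ifN : {A : Set} → ℕ → A → A → A
ifN zero    a b = a
ifN (suc _) a b = b

-- Restricted to what the programming language does with numbers, so that each constructor compiles
-- to one of its constructs and the cost can be read off the expression.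
data AExp (X : Set) : Set where
  avar       : X → AExp X
  alit       : ℕ → AExp X
  _⊕_ _⊖_    : AExp X → AExp X → AExp X
  if0        : AExp X → AExp X → AExp X → AExp X

aeval : ∀ {X} → (X → ℕ) → AExp X → ℕ
aeval ρ (avar x)    = ρ x
aeval ρ (alit n)    = n
aeval ρ (a ⊕ b)     = aeval ρ a + aeval ρ b
aeval ρ (a ⊖ b)     = aeval ρ a ∸ aeval ρ b
aeval ρ (if0 a b c) = ifN (aeval ρ a) (aeval ρ b) (aeval ρ c)

module _ {X : Set} where

  andE orE leE maxE : AExp X → AExp X → AExp X
  andE a b = if0 a (alit 0) b
  orE  a b = if0 a b (alit 1)
  leE  a b = if0 (a ⊖ b) (alit 1) (alit 0)
  maxE a b = if0 (a ⊖ b) b a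

  notE : AExp X → AExp X
  notE a = if0 a (alit 1) (alit 0)

  allE anyE : ∀ {n} → (Fin n → AExp X) → AExp X
  allE {zero}  f = alit 1
  allE {suc n} f = andE (f zero) (allE (f ∘ suc))
  anyE {zero}  f = alit 0
  anyE {suc n} f = orE (f zero) (anyE (f ∘ suc))

ref-and : ∀ {a b P Q} → Ref a P → Ref b Q → Ref (ifN a 0 b) (P × Q)
ref-and (holds p)   (holds q)   = holds (p , q)
ref-and (holds p)   (fails ¬q) = fails (¬q ∘ proj₂)
ref-and (fails ¬p) _          = fails (¬p ∘ proj₁)

ref-or : ∀ {a b P Q} → Ref a P → Ref b Q → Ref (ifN a b 1) (P ⊎ Q)
ref-or (holds p)   _          = holds (inj₁ p)
ref-or (fails ¬p) (holds q)   = holds (inj₂ q)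
ref-or (fails ¬p) (fails ¬q) = fails [ ¬p , ¬q ]′

ref-not : ∀ {a P} → Ref a P → Ref (ifN a 1 0) (¬ P)
ref-not (holds p)   = fails λ ¬p → ¬p p
ref-not (fails ¬p) = holds ¬p

ref-le : ∀ a b → Ref (ifN (a ∸ b) 1 0) (a ≤ b)
ref-le a b with a ∸ b in eq
... | zero  = holds (ℕ.m∸n≡0⇒m≤n eq)
... | suc _ = fails λ a≤b → ℕ.1+n≢0 (trans (sym eq) (ℕ.m≤n⇒m∸n≡0 a≤b))

suc≢0 : ∀ {m n} → m ≡ suc n → m ≢ 0
suc≢0 refl ()

∸-positive : ∀ {m n o} → m ∸ n ≡ suc o → n ≤ m
∸-positive eq = ℕ.<⇒≤ (ℕ.m∸n≢0⇒n<m (suc≢0 eq))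

max-upper : ∀ a b → a ≤ ifN (a ∸ b) b a × b ≤ ifN (a ∸ b) b a ×
            (ifN (a ∸ b) b a ≡ a ⊎ ifN (a ∸ b) b a ≡ b)
max-upper a b with a ∸ b in eq
... | zero  = ℕ.m∸n≡0⇒m≤n eq , ≤-refl , inj₂ refl
... | suc n = ≤-refl , ∸-positive eq , inj₁ refl

module _ {X : Set} (ρ : X → ℕ) where

  ref-all : ∀ {n} (f : Fin n → AExp X) {P : Fin n → Set} → (∀ i → Ref (aeval ρ (f i)) (P i)) →
            Ref (aeval ρ (allE f)) (∀ i → P i)
  ref-all {zero}  f r = holds λ ()
  ref-all {suc n} f r = ref-map (λ { (p , ps) zero → p ; (p , ps) (suc i) → ps i })
    (λ ps → ps zero , ps ∘ suc) (ref-and (r zero) (ref-all (f ∘ suc) (r ∘ suc)))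

  ref-any : ∀ {n} (f : Fin n → AExp X) {P : Fin n → Set} → (∀ i → Ref (aeval ρ (f i)) (P i)) →
            Ref (aeval ρ (anyE f)) (∃[ i ] P i)
  ref-any {zero}  f r = fails λ ()
  ref-any {suc n} f r = ref-map
    [ (λ p → zero , p) , (λ (i , p) → suc i , p) ]′
    (λ { (zero , p) → inj₁ p ; (suc i , p) → inj₂ (i , p) })
    (ref-or (r zero) (ref-any (f ∘ suc) (r ∘ suc)))

-- Signatures.

data Var (t : ℕ) : Set where
  same conn dist : (i j : Fin t) → Var t
  ecc            : (i : Fin t) → Var t

Sig : Set → ℕ → Set
Sig X t = Var t → AExp X

Anchored : {V : Set} {t : ℕ} → Edges V → (Fin t → V) → V → Set
Anchored E τ x = ∃[ i ] Conn E x (τ i)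

-- The partial solutions worth keeping.  Only a component that is the whole
-- graph may lack a terminal.
record Alive (D : ℕ) {V : Set} {t : ℕ} (E : Edges V) (τ : Fin t → V) : Set where
  field
    forest   : Forest E
    near     : ∀ {x y} → Conn E x y → Path E x y D
    anchored : ∀ x y → Conn E x y ⊎ (Anchored E τ x × Anchored E τ y)

  anchor : Fin t → ∀ x → Anchored E τ x
  anchor i x with anchored x (τ i)
  ... | inj₁ c       = i , c
  ... | inj₂ (a , _) = a

-- Without a path the value is pinned to 0. A distance entry is thus a number within the bound in
-- all cases, and the count of signatures covers unconnected pairs too.
OptDist : {V : Set} → Edges V → V → V → ℕ → Set
OptDist E x y n = Dist E x y n ⊎ (¬ Conn E x y × n ≡ 0)

record Rep {V : Set} {t : ℕ} (E : Edges V) (τ : Fin t → V) (σ : Var t → ℕ) : Set₁ where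
  field
    same-ref : ∀ i j → Ref (σ (same i j)) (τ i ≡ τ j)
    conn-ref : ∀ i j → Ref (σ (conn i j)) (Conn E (τ i) (τ j))
    dist-opt : ∀ i j → OptDist E (τ i) (τ j) (σ (dist i j))
    ecc-is   : ∀ i → Ecc E (τ i) (σ (ecc i))

-- The signature is promised only for selections that are alive. The update formulas assume that a
-- bridge joins different components, so they say nothing about dead selections, which never enter a
-- table.
Summary : ℕ → {V : Set} {t : ℕ} → Edges V → (Fin t → V) → ℕ → (Var t → ℕ) → Set₁
Summary D E τ ok σ = Ref ok (Alive D E τ) × (Alive D E τ → Rep E τ σ)

-- Distances and eccentricities are at most `D`, truth values at most 1. The bound `2 + D` covers
-- the latter even for `D = 0`.
signature-bound : ∀ {D V t} {E : Edges V} {τ : Fin t → V} {σ} →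
                  Alive D E τ → Rep E τ σ → ∀ v → σ v < 2 + D
signature-bound {D} {E = E} {τ} {σ} alive rep = bound
  where
  open Alive alive
  open Rep rep
  bound : ∀ v → σ v < 2 + D
  bound (same i j) = s≤s (≤-trans (ref≤1 (same-ref i j)) (s≤s z≤n))
  bound (conn i j) = s≤s (≤-trans (ref≤1 (conn-ref i j)) (s≤s z≤n))
  bound (dist i j) with dist-opt i j
  ... | inj₁ (p , min) = s≤s (ℕ.m≤n⇒m≤1+n (min (near (_ , p))))
  ... | inj₂ (_ , eq)  = subst (_< 2 + D) (sym eq) (s≤s z≤n)
  bound (ecc i) with ecc-is i
  ... | (y , p , min) , _ = s≤s (ℕ.m≤n⇒m≤1+n (min (flipPath (near (_ , flipPath p)))))

module _ {D : ℕ} {V : Set} {t : ℕ} {E : Edges V} {τ τ′ : Fin t → V} (eq : ∀ i → τ i ≡ τ′ i) where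

  alive-cong : Alive D E τ → Alive D E τ′
  alive-cong alive = record { forest = forest ; near = near ; anchored = λ x y → [ inj₁ , inj₂ ∘ both ]′ (anchored x y) }
    where
    open Alive alive
    move : ∀ {x} → Anchored E τ x → Anchored E τ′ x
    move (i , c) = i , subst (Conn E _) (eq i) c
    both : ∀ {x y} → Anchored E τ x × Anchored E τ y → Anchored E τ′ x × Anchored E τ′ y
    both (a , b) = move a , move b

  rep-cong : ∀ {σ} → Rep E τ σ → Rep E τ′ σ
  rep-cong {σ} rep = record
    { same-ref = λ i j → subst₂ (λ x y → Ref (σ (same i j)) (x ≡ y)) (eq i) (eq j) (same-ref i j)
    ; conn-ref = λ i j → subst₂ (λ x y → Ref (σ (conn i j)) (Conn E x y)) (eq i) (eq j) (conn-ref i j)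
    ; dist-opt = λ i j → subst₂ (λ x y → OptDist E x y (σ (dist i j))) (eq i) (eq j) (dist-opt i j)
    ; ecc-is   = λ i → subst (λ x → Ecc E x (σ (ecc i))) (eq i) (ecc-is i) }
    where open Rep rep

summary-cong : ∀ {D V t} {E : Edges V} {τ τ′ : Fin t → V} {ok σ} → (∀ i → τ i ≡ τ′ i) →
               Summary D E τ ok σ → Summary D E τ′ ok σ
summary-cong {D} {E = E} {τ} {τ′} eq (ok , rep) =
  ref-map (alive-cong eq) back ok , rep-cong {D = D} eq ∘ rep ∘ back
  where
  back : Alive D E τ′ → Alive D E τ
  back = alive-cong (sym ∘ eq)

-- Merging two terminals by an edge or by identification.

module _ {V W : Set} {E : Edges V} {E′ : Edges W} {π : V → W} {i j : V} {w : ℕ}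
         (M : Merge E E′ π i j w) where
  open Merge M

  merge-dist : ∀ {x y c₁ c₂ c₃ c₄ c₅ d₁ d₂ d₃ d₄ d₅} →
    Ref c₁ (Conn E x y) → Ref c₂ (Conn E x i) → Ref c₃ (Conn E j y) →
    Ref c₄ (Conn E x j) → Ref c₅ (Conn E i y) →
    OptDist E x y d₁ → OptDist E x i d₂ → OptDist E j y d₃ →
    OptDist E x j d₄ → OptDist E i y d₅ →
    OptDist E′ (π x) (π y)
      (ifN c₁ (ifN (ifN c₂ 0 c₃) (ifN (ifN c₄ 0 c₅) 0 (d₄ + w + d₅)) (d₂ + w + d₃)) d₁)
  merge-dist {x} {y} r₁ r₂ r₃ r₄ r₅ o₁ o₂ o₃ o₄ o₅ = step₁ r₁
    where
    get : ∀ {x y n} → Conn E x y → OptDist E x y n → Dist E x y n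
    get c (inj₁ d)        = d
    get c (inj₂ (¬c , _)) = contradiction c ¬c

    step₃ : ∀ {c} → Ref c (ViaConn E j i x y) → ¬ Conn E x y → ¬ ViaConn E i j x y →
            OptDist E′ (π x) (π y) (ifN c 0 _)
    step₃ (holds (c , d)) ¬p ¬q = inj₁ (Merge.dist-via (swap M) (get c o₄) (get d o₅))
    step₃ (fails ¬r) ¬p ¬q     = inj₂ ([ ¬p , [ ¬q , ¬r ]′ ]′ ∘ conn⁻ , refl)

    step₂ : ∀ {c} → Ref c (ViaConn E i j x y) → ¬ Conn E x y →
            OptDist E′ (π x) (π y) (ifN c _ _)
    step₂ (holds (c , d)) ¬p = inj₁ (dist-via (get c o₂) (get d o₃))
    step₂ (fails ¬q) ¬p     = step₃ (ref-and r₄ r₅) ¬p ¬q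

    step₁ : ∀ {c} → Ref c (Conn E x y) → OptDist E′ (π x) (π y) (ifN c _ _)
    step₁ (holds c)   = inj₁ (dist-old (get c o₁))
    step₁ (fails ¬p) = step₂ (ref-and r₂ r₃) ¬p

  -- Seen from `x` on the side of `i`, the new vertices all lie behind `j`, the farthest at
  -- `a + w + n₂`; the other side is symmetric, and a vertex connected to neither end keeps its
  -- eccentricity.
  merge-ecc : ∀ {x c₁ c₂ m a b n₁ n₂} →
    Ref c₁ (Conn E x i) → Ref c₂ (Conn E x j) → Ecc E x m →
    OptDist E x i a → OptDist E x j b → Ecc E i n₁ → Ecc E j n₂ →
    Ecc E′ (π x) (ifN c₁ (ifN c₂ m (ifN (m ∸ (b + w + n₁)) (b + w + n₁) m))
                     (ifN (m ∸ (a + w + n₂)) (a + w + n₂) m))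
  merge-ecc {m = m} {a} {b} {n₁} {n₂} (holds c) r₂ ex (inj₁ da) _ ei ej =
    let (le , le′ , which) = max-upper m (a + w + n₂) in ecc-via da ex ej le le′ which
  merge-ecc (holds c) r₂ ex (inj₂ (¬c , _)) _ ei ej = contradiction c ¬c
  merge-ecc {m = m} {a} {b} {n₁} {n₂} (fails _) (holds c) ex _ (inj₁ db) ei ej =
    let (le , le′ , which) = max-upper m (b + w + n₁) in
    Merge.ecc-via (swap M) db ex ei le le′ which
  merge-ecc (fails _) (holds c) ex _ (inj₂ (¬c , _)) ei ej = contradiction c ¬c
  merge-ecc (fails ¬c) (fails ¬d) ex _ _ ei ej = ecc-old ¬c ¬d ex

module _ {D : ℕ} {V W : Set} {t : ℕ} {E : Edges V} {E′ : Edges W} {π : V → W}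
         {τ : Fin t → V} {i j : Fin t} {w : ℕ} (M : Merge E E′ π (τ i) (τ j) w) where
  open Merge M

  -- The direction that makes discarding safe. Old paths lose nothing when the bridge is removed,
  -- and a component that reached its terminal only across the bridge contains an end of the bridge,
  -- which is itself a terminal.
  unmerge : Forest E → Alive D E′ (π ∘ τ) → Alive D E τ
  unmerge f alive = record { forest = f ; near = near′ ; anchored = anchored′ }
    where
    open Alive alive
    near′ : ∀ {x y} → Conn E x y → Path E x y D
    near′ {x} {y} c = old (bwd (near (lift c)))
      where
      old : Cross E (τ i) (τ j) w x y D → Path E x y D
      old (inj₁ p) = p
      old (inj₂ (inj₁ (_ , _ , p , q , _))) =
        ⊥-elim (apart (conn-trans (_ , flipPath p) (conn-trans c (_ , flipPath q))))
      old (inj₂ (inj₂ (_ , _ , p , q , _))) =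
        ⊥-elim (apart (conn-trans (_ , q) (conn-trans (conn-sym c) (_ , p))))
    move : ∀ {x} → Anchored E′ (π ∘ τ) (π x) → Anchored E τ x
    move (k , c) with conn⁻ c
    ... | inj₁ d              = k , d
    ... | inj₂ (inj₁ (d , _)) = i , d
    ... | inj₂ (inj₂ (d , _)) = j , d
    anchored′ : ∀ x y → Conn E x y ⊎ (Anchored E τ x × Anchored E τ y)
    anchored′ x y with anchored (π x) (π y)
    ... | inj₂ (a , b) = inj₂ (move a , move b)
    ... | inj₁ c with conn⁻ c
    ... | inj₁ d               = inj₁ d
    ... | inj₂ (inj₁ (d , d′)) = inj₂ ((i , d) , (j , conn-sym d′))
    ... | inj₂ (inj₂ (d , d′)) = inj₂ ((j , d) , (i , conn-sym d′))

  -- The vertices farthest from the two ends are at distance exactly `m + w + n` after the merge, so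
  -- the test on eccentricities is necessary; `merge-alive` shows that it suffices.
  merged-near : ∀ {m n} → Ecc E (τ i) m → Ecc E (τ j) n → Alive D E′ (π ∘ τ) → m + w + n ≤ D
  merged-near ((x , dx) , _) ((y , dy) , _) alive =
    via-least (dist-sym dx) dy
      (Alive.near alive (_ , (fwd (flipPath (proj₁ dx)) ⧺ bridge) ⧺ fwd (proj₁ dy)))

  merge-alive : ∀ {m n} → Ecc E (τ i) m → Ecc E (τ j) n → m + w + n ≤ D →
                Forest E′ → Alive D E τ → Alive D E′ (π ∘ τ)
  merge-alive {m} {n} (_ , fari) (_ , farj) le f alive = record
    { forest = f ; near = λ {p} {q} → near′ p q ; anchored = anchored′ }
    where
    open Alive alive
    shift : n + w + m ≤ D
    shift = ≤-trans (≤-reflexive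
      (trans (+-comm (n + w) m) (trans (cong (m +_) (+-comm n w)) (sym (+-assoc m w n))))) le
    near′ : ∀ p q → Conn E′ p q → Path E′ p q D
    near′ p q c with onto p | onto q
    ... | x , refl | y , refl with conn⁻ c
    ... | inj₁ d               = fwd (near d)
    ... | inj₂ (inj₁ (d , d′)) = weaken le
      ((fwd (flipPath (fari (conn-sym d))) ⧺ bridge) ⧺ fwd (farj d′))
    ... | inj₂ (inj₂ (d , d′)) = weaken shift
      ((fwd (flipPath (farj (conn-sym d))) ⧺ flipPath bridge) ⧺ fwd (fari d′))
    anchored′ : ∀ p q → Conn E′ p q ⊎ (Anchored E′ (π ∘ τ) p × Anchored E′ (π ∘ τ) q)
    anchored′ p q with onto p | onto q
    ... | x , refl | y , refl with anchored x y
    ... | inj₁ c                     = inj₁ (lift c)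
    ... | inj₂ ((k , c) , (l , c′)) = inj₂ ((k , lift c) , (l , lift c′))

-- Operations act on signatures symbolically, so that each of them becomes
-- straight-line code, whose running time depends on the class alone.
record State (X : Set) (t : ℕ) : Set where
  constructor state
  field
    ok  : AExp X
    sig : Sig X t

Summarises : ∀ {X t} → (X → ℕ) → ℕ → {V : Set} → Edges V → (Fin t → V) → State X t → Set₁
Summarises ρ D E τ s = Summary D E τ (aeval ρ ok) (aeval ρ ∘ sig)
  where open State s

module _ {X : Set} {t : ℕ} (i j : Fin t) (w : AExp X) where

  -- The new coincidence relation is a parameter, since an added edge leaves it unchanged whereas an
  -- identification enlarges it.
  mergeSig : (Fin t → Fin t → AExp X) → Sig X t → Sig X t
  mergeSig same′ s (same a b) = same′ a b
  mergeSig same′ s (conn a b) =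
    orE (s (conn a b)) (orE (andE (s (conn a i)) (s (conn j b))) (andE (s (conn a j)) (s (conn i b))))
  mergeSig same′ s (dist a b) =
    if0 (s (conn a b))
      (if0 (andE (s (conn a i)) (s (conn j b)))
        (if0 (andE (s (conn a j)) (s (conn i b))) (alit 0) ((s (dist a j) ⊕ w) ⊕ s (dist i b)))
        ((s (dist a i) ⊕ w) ⊕ s (dist j b)))
      (s (dist a b))
  mergeSig same′ s (ecc a) =
    if0 (s (conn a i))
      (if0 (s (conn a j)) (s (ecc a)) (maxE (s (ecc a)) ((s (dist a j) ⊕ w) ⊕ s (ecc i))))
      (maxE (s (ecc a)) ((s (dist a i) ⊕ w) ⊕ s (ecc j)))

  mergeState : AExp X → (Fin t → Fin t → AExp X) → State X t → State X t
  mergeState bound same′ (state ok s) = state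
    (andE ok (andE (notE (s (conn i j))) (leE ((s (ecc i) ⊕ w) ⊕ s (ecc j)) bound)))
    (mergeSig same′ s)

  merge-rep : ∀ {V W : Set} {E : Edges V} {E′ : Edges W} {π : V → W} {τ : Fin t → V}
    (ρ : X → ℕ) {s : Sig X t} {same′ : Fin t → Fin t → AExp X} →
    Merge E E′ π (τ i) (τ j) (aeval ρ w) →
    (∀ a b → Ref (aeval ρ (same′ a b)) (π (τ a) ≡ π (τ b))) →
    Rep E τ (aeval ρ ∘ s) → Rep E′ (π ∘ τ) (aeval ρ ∘ mergeSig same′ s)
  merge-rep ρ M same-ref′ rep = record
    { same-ref = same-ref′
    ; conn-ref = λ a b → ref-map conn⁺ conn⁻
        (ref-or (conn-ref a b) (ref-or (ref-and (conn-ref a i) (conn-ref j b))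
                                       (ref-and (conn-ref a j) (conn-ref i b))))
    ; dist-opt = λ a b → merge-dist M
        (conn-ref a b) (conn-ref a i) (conn-ref j b) (conn-ref a j) (conn-ref i b)
        (dist-opt a b) (dist-opt a i) (dist-opt j b) (dist-opt a j) (dist-opt i b)
    ; ecc-is   = λ a → merge-ecc M (conn-ref a i) (conn-ref a j) (ecc-is a)
        (dist-opt a i) (dist-opt a j) (ecc-is i) (ecc-is j)
    }
    where
    open Merge M
    open Rep rep

  -- The common core of added edges and identifications, which differ in how the forest property is
  -- transferred and in the relation `same`. By `back`, a dead operand gives a dead result; hence
  -- the signature is consulted only where it is known to be right.
  merge-summary : ∀ {V W : Set} {E : Edges V} {E′ : Edges W} {π : V → W} {τ : Fin t → V}
    (ρ : X → ℕ) {bound : AExp X} {s : State X t} {same′ : Fin t → Fin t → AExp X} →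
    (Forest E′ → Forest E × ¬ Conn E (τ i) (τ j)) →
    (Forest E → ¬ Conn E (τ i) (τ j) → Forest E′) →
    (¬ Conn E (τ i) (τ j) → Merge E E′ π (τ i) (τ j) (aeval ρ w)) →
    (Rep E τ (aeval ρ ∘ State.sig s) → ∀ a b → Ref (aeval ρ (same′ a b)) (π (τ a) ≡ π (τ b))) →
    Summarises ρ (aeval ρ bound) E τ s →
    Summarises ρ (aeval ρ bound) E′ (π ∘ τ) (mergeState bound same′ s)
  merge-summary {E = E} {E′} {π} {τ} ρ {bound} {s} forest⁻ forest⁺ mk same-ref′ (ok , rep) =
    decide ok , λ a′ → merge-rep {τ = τ} ρ (mk (proj₂ (back a′))) (same-ref′ (rep (proj₁ (back a′)))) (rep (proj₁ (back a′)))
    where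
    D = aeval ρ bound

    back : Alive D E′ (π ∘ τ) → Alive D E τ × ¬ Conn E (τ i) (τ j)
    back a′ = let (f , apart) = forest⁻ (Alive.forest a′) in unmerge {τ = τ} {i = i} {j} (mk apart) f a′ , apart

    open State s using (sig)

    decide : ∀ {n} → Ref n (Alive D E τ) →
             Ref (ifN n 0 (ifN (ifN (aeval ρ (sig (conn i j))) 1 0) 0
                    (ifN (aeval ρ (sig (ecc i)) + aeval ρ w + aeval ρ (sig (ecc j)) ∸ D) 1 0)))
                 (Alive D E′ (π ∘ τ))
    decide (fails ¬a) = fails (¬a ∘ proj₁ ∘ back)
    decide (holds a)   = ref-map
      (λ (apart , le) → merge-alive {τ = τ} {i = i} {j} (mk apart) (ecc-is i) (ecc-is j) le (forest⁺ forest apart) a)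
      (λ a′ → let (_ , apart) = back a′ in apart , merged-near {τ = τ} {i = i} {j} (mk apart) (ecc-is i) (ecc-is j) a′)
      (ref-and (ref-not (conn-ref i j)) (ref-le _ _))
      where
      open Rep (rep a)
      open Alive a

rep-ext : ∀ {V t} {E : Edges V} {τ : Fin t → V} {σ σ′} → (∀ v → σ v ≡ σ′ v) → Rep E τ σ → Rep E τ σ′
rep-ext {E = E} {τ} eq rep = record
  { same-ref = λ i j → subst (λ n → Ref n (τ i ≡ τ j)) (eq (same i j)) (same-ref i j)
  ; conn-ref = λ i j → subst (λ n → Ref n (Conn E (τ i) (τ j))) (eq (conn i j)) (conn-ref i j)
  ; dist-opt = λ i j → subst (OptDist E (τ i) (τ j)) (eq (dist i j)) (dist-opt i j)
  ; ecc-is   = λ i → subst (Ecc E (τ i)) (eq (ecc i)) (ecc-is i) }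
  where open Rep rep

summary-ext : ∀ {D V t} {E : Edges V} {τ : Fin t → V} {ok ok′ σ σ′} → ok ≡ ok′ →
              (Alive D E τ → ∀ v → σ v ≡ σ′ v) → Summary D E τ ok σ → Summary D E τ ok′ σ′
summary-ext refl eq (ok , rep) = ok , λ a → rep-ext (eq a) (rep a)

ref-yes : ∀ {n P} → Ref n P → P → n ≡ 1
ref-yes (holds _)   p = refl
ref-yes (fails ¬p) p = contradiction p ¬p

ref-no : ∀ {n P} → Ref n P → ¬ P → n ≡ 0
ref-no (holds p)  ¬p = contradiction p ¬p
ref-no (fails _) ¬p = refl

module _ {X : Set} {t : ℕ} (bound : AExp X) (i j : Fin t) where

  addEdgeState : AExp X → State X t → State X t
  addEdgeState w s = mergeState i j w bound (λ a b → State.sig s (same a b)) s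

  addEdge-summary : ∀ {V : Set} {E : Edges V} {τ : Fin t → V} (ρ : X → ℕ) {w : AExp X} {s : State X t} →
    Summarises ρ (aeval ρ bound) E τ s →
    Summarises ρ (aeval ρ bound) ((τ i , τ j , aeval ρ w) ∷ E) τ (addEdgeState w s)
  addEdge-summary {τ = τ} ρ {w} {s} =
    merge-summary i j w {π = id} {τ} ρ {bound} {s} (λ (¬c , f) → f , ¬c) (λ f ¬c → ¬c , f) cons-merge Rep.same-ref

alive-uncons : ∀ {D V t} {E : Edges V} {τ : Fin t → V} {i j w} →
               Alive D ((τ i , τ j , w) ∷ E) τ → Alive D E τ
alive-uncons {τ = τ} {i} {j} a = let (¬c , f) = Alive.forest a in unmerge {τ = τ} {i} {j} (cons-merge ¬c) f a

Quotient : {V : Set} → V → V → (W : Set) → (V → W) → Set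
Quotient i j W π = i ≢ j × Glues π i j × π i ≡ π j × (∀ y → ∃[ x ] π x ≡ y)

alive-unglue : ∀ {D V W t} {E : Edges V} {π : V → W} {τ : Fin t → V} {i j} →
               Quotient (τ i) (τ j) W π → Alive D (mapEnds π E) (π ∘ τ) → Alive D E τ
alive-unglue {E = E} {τ = τ} {i} {j} (i≢j , glues , eq , onto) a = unmerge {τ = τ} {i} {j}
  (glue-merge glues eq onto (glue-apart E i≢j eq (Alive.forest a))) (forest-unglue E (Alive.forest a)) a

module _ {X : Set} {t : ℕ} (bound : AExp X) (i j : Fin t) where

  glueState : State X t → State X t
  glueState s = mergeState i j (alit 0) bound
    (λ a b → orE (sig (same a b))
                 (orE (andE (sig (same a i)) (sig (same b j))) (andE (sig (same a j)) (sig (same b i))))) s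
    where open State s

  -- Terminals that already coincide are connected, so `glueState` would report a cycle. Identifying
  -- them changes nothing and must be told apart first.
  identifyState : State X t → State X t
  identifyState s = state (if0 (sig (same i j)) (State.ok (glueState s)) ok)
                          (λ v → if0 (sig (same i j)) (State.sig (glueState s) v) (sig v))
    where open State s

  glue-summary : ∀ {V W : Set} {E : Edges V} {π : V → W} {τ : Fin t → V} (ρ : X → ℕ) {s : State X t} →
    Quotient (τ i) (τ j) W π → Summarises ρ (aeval ρ bound) E τ s →
    Summarises ρ (aeval ρ bound) (mapEnds π E) (π ∘ τ) (glueState s)
  glue-summary {E = E} {π} {τ} ρ {s} (i≢j , glues , eq , onto) =
    merge-summary i j (alit 0) {π = π} {τ} ρ {bound} {s}
      (λ f → forest-unglue E f , glue-apart E i≢j eq f) (glue-forest E glues)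
      (glue-merge glues eq onto)
      λ rep a b → let open Rep rep in ref-map
        [ cong π , [ (λ (p , q) → trans (cong π p) (trans eq (sym (cong π q))))
                   , (λ (p , q) → trans (cong π p) (trans (sym eq) (sym (cong π q)))) ]′ ]′
        glues
        (ref-or (same-ref a b) (ref-or (ref-and (same-ref a i) (same-ref b j))
                                       (ref-and (same-ref a j) (same-ref b i))))

  identify-same : ∀ {V : Set} {E : Edges V} {τ : Fin t → V} (ρ : X → ℕ) {s : State X t} →
    τ i ≡ τ j → Summarises ρ (aeval ρ bound) E τ s →
    Summarises ρ (aeval ρ bound) E τ (identifyState s)
  identify-same {E = E} {τ} ρ {s} i≡j (ok , rep) = summary-ext
    (ok-eq ok λ a → ref-yes (Rep.same-ref (rep a) i j) i≡j)
    (λ a v → cong (λ n → ifN n (aeval ρ (State.sig (glueState s) v)) (aeval ρ (sig v))) (sym (ref-yes (Rep.same-ref (rep a) i j) i≡j)))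
    (ok , rep)
    where
    open State s using (sig)
    -- For a dead selection the entry `m` for `same` is arbitrary; both branches then evaluate to 0.
    ok-eq : ∀ {n m x} → Ref n (Alive (aeval ρ bound) E τ) → (Alive (aeval ρ bound) E τ → m ≡ 1) →
            n ≡ ifN m (ifN n 0 x) n
    ok-eq {m = zero}  (holds a)  f = contradiction (f a) λ ()
    ok-eq {m = suc _} (holds a)  f = refl
    ok-eq {m = zero}  (fails _) f = refl
    ok-eq {m = suc _} (fails _) f = refl

  identify-distinct : ∀ {V W : Set} {E : Edges V} {π : V → W} {τ : Fin t → V} (ρ : X → ℕ) {s : State X t} →
    Quotient (τ i) (τ j) W π → Summarises ρ (aeval ρ bound) E τ s →
    Summarises ρ (aeval ρ bound) (mapEnds π E) (π ∘ τ) (identifyState s)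
  identify-distinct {E = E} {π} {τ} ρ {s} quot (ok , rep) = summary-ext
    (ok-eq ok λ a → ref-no (Rep.same-ref (rep a) i j) (proj₁ quot))
    (λ a v → cong (λ n → ifN n (aeval ρ (State.sig (glueState s) v)) (aeval ρ (sig v)))
      (sym (ref-no (Rep.same-ref (rep (alive-unglue {τ = τ} {i} {j} quot a)) i j) (proj₁ quot))))
    (glue-summary {τ = τ} ρ {s} quot (ok , rep))
    where
    open State s using (sig)
    ok-eq : ∀ {n m x} → Ref n (Alive (aeval ρ bound) E τ) → (Alive (aeval ρ bound) E τ → m ≡ 0) →
            ifN n 0 x ≡ ifN m (ifN n 0 x) n
    ok-eq {m = suc _} (holds a)  f = contradiction (f a) λ ()
    ok-eq {m = zero}  (holds a)  f = refl
    ok-eq {m = zero}  (fails _) f = refl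
    ok-eq {m = suc _} (fails _) f = refl

-- Graphs without edges.

δ : ∀ {n} → Fin n → Fin n → ℕ
δ i j with i Finₚ.≟ j
... | yes _ = 1
... | no _  = 0

δ-ref : ∀ {n} (i j : Fin n) → Ref (δ i j) (i ≡ j)
δ-ref i j with i Finₚ.≟ j
... | yes p = holds p
... | no ¬p = fails ¬p

discreteState : ∀ {X} t → State X t
discreteState t = state (alit 1) λ
  { (same i j) → alit (δ i j) ; (conn i j) → alit (δ i j) ; (dist i j) → alit 0 ; (ecc i) → alit 0 }

no-link : ∀ {V : Set} {x y : V} {w} → ¬ Link [] x y w
no-link (along ())
no-link (against ())

path-[] : ∀ {V : Set} {x y : V} {ℓ} → Path [] x y ℓ → x ≡ y
path-[] (stop eq)  = eq
path-[] (go l _ _) = ⊥-elim (no-link l)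

discrete-summary : ∀ {X t D} (ρ : X → ℕ) → Summarises ρ D [] (id {A = Fin t}) (discreteState t)
discrete-summary {t = t} {D} ρ = holds alive , λ _ → record
  { same-ref = δ-ref
  ; conn-ref = λ i j → ref-map (λ eq → 0 , stop eq) (path-[] ∘ proj₂) (δ-ref i j)
  ; dist-opt = opt
  ; ecc-is   = λ i → (i , stop refl , λ _ → z≤n) , λ (_ , p) → stop (path-[] p) }
  where
  alive : Alive D [] id
  alive = record
    { forest = _ ; near = λ (_ , p) → stop (path-[] p)
    ; anchored = λ x y → inj₂ ((x , conn-refl) , (y , conn-refl)) }
  opt : ∀ (i j : Fin t) → OptDist [] i j 0
  opt i j with i Finₚ.≟ j
  ... | yes eq = inj₁ (stop eq , λ _ → z≤n)
  ... | no ¬eq = inj₂ (¬eq ∘ path-[] ∘ proj₂ , refl)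

-- Disjoint unions.

record Union {V₁ V₂ W : Set} (E₁ : Edges V₁) (E₂ : Edges V₂) (E : Edges W)
             (ι₁ : V₁ → W) (ι₂ : V₂ → W) : Set where
  field
    injective₁ : ∀ {x y} → ι₁ x ≡ ι₁ y → x ≡ y
    injective₂ : ∀ {x y} → ι₂ x ≡ ι₂ y → x ≡ y
    disjoint   : ∀ {x y} → ι₁ x ≢ ι₂ y
    cover      : ∀ p → (∃[ x ] ι₁ x ≡ p) ⊎ (∃[ y ] ι₂ y ≡ p)
    link₁      : ∀ {x y w} → Link E₁ x y w → Link E (ι₁ x) (ι₁ y) w
    link₂      : ∀ {x y w} → Link E₂ x y w → Link E (ι₂ x) (ι₂ y) w
    link⁻      : ∀ {p q w} → Link E p q w →
                 (∃[ x ] ∃[ y ] (ι₁ x ≡ p × ι₁ y ≡ q × Link E₁ x y w)) ⊎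
                 (∃[ x ] ∃[ y ] (ι₂ x ≡ p × ι₂ y ≡ q × Link E₂ x y w))

  path⁺ : ∀ {x y ℓ} → Path E₁ x y ℓ → Path E (ι₁ x) (ι₁ y) ℓ
  path⁺ = mapPath ι₁ link₁

  stays : ∀ {p q ℓ} → Path E p q ℓ → ∀ {x} → ι₁ x ≡ p → ∃[ y ] (ι₁ y ≡ q × Path E₁ x y ℓ)
  stays (stop refl) px = _ , px , stop refl
  stays (go l p le) px with link⁻ l
  ... | inj₂ (y , _ , py , _) = ⊥-elim (disjoint (trans px (sym py)))
  ... | inj₁ (x′ , z , px′ , pz , l′) with injective₁ (trans px (sym px′)) | stays p pz
  ... | refl | y , py , p′ = y , py , go l′ p′ le

  path⁻ : ∀ {x y ℓ} → Path E (ι₁ x) (ι₁ y) ℓ → Path E₁ x y ℓ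
  path⁻ p with stays p refl
  ... | _ , py , p′ with injective₁ py
  ... | refl = p′

  conn⁺ : ∀ {x y} → Conn E₁ x y → Conn E (ι₁ x) (ι₁ y)
  conn⁺ (_ , p) = _ , path⁺ p

  conn⁻ : ∀ {x y} → Conn E (ι₁ x) (ι₁ y) → Conn E₁ x y
  conn⁻ (_ , p) = _ , path⁻ p

  apart : ∀ {x y} → ¬ Conn E (ι₁ x) (ι₂ y)
  apart (_ , p) with stays p refl
  ... | _ , eq , _ = disjoint eq

  dist⁺ : ∀ {x y n} → Dist E₁ x y n → Dist E (ι₁ x) (ι₁ y) n
  dist⁺ (p , min) = path⁺ p , min ∘ path⁻

  opt⁺ : ∀ {x y n} → OptDist E₁ x y n → OptDist E (ι₁ x) (ι₁ y) n
  opt⁺ (inj₁ d)         = inj₁ (dist⁺ d)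
  opt⁺ (inj₂ (¬c , eq)) = inj₂ (¬c ∘ conn⁻ , eq)

  ecc⁺ : ∀ {x n} → Ecc E₁ x n → Ecc E (ι₁ x) n
  ecc⁺ {x} {n} ((y , d) , far) = (ι₁ y , dist⁺ d) , λ {p} → below p
    where
    below : ∀ p → Conn E (ι₁ x) p → Path E (ι₁ x) p n
    below p (_ , q) with stays q refl
    ... | y , refl , q′ = path⁺ (far (_ , q′))

flipUnion : ∀ {V₁ V₂ W : Set} {E₁ : Edges V₁} {E₂ : Edges V₂} {E : Edges W} {ι₁ ι₂} →
            Union E₁ E₂ E ι₁ ι₂ → Union E₂ E₁ E ι₂ ι₁
flipUnion U = record
  { injective₁ = injective₂ ; injective₂ = injective₁ ; disjoint = disjoint ∘ sym
  ; cover = [ inj₂ , inj₁ ]′ ∘ cover ; link₁ = link₂ ; link₂ = link₁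
  ; link⁻ = [ inj₂ , inj₁ ]′ ∘ link⁻ }
  where open Union U

link-++ˡ : ∀ {V : Set} {E F : Edges V} {x y w} → Link E x y w → Link (E ++ F) x y w
link-++ˡ (along p)   = along (∈ˡ.∈-++⁺ˡ p)
link-++ˡ (against p) = against (∈ˡ.∈-++⁺ˡ p)

link-++ʳ : ∀ {V : Set} (E : Edges V) {F : Edges V} {x y w} → Link F x y w → Link (E ++ F) x y w
link-++ʳ E (along p)   = along (∈ˡ.∈-++⁺ʳ E p)
link-++ʳ E (against p) = against (∈ˡ.∈-++⁺ʳ E p)

link-++⁻ : ∀ {V : Set} (E : Edges V) {F : Edges V} {x y w} → Link (E ++ F) x y w → Link E x y w ⊎ Link F x y w
link-++⁻ E (along p) with ∈ˡ.∈-++⁻ E p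
... | inj₁ q = inj₁ (along q)
... | inj₂ q = inj₂ (along q)
link-++⁻ E (against p) with ∈ˡ.∈-++⁻ E p
... | inj₁ q = inj₁ (against q)
... | inj₂ q = inj₂ (against q)

record DisjointCover {V₁ V₂ W : Set} (ι₁ : V₁ → W) (ι₂ : V₂ → W) : Set where
  field
    injective₁ : ∀ {x y} → ι₁ x ≡ ι₁ y → x ≡ y
    injective₂ : ∀ {x y} → ι₂ x ≡ ι₂ y → x ≡ y
    disjoint   : ∀ {x y} → ι₁ x ≢ ι₂ y
    cover      : ∀ p → (∃[ x ] ι₁ x ≡ p) ⊎ (∃[ y ] ι₂ y ≡ p)

module _ {V₁ V₂ W : Set} {ι₁ : V₁ → W} {ι₂ : V₂ → W} (C : DisjointCover ι₁ ι₂) where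

  append-union : (E₁ : Edges V₁) (E₂ : Edges V₂) →
                 Union E₁ E₂ (mapEnds ι₁ E₁ ++ mapEnds ι₂ E₂) ι₁ ι₂
  append-union E₁ E₂ = record
    { DisjointCover C
    ; link₁ = λ l → link-++ˡ (mapEnds-link ι₁ l)
    ; link₂ = λ l → link-++ʳ (mapEnds ι₁ E₁) (mapEnds-link ι₂ l)
    ; link⁻ = λ l → [ inj₁ ∘ mapEnds-link⁻ ι₁ , inj₂ ∘ mapEnds-link⁻ ι₂ ]′ (link-++⁻ (mapEnds ι₁ E₁) l) }

  append-forest : (E₁ : Edges V₁) (E₂ : Edges V₂) → Forest E₁ → Forest E₂ →
                  Forest (mapEnds ι₁ E₁ ++ mapEnds ι₂ E₂)
  append-forest [] [] f₁ f₂ = _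
  append-forest [] (e ∷ E₂) f₁ (¬c , f₂) =
    ¬c ∘ Union.conn⁻ (flipUnion (append-union [] E₂)) , append-forest [] E₂ f₁ f₂
  append-forest (e ∷ E₁) E₂ (¬c , f₁) f₂ =
    ¬c ∘ Union.conn⁻ (append-union E₁ E₂) , append-forest E₁ E₂ f₁ f₂

  forest-append : (E₁ : Edges V₁) (E₂ : Edges V₂) → Forest (mapEnds ι₁ E₁ ++ mapEnds ι₂ E₂) →
                  Forest E₁ × Forest E₂
  forest-append [] E₂ f = _ , forest-unglue E₂ f
  forest-append (e ∷ E₁) E₂ (¬c , f) = let (f₁ , f₂) = forest-append E₁ E₂ f in
    (¬c ∘ Union.conn⁺ (append-union E₁ E₂) , f₁) , f₂

module _ {X : Set} {s t : ℕ} where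

  cross : (Fin s → Fin s → AExp X) → (Fin t → Fin t → AExp X) → Fin s ⊎ Fin t → Fin s ⊎ Fin t → AExp X
  cross f g (inj₁ i) (inj₁ j) = f i j
  cross f g (inj₂ i) (inj₂ j) = g i j
  cross f g (inj₁ _) (inj₂ _) = alit 0
  cross f g (inj₂ _) (inj₁ _) = alit 0

  -- Both operands have a node, so neither is the whole graph any longer and each of its components
  -- needs a terminal. An operand that is alive and has some terminal has one in every component, by
  -- `anchor`; testing the two numbers of terminals is therefore enough.
  unionState : Sig X s → Sig X t → State X (s + t)
  unionState f g = state (andE (alit (ifN s 0 1)) (alit (ifN t 0 1))) λ
    { (same i j) → cross (λ i j → f (same i j)) (λ i j → g (same i j)) (splitAt s i) (splitAt s j)
    ; (conn i j) → cross (λ i j → f (conn i j)) (λ i j → g (conn i j)) (splitAt s i) (splitAt s j)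
    ; (dist i j) → cross (λ i j → f (dist i j)) (λ i j → g (dist i j)) (splitAt s i) (splitAt s j)
    ; (ecc i)    → [ (λ i → f (ecc i)) , (λ i → g (ecc i)) ]′ (splitAt s i) }

inhabited-ref : ∀ s → Ref (ifN s 0 1) (Fin s)
inhabited-ref zero    = fails λ ()
inhabited-ref (suc _) = holds zero

joinTerminals : ∀ {V₁ V₂ W : Set} {s t} → (V₁ → W) → (V₂ → W) → (Fin s → V₁) → (Fin t → V₂) → Fin (s + t) → W
joinTerminals {s = s} ι₁ ι₂ τ₁ τ₂ = [ ι₁ ∘ τ₁ , ι₂ ∘ τ₂ ]′ ∘ splitAt s

module _ {D s t : ℕ} {V₁ V₂ W : Set} {ι₁ : V₁ → W} {ι₂ : V₂ → W} (C : DisjointCover ι₁ ι₂)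
         {E₁ : Edges V₁} {E₂ : Edges V₂} {τ₁ : Fin s → V₁} {τ₂ : Fin t → V₂} where

  private
    U  = append-union C E₁ E₂
    U′ = flipUnion U
    E  = mapEnds ι₁ E₁ ++ mapEnds ι₂ E₂
    τ  = joinTerminals ι₁ ι₂ τ₁ τ₂
    module U  = Union U
    module U′ = Union U′

  anchored₁⁻ : ∀ {x} → Anchored E τ (ι₁ x) → Anchored E₁ τ₁ x
  anchored₁⁻ (k , c) with splitAt s k
  ... | inj₁ i = i , U.conn⁻ c
  ... | inj₂ i = ⊥-elim (U.apart c)

  anchored₂⁻ : ∀ {x} → Anchored E τ (ι₂ x) → Anchored E₂ τ₂ x
  anchored₂⁻ (k , c) with splitAt s k
  ... | inj₁ i = ⊥-elim (U′.apart c)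
  ... | inj₂ i = i , U′.conn⁻ c

  anchored₁⁺ : ∀ {x} → Anchored E₁ τ₁ x → Anchored E τ (ι₁ x)
  anchored₁⁺ {x} (i , c) = i Fin.↑ˡ t , subst (λ q → Conn E (ι₁ x) ([ ι₁ ∘ τ₁ , ι₂ ∘ τ₂ ]′ q))
    (sym (Finₚ.splitAt-↑ˡ s i t)) (U.conn⁺ c)

  anchored₂⁺ : ∀ {x} → Anchored E₂ τ₂ x → Anchored E τ (ι₂ x)
  anchored₂⁺ {x} (i , c) = s Fin.↑ʳ i , subst (λ q → Conn E (ι₂ x) ([ ι₁ ∘ τ₁ , ι₂ ∘ τ₂ ]′ q))
    (sym (Finₚ.splitAt-↑ʳ s t i)) (U′.conn⁺ c)

  alive-ununion : Alive D E τ → Alive D E₁ τ₁ × Alive D E₂ τ₂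
  alive-ununion a = record
    { forest = proj₁ (forest-append C E₁ E₂ forest) ; near = λ c → U.path⁻ (near (U.conn⁺ c))
    ; anchored = λ x y → [ inj₁ ∘ U.conn⁻ , (λ (p , q) → inj₂ (anchored₁⁻ p , anchored₁⁻ q)) ]′
                            (anchored (ι₁ x) (ι₁ y)) }
    , record
    { forest = proj₂ (forest-append C E₁ E₂ forest) ; near = λ c → U′.path⁻ (near (U′.conn⁺ c))
    ; anchored = λ x y → [ inj₁ ∘ U′.conn⁻ , (λ (p , q) → inj₂ (anchored₂⁻ p , anchored₂⁻ q)) ]′
                            (anchored (ι₂ x) (ι₂ y)) }
    where open Alive a

  union-inhabited : V₁ → V₂ → Alive D E τ → Fin s × Fin t
  union-inhabited x y a with Alive.anchored a (ι₁ x) (ι₂ y)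
  ... | inj₁ c       = ⊥-elim (U.apart c)
  ... | inj₂ (p , q) = proj₁ (anchored₁⁻ p) , proj₁ (anchored₂⁻ q)

  union-alive : Fin s → Fin t → Alive D E₁ τ₁ → Alive D E₂ τ₂ → Alive D E τ
  union-alive i j a₁ a₂ = record
    { forest = append-forest C E₁ E₂ A₁.forest A₂.forest
    ; near = λ {p} {q} → near p q ; anchored = λ p q → inj₂ (anch p , anch q) }
    where
    module A₁ = Alive a₁
    module A₂ = Alive a₂
    anch : ∀ p → Anchored E τ p
    anch p with U.cover p
    ... | inj₁ (x , refl) = anchored₁⁺ (A₁.anchor i x)
    ... | inj₂ (x , refl) = anchored₂⁺ (A₂.anchor j x)
    near : ∀ p q → Conn E p q → Path E p q D
    near p q c with U.cover p | U.cover q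
    ... | inj₁ (x , refl) | inj₁ (y , refl) = U.path⁺ (A₁.near (U.conn⁻ c))
    ... | inj₂ (x , refl) | inj₂ (y , refl) = U′.path⁺ (A₂.near (U′.conn⁻ c))
    ... | inj₁ (x , refl) | inj₂ (y , refl) = ⊥-elim (U.apart c)
    ... | inj₂ (x , refl) | inj₁ (y , refl) = ⊥-elim (U′.apart c)

  union-summary : ∀ {X} (ρ : X → ℕ) {f : Sig X s} {g : Sig X t} → V₁ → V₂ →
    Alive D E₁ τ₁ → Alive D E₂ τ₂ → Rep E₁ τ₁ (aeval ρ ∘ f) → Rep E₂ τ₂ (aeval ρ ∘ g) →
    Summarises ρ D E τ (unionState f g)
  union-summary ρ {f} {g} x y a₁ a₂ r₁ r₂ =
    ref-map (λ (i , j) → union-alive i j a₁ a₂) (union-inhabited x y)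
            (ref-and (inhabited-ref s) (inhabited-ref t)) ,
    λ _ → record
    { same-ref = λ i j → same-ref (splitAt s i) (splitAt s j)
    ; conn-ref = λ i j → conn-ref (splitAt s i) (splitAt s j)
    ; dist-opt = λ i j → dist-opt (splitAt s i) (splitAt s j)
    ; ecc-is   = λ i → ecc-is (splitAt s i) }
    where
    module R₁ = Rep r₁
    module R₂ = Rep r₂
    τ′ = [ ι₁ ∘ τ₁ , ι₂ ∘ τ₂ ]′
    same-ref : ∀ p q → Ref (aeval ρ (cross (λ i j → f (same i j)) (λ i j → g (same i j)) p q)) (τ′ p ≡ τ′ q)
    same-ref (inj₁ i) (inj₁ j) = ref-map (cong ι₁) U.injective₁ (R₁.same-ref i j)
    same-ref (inj₂ i) (inj₂ j) = ref-map (cong ι₂) U.injective₂ (R₂.same-ref i j)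
    same-ref (inj₁ i) (inj₂ j) = fails U.disjoint
    same-ref (inj₂ i) (inj₁ j) = fails U′.disjoint
    conn-ref : ∀ p q → Ref (aeval ρ (cross (λ i j → f (conn i j)) (λ i j → g (conn i j)) p q)) (Conn E (τ′ p) (τ′ q))
    conn-ref (inj₁ i) (inj₁ j) = ref-map U.conn⁺ U.conn⁻ (R₁.conn-ref i j)
    conn-ref (inj₂ i) (inj₂ j) = ref-map U′.conn⁺ U′.conn⁻ (R₂.conn-ref i j)
    conn-ref (inj₁ i) (inj₂ j) = fails U.apart
    conn-ref (inj₂ i) (inj₁ j) = fails U′.apart
    dist-opt : ∀ p q → OptDist E (τ′ p) (τ′ q) (aeval ρ (cross (λ i j → f (dist i j)) (λ i j → g (dist i j)) p q))
    dist-opt (inj₁ i) (inj₁ j) = U.opt⁺ (R₁.dist-opt i j)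
    dist-opt (inj₂ i) (inj₂ j) = U′.opt⁺ (R₂.dist-opt i j)
    dist-opt (inj₁ i) (inj₂ j) = inj₂ (U.apart , refl)
    dist-opt (inj₂ i) (inj₁ j) = inj₂ (U′.apart , refl)
    ecc-is : ∀ p → Ecc E (τ′ p) (aeval ρ ([ (λ i → f (ecc i)) , (λ i → g (ecc i)) ]′ p))
    ecc-is (inj₁ i) = U.ecc⁺ (R₁.ecc-is i)
    ecc-is (inj₂ i) = U′.ecc⁺ (R₂.ecc-is i)

-- Forgetting terminals.

module _ {D r t : ℕ} {V : Set} {E : Edges V} {τ : Fin t → V} (keep : Fin r → Fin t) where

  alive-unretain : Alive D E (τ ∘ keep) → Alive D E τ
  alive-unretain a = record
    { forest = forest ; near = near
    ; anchored = λ x y → [ inj₁ , (λ ((i , c) , (j , d)) → inj₂ ((keep i , c) , (keep j , d))) ]′ (anchored x y) }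
    where open Alive a

  Covered : Set
  Covered = ∀ i j → Conn E (τ i) (τ j) ⊎ (Anchored E (τ ∘ keep) (τ i) × Anchored E (τ ∘ keep) (τ j))

  -- Two nodes that are not connected each reach an old terminal, so the condition on all pairs of
  -- nodes reduces to pairs of old terminals, where `conn` decides it.
  alive-retain : Covered → Alive D E τ → Alive D E (τ ∘ keep)
  alive-retain covered a = record { forest = forest ; near = near ; anchored = anchored′ }
    where
    open Alive a
    anchored′ : ∀ x y → Conn E x y ⊎ (Anchored E (τ ∘ keep) x × Anchored E (τ ∘ keep) y)
    anchored′ x y with anchored x y
    ... | inj₁ c = inj₁ c
    ... | inj₂ ((i , c) , (j , d)) with covered i j
    ... | inj₁ e = inj₁ (conn-trans c (conn-trans e (conn-sym d)))
    ... | inj₂ ((k , e) , (l , f)) = inj₂ ((k , conn-trans c e) , (l , conn-trans d f))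

module _ {X : Set} {r t : ℕ} (keep : Fin r → Fin t) where

  anchoredE : Sig X t → Fin t → AExp X
  anchoredE s i = anyE λ k → s (conn i (keep k))

  retainSig : Sig X t → Sig X r
  retainSig s (same i j) = s (same (keep i) (keep j))
  retainSig s (conn i j) = s (conn (keep i) (keep j))
  retainSig s (dist i j) = s (dist (keep i) (keep j))
  retainSig s (ecc i)    = s (ecc (keep i))

  retainState : State X t → State X r
  retainState (state ok s) = state
    (andE ok (allE λ i → allE λ j → orE (s (conn i j)) (andE (anchoredE s i) (anchoredE s j))))
    (retainSig s)

  retain-summary : ∀ {D V} {E : Edges V} {τ : Fin t → V} (ρ : X → ℕ) {s : State X t} →
    Summarises ρ D E τ s → Summarises ρ D E (τ ∘ keep) (retainState s)
  retain-summary {D} {E = E} {τ} ρ {state _ s} (ok , rep) =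
    decide ok , λ a → let open Rep (rep (alive-unretain keep a)) in record
      { same-ref = λ i j → same-ref (keep i) (keep j)
      ; conn-ref = λ i j → conn-ref (keep i) (keep j)
      ; dist-opt = λ i j → dist-opt (keep i) (keep j)
      ; ecc-is   = λ i → ecc-is (keep i) }
    where
    test : AExp X
    test = allE λ i → allE λ j → orE (s (conn i j)) (andE (anchoredE s i) (anchoredE s j))

    decide : ∀ {n} → Ref n (Alive D E τ) → Ref (ifN n 0 (aeval ρ test)) (Alive D E (τ ∘ keep))
    decide (fails ¬a) = fails (¬a ∘ alive-unretain keep)
    decide (holds a)   = ref-map (λ c → alive-retain keep c a) (λ a′ i j → Alive.anchored a′ (τ i) (τ j))
      (ref-all ρ _ λ i → ref-all ρ _ λ j → ref-or (conn-ref i j) (ref-and (anch i) (anch j)))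
      where
      open Rep (rep a)
      anch : ∀ i → Ref (aeval ρ (anchoredE s i)) (Anchored E (τ ∘ keep) (τ i))
      anch i = ref-any ρ _ λ k → conn-ref i (keep k)

connectedE : ∀ {X t} → Sig X t → AExp X
connectedE s = allE λ i → allE λ j → s (conn i j)

-- Unconnected nodes would be anchored at terminals, and those are connected pairwise. Without
-- terminals the test is vacuous and still right: `anchored` then leaves only the alternative that
-- the two nodes are connected.
connected-ref : ∀ {X V t D} {E : Edges V} {τ : Fin t → V} (ρ : X → ℕ) {s : Sig X t} →
                Alive D E τ → Rep E τ (aeval ρ ∘ s) →
                Ref (aeval ρ (connectedE s)) (∀ x y → Conn E x y)
connected-ref {V = V} {E = E} {τ} ρ {s} a rep = ref-map all (λ c i j → c (τ i) (τ j))
  (ref-all ρ _ λ i → ref-all ρ _ λ j → Rep.conn-ref rep i j)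
  where
  all : (∀ i j → Conn E (τ i) (τ j)) → ∀ x y → Conn E x y
  all c x y with Alive.anchored a x y
  ... | inj₁ d = d
  ... | inj₂ ((i , d) , (j , e)) = conn-trans d (conn-trans (c i j) (conn-sym e))

-- Selected edges of graphs built by operations.

select : ∀ {V : Set} {m} → Vec (V × V) m → Vec ℕ m → Vec Bool m → Edges V
select []             []       []           = []
select ((u , v) ∷ es) (w ∷ ws) (true ∷ bs)  = (u , v , w) ∷ select es ws bs
select (_ ∷ es)       (_ ∷ ws) (false ∷ bs) = select es ws bs

select-map : ∀ {V W : Set} {m} (π : V → W) (es : Vec (V × V) m) ws bs →
             select (Vec.map (λ (u , v) → π u , π v) es) ws bs ≡ mapEnds π (select es ws bs)
select-map π []       []       []           = refl
select-map π (_ ∷ es) (_ ∷ ws) (true ∷ bs)  = cong (_ ∷_) (select-map π es ws bs)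
select-map π (_ ∷ es) (_ ∷ ws) (false ∷ bs) = select-map π es ws bs

select-++ : ∀ {V : Set} {m n} (es : Vec (V × V) m) (fs : Vec (V × V) n) ws ws′ bs bs′ →
            select (es Vec.++ fs) (ws Vec.++ ws′) (bs Vec.++ bs′) ≡ select es ws bs ++ select fs ws′ bs′
select-++ []       fs []       ws′ []           bs′ = refl
select-++ (_ ∷ es) fs (_ ∷ ws) ws′ (true ∷ bs)  bs′ = cong (_ ∷_) (select-++ es fs ws ws′ bs bs′)
select-++ (_ ∷ es) fs (_ ∷ ws) ws′ (false ∷ bs) bs′ = select-++ es fs ws ws′ bs bs′

module _ {t : ℕ} (G : TGraph t) where

  selectedEdges : Vec ℕ (TGraph.edges G) → Subset (TGraph.edges G) → Edges (Fin (TGraph.nodes G))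
  selectedEdges = select (TGraph.ends G)

  terminal : Fin t → Fin (TGraph.nodes G)
  terminal = lookup (TGraph.terminals G)

AliveIn : ℕ → ∀ {t} (G : TGraph t) → Vec ℕ (TGraph.edges G) → Subset (TGraph.edges G) → Set
AliveIn D G d S = Alive D (selectedEdges G d S) (terminal G)

RepIn : ∀ {t} (G : TGraph t) → Vec ℕ (TGraph.edges G) → Subset (TGraph.edges G) → (Var t → ℕ) → Set₁
RepIn G d S = Rep (selectedEdges G d S) (terminal G)

SummarisesIn : ∀ {X} → (X → ℕ) → ℕ → ∀ {t} (G : TGraph t) →
               Vec ℕ (TGraph.edges G) → Subset (TGraph.edges G) → State X t → Set₁
SummarisesIn ρ D G d S = Summarises ρ D (selectedEdges G d S) (terminal G)

-- Identification of nodes as a quotient.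

module _ {n : ℕ} (i j : Fin (suc n)) (i≢j : i ≢ j) where

  identified-glues : Glues (proj₂ (identified i j)) i j
  identified-glues {x} {y} with j Finₚ.≟ i
  ... | yes j≡i = contradiction (sym j≡i) i≢j
  ... | no j≢i with j Finₚ.≟ x | j Finₚ.≟ y
  ... | yes j≡x | yes j≡y = λ _ → inj₁ (trans (sym j≡x) j≡y)
  ... | yes j≡x | no j≢y  = λ eq → inj₂ (inj₂ (sym j≡x , sym (Finₚ.punchOut-injective j≢i j≢y eq)))
  ... | no j≢x  | yes j≡y = λ eq → inj₂ (inj₁ (Finₚ.punchOut-injective j≢x j≢i eq , sym j≡y))
  ... | no j≢x  | no j≢y  = λ eq → inj₁ (Finₚ.punchOut-injective j≢x j≢y eq)

  identified-meets : proj₂ (identified i j) i ≡ proj₂ (identified i j) j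
  identified-meets with j Finₚ.≟ i
  ... | yes j≡i = contradiction (sym j≡i) i≢j
  ... | no j≢i with j Finₚ.≟ i | j Finₚ.≟ j
  ... | yes j≡i | _      = contradiction j≡i j≢i
  ... | no _    | no j≢j = contradiction refl j≢j
  ... | no _    | yes _  = Finₚ.punchOut-cong j refl

  identified-size : proj₁ (identified i j) ≡ n
  identified-size with j Finₚ.≟ i
  ... | yes j≡i = contradiction (sym j≡i) i≢j
  ... | no _    = refl

  identified-other : ∀ {x} (j≢x : j ≢ x) →
                     toℕ (proj₂ (identified i j) x) ≡ toℕ (punchOut j≢x)
  identified-other {x} j≢x with j Finₚ.≟ i
  ... | yes j≡i = contradiction (sym j≡i) i≢j
  ... | no _ with j Finₚ.≟ x
  ... | yes j≡x = contradiction j≡x j≢x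
  ... | no _    = cong toℕ (Finₚ.punchOut-cong j refl)

  identified-onto : ∀ y → ∃[ x ] proj₂ (identified i j) x ≡ y
  -- `punchIn j` avoids the redirected node `j`. The number of nodes of the quotient equals `n` only
  -- propositionally, whence the cast and the comparison through `toℕ`.
  identified-onto y = punchIn j y′ , Finₚ.toℕ-injective (trans
    (identified-other (Finₚ.punchInᵢ≢i j y′ ∘ sym))
    (trans (cong toℕ (Finₚ.punchOut-punchIn j)) (Finₚ.toℕ-cast identified-size y)))
    where y′ = Fin.cast identified-size y

identified-same : ∀ {n} (i : Fin n) → identified i i ≡ (n , id)
identified-same {suc n} i with i Finₚ.≟ i
... | yes _  = refl
... | no i≢i = contradiction refl i≢i

identified-quotient : ∀ {n} (i j : Fin n) →
  (i ≡ j × identified i j ≡ (n , id)) ⊎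
  Quotient i j (Fin (proj₁ (identified i j))) (proj₂ (identified i j))
identified-quotient {suc n} i j with i Finₚ.≟ j
... | yes refl = inj₁ (refl , identified-same i)
... | no i≢j   = inj₂ (i≢j , identified-glues i j i≢j , identified-meets i j i≢j , identified-onto i j i≢j)

module _ {X : Set} (ρ : X → ℕ) (bound : AExp X) {t : ℕ} (G : TGraph t) where
  open TGraph G

  identified-summary : ∀ {d : Vec ℕ edges} {S : Subset edges} {s : State X t} (i j : Fin t) →
    SummarisesIn ρ (aeval ρ bound) G d S s →
    SummarisesIn ρ (aeval ρ bound) (applyOp G (identify i j)) d S (identifyState bound i j s)
  identified-summary {d} {S} {s} i j sum =
    summary-cong (λ k → sym (Vecₚ.lookup-map k (proj₂ quotient) terminals))
      (subst (λ E → Summarises ρ _ E (proj₂ quotient ∘ terminal G) (identifyState bound i j s))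
        (sym (select-map (proj₂ quotient) ends d S))
        (cases quotient (identified-quotient (terminal G i) (terminal G j))))
    where
    quotient = identified (terminal G i) (terminal G j)

    -- The quotient is generalised to a variable, since only then can the equation with
    -- `(nodes , id)` be matched.
    cases : (q : ∃[ m ] (Fin nodes → Fin m)) →
      (terminal G i ≡ terminal G j × q ≡ (nodes , id)) ⊎
      Quotient (terminal G i) (terminal G j) (Fin (proj₁ q)) (proj₂ q) →
      Summarises ρ (aeval ρ bound) (mapEnds (proj₂ q) (selectedEdges G d S)) (proj₂ q ∘ terminal G)
        (identifyState bound i j s)
    cases q (inj₁ (eq , refl)) = subst (λ E → Summarises ρ _ E (terminal G) (identifyState bound i j s))
      (sym (Listₚ.map-id _)) (identify-same bound i j {τ = terminal G} ρ {s} eq sum)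
    cases q (inj₂ quot) = identify-distinct bound i j {τ = terminal G} ρ {s} quot sum

module _ {D t : ℕ} (G : TGraph t) where
  open TGraph G

  identified-alive⁻ : ∀ {d : Vec ℕ edges} {S : Subset edges} (i j : Fin t) →
    AliveIn D (applyOp G (identify i j)) d S → AliveIn D G d S
  identified-alive⁻ {d} {S} i j a = cases quotient (identified-quotient (terminal G i) (terminal G j))
    (alive-cong (λ k → Vecₚ.lookup-map k (proj₂ quotient) terminals)
      (subst (λ E → Alive D E (lookup (Vec.map (proj₂ quotient) terminals)))
        (select-map (proj₂ quotient) ends d S) a))
    where
    quotient = identified (terminal G i) (terminal G j)

    cases : (q : ∃[ m ] (Fin nodes → Fin m)) →
      (terminal G i ≡ terminal G j × q ≡ (nodes , id)) ⊎
      Quotient (terminal G i) (terminal G j) (Fin (proj₁ q)) (proj₂ q) →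
      Alive D (mapEnds (proj₂ q) (selectedEdges G d S)) (proj₂ q ∘ terminal G) → AliveIn D G d S
    cases q (inj₁ (eq , refl)) a = subst (λ E → Alive D E (terminal G)) (Listₚ.map-id _) a
    cases q (inj₂ quot) a = alive-unglue {τ = terminal G} {i} {j} quot a

-- Operations applied from the last to the first, so that the labels of the
-- added edges come in the order of the list.

applyRev : ∀ {t} → TGraph t → List (Op t) → TGraph t
applyRev = List.foldr (flip applyOp)

additions : ∀ {t} → List (Op t) → ℕ
additions []                 = 0
additions (identify _ _ ∷ os) = additions os
additions (addEdge _ _ ∷ os)  = suc (additions os)

module _ {A : Set} {t : ℕ} (G : TGraph t) where

  labels : (os : List (Op t)) → Vec A (additions os) → Vec A (TGraph.edges G) → Vec A (TGraph.edges (applyRev G os))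
  labels []                  []      v = v
  labels (identify _ _ ∷ os) l       v = labels os l v
  labels (addEdge _ _ ∷ os)  (x ∷ l) v = x ∷ labels os l v

  unlabels : (os : List (Op t)) (u : Vec A (TGraph.edges (applyRev G os))) → ∃[ l ] ∃[ v ] labels os l v ≡ u
  unlabels []                  u       = [] , u , refl
  unlabels (identify _ _ ∷ os) u       = unlabels os u
  unlabels (addEdge _ _ ∷ os)  (x ∷ u) with unlabels os u
  ... | l , v , eq = x ∷ l , v , cong (x ∷_) eq

  labels-toList : (os : List (Op t)) (l : Vec A (additions os)) (v : Vec A (TGraph.edges G)) →
                  toList (labels os l v) ≡ toList l ++ toList v
  labels-toList []                  []      v = refl
  labels-toList (identify _ _ ∷ os) l       v = labels-toList os l v
  labels-toList (addEdge _ _ ∷ os)  (x ∷ l) v = cong (x ∷_) (labels-toList os l v)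

module _ {t : ℕ} (G : TGraph t) where

  labels-cost : (os : List (Op t)) (l : Vec ℕ (additions os)) (c : Vec ℕ (TGraph.edges G))
                (X : Vec Bool (additions os)) (S : Subset (TGraph.edges G)) →
                totalCost (labels G os l c) (labels G os X S) ≡ totalCost l X + totalCost c S
  labels-cost []                  []      c []      S = refl
  labels-cost (identify _ _ ∷ os) l       c X       S = labels-cost os l c X S
  labels-cost (addEdge _ _ ∷ os)  (x ∷ l) c (b ∷ X) S =
    trans (cong (_ +_) (labels-cost os l c X S)) (sym (+-assoc (if b then x else 0) (totalCost l X) (totalCost c S)))

  labels-alive⁻ : ∀ {D} (os : List (Op t)) (l : Vec ℕ (additions os)) (d : Vec ℕ (TGraph.edges G))
                  (X : Vec Bool (additions os)) (S : Subset (TGraph.edges G)) →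
                  AliveIn D (applyRev G os) (labels G os l d) (labels G os X S) → AliveIn D G d S
  labels-alive⁻ []                  []      d []      S a = a
  labels-alive⁻ (identify i j ∷ os) l       d X       S a =
    labels-alive⁻ os l d X S (identified-alive⁻ (applyRev G os) {labels G os l d} {labels G os X S} i j a)
  labels-alive⁻ (addEdge i j ∷ os)  (x ∷ l) d (true ∷ X) S a =
    labels-alive⁻ os l d X S (alive-uncons {τ = terminal (applyRev G os)} {i} {j} a)
  labels-alive⁻ (addEdge i j ∷ os)  (x ∷ l) d (false ∷ X) S a = labels-alive⁻ os l d X S a

  applyRev-node : (os : List (Op t)) → Fin (TGraph.nodes G) → Fin (TGraph.nodes (applyRev G os))
  applyRev-node []                  x = x
  applyRev-node (addEdge _ _ ∷ os)  x = applyRev-node os x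
  applyRev-node (identify i j ∷ os) x =
    proj₂ (identified (terminal (applyRev G os) i) (terminal (applyRev G os) j)) (applyRev-node os x)

module _ {X : Set} (bound : AExp X) {t : ℕ} where

  -- Which of the added edges are selected is fixed when the code is generated, not read at run
  -- time: every choice has an expression of its own.
  runOps : (os : List (Op t)) → Vec Bool (additions os) → (Fin (additions os) → AExp X) → State X t → State X t
  runOps []                  S       w s = s
  runOps (identify i j ∷ os) S       w s = identifyState bound i j (runOps os S w s)
  runOps (addEdge i j ∷ os)  (b ∷ S) w s =
    if b then addEdgeState bound i j (w zero) (runOps os S (w ∘ suc) s) else runOps os S (w ∘ suc) s

  runOps-summary : (ρ : X → ℕ) (G : TGraph t) (os : List (Op t)) (w : Fin (additions os) → AExp X)
    (l : Vec ℕ (additions os)) (Y : Vec Bool (additions os)) {d : Vec ℕ (TGraph.edges G)} {S : Subset (TGraph.edges G)}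
    {s : State X t} → (∀ i → aeval ρ (w i) ≡ lookup l i) →
    SummarisesIn ρ (aeval ρ bound) G d S s →
    SummarisesIn ρ (aeval ρ bound) (applyRev G os) (labels G os l d) (labels G os Y S) (runOps os Y w s)
  runOps-summary ρ G []                  w []      []      eq sum = sum
  runOps-summary ρ G (identify i j ∷ os) w l       Y       {d} {S} {s} eq sum =
    identified-summary ρ bound (applyRev G os) {labels G os l d} {labels G os Y S} {runOps os Y w s} i j
      (runOps-summary ρ G os w l Y {d} {S} {s} eq sum)
  runOps-summary ρ G (addEdge i j ∷ os)  w (x ∷ l) (false ∷ Y) {d} {S} {s} eq sum =
    runOps-summary ρ G os (w ∘ suc) l Y {d} {S} {s} (eq ∘ suc) sum
  runOps-summary ρ G (addEdge i j ∷ os)  w (x ∷ l) (true ∷ Y) {d} {S} {s} eq sum =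
    subst (λ n → Summarises ρ (aeval ρ bound)
                  ((terminal G′ i , terminal G′ j , n) ∷ selectedEdges G′ (labels G os l d) (labels G os Y S))
                  (terminal G′) (addEdgeState bound i j (w zero) s′))
      (eq zero)
      (addEdge-summary bound i j {τ = terminal G′} ρ {w zero} {s′} (runOps-summary ρ G os (w ∘ suc) l Y {d} {S} {s} (eq ∘ suc) sum))
    where
    G′ = applyRev G os
    s′ = runOps os Y (w ∘ suc) s

summary-retain : ∀ {X D t r} (ρ : X → ℕ) (G : TGraph t) (keep : Vec (Fin t) r) {d : Vec ℕ (TGraph.edges G)}
                 {S : Subset (TGraph.edges G)} {s : State X t} →
                 SummarisesIn ρ D G d S s → SummarisesIn ρ D (retain keep G) d S (retainState (lookup keep) s)
summary-retain ρ G keep {s = s} sum =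
  summary-cong (λ i → sym (Vecₚ.lookup-map i (terminal G) keep)) (retain-summary (lookup keep) {τ = terminal G} ρ {s} sum)

retain-alive⁻ : ∀ {D t r} (G : TGraph t) (keep : Vec (Fin t) r) {d : Vec ℕ (TGraph.edges G)} {S : Subset (TGraph.edges G)} →
                AliveIn D (retain keep G) d S → AliveIn D G d S
retain-alive⁻ G keep a = alive-unretain (lookup keep) (alive-cong (λ i → Vecₚ.lookup-map i (terminal G) keep) a)

module _ {s t : ℕ} (G : TGraph s) (H : TGraph t) where
  private
    module G = TGraph G
    module H = TGraph H

  fin-cover : DisjointCover {Fin G.nodes} {Fin H.nodes} (_↑ˡ H.nodes) (G.nodes ↑ʳ_)
  fin-cover = record
    { injective₁ = Finₚ.↑ˡ-injective H.nodes _ _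
    ; injective₂ = Finₚ.↑ʳ-injective G.nodes _ _
    ; disjoint = λ {x} {y} eq → disjoint (trans (sym (Finₚ.splitAt-↑ˡ G.nodes x H.nodes))
                                  (trans (cong (splitAt G.nodes) eq) (Finₚ.splitAt-↑ʳ G.nodes H.nodes y)))
    ; cover = cover }
    where
    disjoint : ∀ {A B : Set} {x : A} {y : B} → ¬ inj₁ x ≡ inj₂ y
    disjoint ()
    cover : ∀ p → (∃[ x ] x ↑ˡ H.nodes ≡ p) ⊎ (∃[ y ] G.nodes ↑ʳ y ≡ p)
    cover p with splitAt G.nodes p in eq
    ... | inj₁ x = inj₁ (x , Finₚ.splitAt⁻¹-↑ˡ eq)
    ... | inj₂ y = inj₂ (y , Finₚ.splitAt⁻¹-↑ʳ eq)

  union-terminal : ∀ i → joinTerminals (_↑ˡ H.nodes) (G.nodes ↑ʳ_) (terminal G) (terminal H) i ≡ terminal (G ⊍ H) i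
  union-terminal i = trans (cases (splitAt s i)) (sym (Vecₚ.lookup-splitAt s (Vec.map (_↑ˡ H.nodes) G.terminals) (Vec.map (G.nodes ↑ʳ_) H.terminals) i))
    where
    cases : ∀ q → [ (_↑ˡ H.nodes) ∘ terminal G , (G.nodes ↑ʳ_) ∘ terminal H ]′ q ≡
                  [ lookup (Vec.map (_↑ˡ H.nodes) G.terminals) , lookup (Vec.map (G.nodes ↑ʳ_) H.terminals) ]′ q
    cases (inj₁ j) = sym (Vecₚ.lookup-map j _ G.terminals)
    cases (inj₂ j) = sym (Vecₚ.lookup-map j _ H.terminals)

  union-select : ∀ (d : Vec ℕ G.edges) (d′ : Vec ℕ H.edges) S S′ →
    mapEnds (_↑ˡ H.nodes) (selectedEdges G d S) ++ mapEnds (G.nodes ↑ʳ_) (selectedEdges H d′ S′)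
      ≡ selectedEdges (G ⊍ H) (d Vec.++ d′) (S Vec.++ S′)
  union-select d d′ S S′ = sym (trans
    (select-++ (Vec.map _ G.ends) (Vec.map _ H.ends) d d′ S S′)
    (cong₂ _++_ (select-map _ G.ends d S) (select-map _ H.ends d′ S′)))

  summary-union : ∀ {X D} (ρ : X → ℕ) {f : Sig X s} {g : Sig X t} {d : Vec ℕ G.edges} {d′ : Vec ℕ H.edges} {S S′} →
    Fin G.nodes → Fin H.nodes → AliveIn D G d S → AliveIn D H d′ S′ →
    RepIn G d S (aeval ρ ∘ f) → RepIn H d′ S′ (aeval ρ ∘ g) →
    SummarisesIn ρ D (G ⊍ H) (d Vec.++ d′) (S Vec.++ S′) (unionState f g)
  summary-union {D = D} ρ {f} {g} {d} {d′} {S} {S′} x y a₁ a₂ r₁ r₂ = summary-cong union-terminal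
    (subst (λ E → Summarises ρ D E τ (unionState f g)) (union-select d d′ S S′)
      (union-summary fin-cover {τ₁ = terminal G} {terminal H} ρ {f} {g} x y a₁ a₂ r₁ r₂))
    where τ = joinTerminals (_↑ˡ H.nodes) (G.nodes ↑ʳ_) (terminal G) (terminal H)

  union-alive⁻ : ∀ {D} {d : Vec ℕ G.edges} {d′ : Vec ℕ H.edges} {S S′} →
    AliveIn D (G ⊍ H) (d Vec.++ d′) (S Vec.++ S′) → AliveIn D G d S × AliveIn D H d′ S′
  union-alive⁻ {D} {d} {d′} {S} {S′} a = alive-ununion fin-cover {τ₁ = terminal G} {terminal H}
    (alive-cong (sym ∘ union-terminal)
      (subst (λ E → Alive D E (terminal (G ⊍ H))) (sym (union-select d d′ S S′)) a))

totalCost-++ : ∀ {m n} (c : Vec ℕ m) (c′ : Vec ℕ n) S S′ →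
               totalCost (c Vec.++ c′) (S Vec.++ S′) ≡ totalCost c S + totalCost c′ S′
totalCost-++ []      c′ []      S′ = refl
totalCost-++ (x ∷ c) c′ (b ∷ S) S′ =
  trans (cong (_ +_) (totalCost-++ c c′ S S′)) (sym (+-assoc (if b then x else 0) (totalCost c S) (totalCost c′ S′)))

-- Every graph of the class, rebuilt from bare terminals.

edgeOps : ∀ {n m} → Vec (Fin n × Fin n) m → List (Op n)
edgeOps []             = []
edgeOps ((u , v) ∷ es) = addEdge u v ∷ edgeOps es

edgeOps-graph : ∀ {n m} (es : Vec (Fin n × Fin n) m) →
  applyRev (discrete n) (edgeOps es) ≡
  record { graph = record { nodes = n ; edges = m ; ends = es } ; terminals = Vec.allFin n }
edgeOps-graph []             = refl
edgeOps-graph {n} {suc m} ((u , v) ∷ es) = trans (cong (λ G → applyOp G (addEdge u v)) (edgeOps-graph es))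
  (cong₂ (λ u v → record { graph = record { nodes = n ; edges = suc m ; ends = (u , v) ∷ es } ; terminals = Vec.allFin n })
    (Vecₚ.lookup-allFin u) (Vecₚ.lookup-allFin v))

module _ {k : ℕ} (Γ : GraphClass k) where
  open GraphClass Γ

  startOps : (i : Fin (length startGraphs)) → List (Op (TGraph.nodes (Primitive.tgraph (start i))))
  startOps i = edgeOps (TGraph.ends (Primitive.tgraph (start i)))

  ruleOps : (r : Fin (length rules)) → List (Op (Rule.left (rule r) + Rule.right (rule r)))
  ruleOps r = List.reverse (Rule.ops (rule r))

  startAdds : Fin (length startGraphs) → ℕ
  startAdds i = additions (startOps i)

  ruleAdds : Fin (length rules) → ℕ
  ruleAdds r = additions (ruleOps r)

module _ {k : ℕ} {Γ : GraphClass k} where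
  open GraphClass Γ

  -- The graph of the parse tree in another presentation. Every added edge is put in front, so
  -- folding the reversed list from the right makes the labels of a node's own edges precede those
  -- of its subtrees. In a primitive graph all nodes first serve as terminals, so that leaves run
  -- through the same operations as rules.
  build : ∀ {t} → ParseTree Γ t → TGraph t
  build (leaf i)     = retain (TGraph.terminals (Primitive.tgraph (start i))) (applyRev (discrete _) (startOps Γ i))
  build (node r S T) = retain (Rule.keep (rule r)) (applyRev (build S ⊍ build T) (ruleOps Γ r))

  build-correct : ∀ {t} (T : ParseTree Γ t) → build T ≡ ⟦ T ⟧
  build-correct (leaf i) = trans (cong (retain terminals) (edgeOps-graph ends))
    (cong (λ ts → record { graph = graph ; terminals = ts })
      (trans (Vecₚ.map-cong Vecₚ.lookup-allFin terminals) (Vecₚ.map-id terminals)))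
    where open TGraph (Primitive.tgraph (start i))
  build-correct (node r S T) = cong (retain (Rule.keep (rule r))) (trans
    (Listₚ.reverse-foldr (flip applyOp) (build S ⊍ build T) (Rule.ops (rule r)))
    (cong₂ (λ G H → applyOps (G ⊍ H) (Rule.ops (rule r))) (build-correct S) (build-correct T)))

  -- Supplies the nodes that `union-summary` asks for on both sides, and the node needed for a
  -- diameter to be attained.
  build-node : ∀ {t} (T : ParseTree Γ t) → Fin (TGraph.nodes (build T))
  build-node (leaf i)     = applyRev-node (discrete _) (startOps Γ i)
    (Fin.fromℕ< (>-nonZero⁻¹ _ {{Primitive.nonempty (start i)}}))
  build-node (node r S T) = applyRev-node (build S ⊍ build T) (ruleOps Γ r) (build-node S ↑ˡ _)

  -- A label for every edge, grouped by the parse tree node that adds it.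
  data Labelling (A : Set) : ∀ {t} → ParseTree Γ t → Set where
    leaf : ∀ {i} → Vec A (startAdds Γ i) → Labelling A (leaf i)
    node : ∀ {r S T} → Vec A (ruleAdds Γ r) → Labelling A S → Labelling A T → Labelling A (node r S T)

  flat : ∀ {A t} {T : ParseTree Γ t} → Labelling A T → Vec A (TGraph.edges (build T))
  flat (leaf {i} l)           = labels (discrete _) (startOps Γ i) l []
  flat (node {r} {S} {T} l x y) = labels (build S ⊍ build T) (ruleOps Γ r) l (flat x Vec.++ flat y)

  unflat : ∀ {A t} (T : ParseTree Γ t) (v : Vec A (TGraph.edges (build T))) → Σ[ l ∈ Labelling A T ] flat l ≡ v
  unflat (leaf i) v with unlabels (discrete _) (startOps Γ i) v
  ... | l , [] , eq = leaf l , eq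
  unflat (node r S T) v with unlabels (build S ⊍ build T) (ruleOps Γ r) v
  ... | l , u , refl with Vec.splitAt (TGraph.edges (build S)) u
  ... | u₁ , u₂ , refl with unflat S u₁ | unflat T u₂
  ... | x , refl | y , refl = node l x y , refl

  labelList : ∀ {A t} {T : ParseTree Γ t} → Labelling A T → List A
  labelList (leaf l)     = toList l
  labelList (node l x y) = toList l ++ labelList x ++ labelList y

  -- The order of the edges in the input is the order in which a preorder traversal of the parse
  -- tree meets their labels, so the program can take the labels from the front of a list.
  flat-toList : ∀ {A t} {T : ParseTree Γ t} (x : Labelling A T) → toList (flat x) ≡ labelList x
  flat-toList (leaf {i} l) = trans (labels-toList (discrete _) (startOps Γ i) l []) (Listₚ.++-identityʳ _)
  flat-toList (node {r} {S} {T} l x y) = trans (labels-toList (build S ⊍ build T) (ruleOps Γ r) l _)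
    (cong (toList l ++_) (trans (Vecₚ.toList-++ (flat x) (flat y)) (cong₂ _++_ (flat-toList x) (flat-toList y))))

  cost : ∀ {t} {T : ParseTree Γ t} → Labelling ℕ T → Labelling Bool T → ℕ
  cost (leaf l)     (leaf X)        = totalCost l X
  cost (node l x y) (node X S₁ S₂) = totalCost l X + (cost x S₁ + cost y S₂)

  flat-cost : ∀ {t} {T : ParseTree Γ t} (c : Labelling ℕ T) (S : Labelling Bool T) →
              totalCost (flat c) (flat S) ≡ cost c S
  flat-cost (leaf {i} l) (leaf X) = trans (labels-cost (discrete _) (startOps Γ i) l [] X []) (ℕ.+-identityʳ _)
  flat-cost (node {r} {S} {T} l x y) (node X S₁ S₂) = trans
    (labels-cost (build S ⊍ build T) (ruleOps Γ r) l _ X _)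
    (cong (totalCost l X +_) (trans (totalCost-++ (flat x) (flat y) (flat S₁) (flat S₂))
      (cong₂ _+_ (flat-cost x S₁) (flat-cost y S₂))))

  AliveT : ℕ → ∀ {t} {T : ParseTree Γ t} → Labelling ℕ T → Labelling Bool T → Set
  AliveT D {T = T} d S = AliveIn D (build T) (flat d) (flat S)

  RepT : ∀ {t} {T : ParseTree Γ t} → Labelling ℕ T → Labelling Bool T → (Var t → ℕ) → Set₁
  RepT {T = T} d S = RepIn (build T) (flat d) (flat S)

  node-alive⁻ : ∀ {D r S T l} {x : Labelling ℕ S} {y : Labelling ℕ T} {X S₁ S₂} →
                AliveT D (node {r = r} l x y) (node X S₁ S₂) → AliveT D x S₁ × AliveT D y S₂
  node-alive⁻ {r = r} {S} {T} {l} {x} {y} {X} {S₁} {S₂} a = union-alive⁻ (build S) (build T)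
    {d = flat x} {flat y} {flat S₁} {flat S₂}
    (labels-alive⁻ (build S ⊍ build T) (ruleOps Γ r) l (flat x Vec.++ flat y) X (flat S₁ Vec.++ flat S₂)
      (retain-alive⁻ (applyRev (build S ⊍ build T) (ruleOps Γ r)) (Rule.keep (rule r)) a))

-- Leaves and rules as symbolic states.

data Input (s t a : ℕ) : Set where
  sig₁        : Var s → Input s t a
  sig₂        : Var t → Input s t a
  cost₁ cost₂ : Input s t a
  weightOf costOf : Fin a → Input s t a
  limit       : Input s t a

module _ {k : ℕ} {Γ : GraphClass k} where
  open GraphClass Γ

  leafState : ∀ i → Vec Bool (startAdds Γ i) →
              State (Input 0 0 (startAdds Γ i)) (Primitive.arity (start i))
  leafState i X = retainState (lookup (TGraph.terminals (Primitive.tgraph (start i))))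
    (runOps (avar limit) (startOps Γ i) X (avar ∘ weightOf) (discreteState _))

  nodeState : ∀ r → Vec Bool (ruleAdds Γ r) →
              State (Input (Rule.left (rule r)) (Rule.right (rule r)) (ruleAdds Γ r)) (Rule.out (rule r))
  nodeState r X = retainState (lookup (Rule.keep (rule r)))
    (runOps (avar limit) (ruleOps Γ r) X (avar ∘ weightOf) (unionState (avar ∘ sig₁) (avar ∘ sig₂)))

  leaf-summary : ∀ i l X ρ → (∀ j → ρ (weightOf j) ≡ lookup l j) →
    SummarisesIn ρ (ρ limit) (build {Γ = Γ} (leaf i)) (flat (leaf {Γ = Γ} {i = i} l)) (flat (leaf {Γ = Γ} {i = i} X)) (leafState i X)
  leaf-summary i l X ρ eq = summary-retain ρ (applyRev (discrete _) os) ts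
      {labels (discrete _) os l []} {labels (discrete _) os X []} {runOps (avar limit) os X (avar ∘ weightOf) (discreteState _)}
    (runOps-summary (avar limit) ρ (discrete _) os (avar ∘ weightOf) l X {[]} {[]} {discreteState _} eq
      (summary-cong (λ j → sym (Vecₚ.lookup-allFin j)) (discrete-summary ρ)))
    where
    os = startOps Γ i
    ts = TGraph.terminals (Primitive.tgraph (start i))

  node-summary : ∀ r {S T} {x : Labelling {Γ = Γ} ℕ S} {y : Labelling {Γ = Γ} ℕ T} {S₁ S₂} l X ρ →
    (∀ j → ρ (weightOf j) ≡ lookup l j) →
    AliveT (ρ limit) x S₁ → AliveT (ρ limit) y S₂ → RepT x S₁ (ρ ∘ sig₁) → RepT y S₂ (ρ ∘ sig₂) →
    SummarisesIn ρ (ρ limit) (build (node r S T)) (flat (node l x y)) (flat (node X S₁ S₂)) (nodeState r X)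
  node-summary r {S} {T} {x} {y} {S₁} {S₂} l X ρ eq a₁ a₂ r₁ r₂ = summary-retain ρ (applyRev G os) ts
      {labels G os l d} {labels G os X Y} {runOps (avar limit) os X (avar ∘ weightOf) u}
    (runOps-summary (avar limit) ρ G os (avar ∘ weightOf) l X {d} {Y} {u} eq
      (summary-union (build S) (build T) ρ {avar ∘ sig₁} {avar ∘ sig₂} {flat x} {flat y} {flat S₁} {flat S₂}
        (build-node S) (build-node T) a₁ a₂ r₁ r₂))
    where
    os = ruleOps Γ r
    ts = Rule.keep (rule r)
    G  = build S ⊍ build T
    d  = flat x Vec.++ flat y
    Y  = flat S₁ Vec.++ flat S₂
    u  = unionState (avar ∘ sig₁) (avar ∘ sig₂)

-- Forests are the acyclic subgraphs.

forest-bridge : ∀ {V : Set} (A : Edges V) {B u v w} → Forest (A ++ (u , v , w) ∷ B) → ¬ Conn (A ++ B) u v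
forest-bridge [] (¬c , _) c = ¬c c
forest-bridge ((a , b , _) ∷ A) {B} {u} {v} {w} (a≁b , f) (_ , p) = bad (cross-conn (cons-cross p))
  where
  E = A ++ (u , v , w) ∷ B

  insert-link : ∀ {x y n} → Link (A ++ B) x y n → Link E x y n
  insert-link l = [ link-++ˡ , link-++ʳ A ∘ link-cons ]′ (link-++⁻ A l)

  lift : ∀ {x y} → Conn (A ++ B) x y → Conn E x y
  lift (_ , p) = _ , mapPath id insert-link p

  uv : Conn E u v
  uv = _ , single (link-++ʳ A (along (here refl)))

  -- This makes the order of insertion irrelevant. A path from `u` to `v` through the front edge,
  -- completed by the edge between `u` and `v`, would join `a` to `b` without the front edge.
  bad : ¬ CrossConn (A ++ B) a b u v
  bad (inj₁ c)              = forest-bridge A f c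
  bad (inj₂ (inj₁ (c , d))) = a≁b (conn-trans (conn-sym (lift c)) (conn-trans uv (conn-sym (lift d))))
  bad (inj₂ (inj₂ (c , d))) = a≁b (conn-trans (lift d) (conn-trans (conn-sym uv) (lift c)))

bridges-forest : ∀ {V : Set} (E : Edges V) →
  (∀ A {u v w B} → E ≡ A ++ (u , v , w) ∷ B → ¬ Conn B u v) → Forest E
bridges-forest []      f = _
bridges-forest (e ∷ E) f = f [] refl , bridges-forest E (λ A eq → f (e ∷ A) (cong (e ∷_) eq))

module _ {V : Set} where

  select-∈ : ∀ {m} (es : Vec (V × V) m) ws bs {e u v} → e Subset.∈ bs → lookup es e ≡ (u , v) →
             (u , v , lookup ws e) ∈ˡ select es ws bs
  select-∈ (_ ∷ es) (_ ∷ ws) (_ ∷ bs)     {zero}  here      refl = here refl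
  select-∈ (_ ∷ es) (_ ∷ ws) (true ∷ bs)  {suc e} (there p) eq   = there (select-∈ es ws bs p eq)
  select-∈ (_ ∷ es) (_ ∷ ws) (false ∷ bs) {suc e} (there p) eq   = select-∈ es ws bs p eq

  ∈-select : ∀ {m} (es : Vec (V × V) m) ws bs {u v w} → (u , v , w) ∈ˡ select es ws bs →
             ∃[ e ] (e Subset.∈ bs × lookup es e ≡ (u , v) × lookup ws e ≡ w)
  ∈-select [] [] [] ()
  ∈-select (_ ∷ es) (_ ∷ ws) (true ∷ bs) (here refl) = zero , here , refl , refl
  ∈-select (_ ∷ es) (_ ∷ ws) (true ∷ bs) (there p) with ∈-select es ws bs p
  ... | e , e∈ , eq , eq′ = suc e , there e∈ , eq , eq′
  ∈-select (_ ∷ es) (_ ∷ ws) (false ∷ bs) p with ∈-select es ws bs p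
  ... | e , e∈ , eq , eq′ = suc e , there e∈ , eq , eq′

  -- Lists forget the names of edges, and parallel edges of equal weight give equal entries.
  -- `Others` and `Avoiding` keep track of an edge by name: the first says that every selected edge
  -- but `e` occurs in `F`, the second that every entry of `F` stems from an edge other than `e`.
  Others : ∀ {m} → Vec (V × V) m → Vec ℕ m → Subset m → Fin m → Edges V → Set
  Others es ws bs e F = ∀ {e′ u v} → e′ Subset.∈ bs → e′ ≢ e → lookup es e′ ≡ (u , v) → (u , v , lookup ws e′) ∈ˡ F

  select-split : ∀ {m} (es : Vec (V × V) m) ws bs {e u v} → e Subset.∈ bs → lookup es e ≡ (u , v) →
    ∃[ A ] ∃[ B ] (select es ws bs ≡ A ++ (u , v , lookup ws e) ∷ B × Others es ws bs e (A ++ B))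
  select-split ((u , v) ∷ es) (w ∷ ws) (true ∷ bs) {zero} here refl = [] , select es ws bs , refl , others
    where
    others : Others ((u , v) ∷ es) (w ∷ ws) (true ∷ bs) zero (select es ws bs)
    others {zero}   _         e≢e _  = contradiction refl e≢e
    others {suc e′} (there p) _   eq = select-∈ es ws bs p eq
  select-split ((u , v) ∷ es) (w ∷ ws) (true ∷ bs) {suc e} (there p) eq with select-split es ws bs p eq
  ... | A , B , split , others = (u , v , w) ∷ A , B , cong (_ ∷_) split , others′
    where
    others′ : Others ((u , v) ∷ es) (w ∷ ws) (true ∷ bs) (suc e) ((u , v , w) ∷ A ++ B)
    others′ {zero}   _         _    refl = here refl
    others′ {suc e′} (there q) e′≢e eq   = there (others q (e′≢e ∘ cong suc) eq)
  select-split ((u , v) ∷ es) (w ∷ ws) (false ∷ bs) {suc e} (there p) eq with select-split es ws bs p eq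
  ... | A , B , split , others = A , B , split , others′
    where
    others′ : Others ((u , v) ∷ es) (w ∷ ws) (false ∷ bs) (suc e) (A ++ B)
    others′ {suc e′} (there q) e′≢e eq = others q (e′≢e ∘ cong suc) eq

  Avoiding : ∀ {m} → Vec (V × V) m → Subset m → Fin m → Edges V → Set
  Avoiding es bs e F = ∀ {u v w} → (u , v , w) ∈ˡ F → ∃[ e′ ] (e′ Subset.∈ bs × e′ ≢ e × lookup es e′ ≡ (u , v))

  split-select : ∀ {m} (es : Vec (V × V) m) ws bs A {B u v w} → select es ws bs ≡ A ++ (u , v , w) ∷ B →
    ∃[ e ] (e Subset.∈ bs × lookup es e ≡ (u , v) × Avoiding es bs e B)
  split-select [] [] [] []      ()
  split-select [] [] [] (_ ∷ _) ()
  split-select (_ ∷ es) (_ ∷ ws) (true ∷ bs) [] refl = zero , here , refl , λ q →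
    let (e′ , e′∈ , eq , _) = ∈-select es ws bs q in suc e′ , there e′∈ , (λ ()) , eq
  split-select (_ ∷ es) (_ ∷ ws) (true ∷ bs) (_ ∷ A) eq
    with split-select es ws bs A (Listₚ.∷-injectiveʳ eq)
  ... | e , e∈ , eq′ , avoid = suc e , there e∈ , eq′ , λ q →
    let (e′ , e′∈ , e′≢e , eq″) = avoid q in suc e′ , there e′∈ , e′≢e ∘ Finₚ.suc-injective , eq″
  split-select (_ ∷ es) (_ ∷ ws) (false ∷ bs) A eq with split-select es ws bs A eq
  ... | e , e∈ , eq′ , avoid = suc e , there e∈ , eq′ , λ q →
    let (e′ , e′∈ , e′≢e , eq″) = avoid q in suc e′ , there e′∈ , e′≢e ∘ Finₚ.suc-injective , eq″

module _ (G : Graph) (S : Subset (Graph.edges G)) where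
  open Graph G
  open Subgraph G S

  visited : ∀ {x y} → Walk x y → List (Fin nodes)
  visited ([] {u})           = u ∷ []
  visited (step {u} _ _ _ w) = u ∷ visited w

  -- Stated for `visited`, which includes the last node, because an edge from that node back to the
  -- start will close the walk; the cycle then lists the node once, in front.
  data Simple : ∀ {x y} → Walk x y → Set where
    []   : ∀ {x} → Simple ([] {x})
    step : ∀ {u v y e p} {j : Joins G e u v} {w : Walk v y} →
           ¬ u ∈ˡ visited w → Simple w → Simple (step e p j w)

  drop-to : ∀ {x y z} {P : Fin edges → Set} (w : Walk x y) → Simple w → All P (walkEdges w) → z ∈ˡ visited w →
            Σ[ w′ ∈ Walk z y ] (Simple w′ × All P (walkEdges w′))
  drop-to []             s          ps       (here refl) = [] , [] , []
  drop-to w@(step _ _ _ _) s        ps       (here refl) = w , s , ps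
  drop-to (step _ _ _ w) (step _ s) (_ ∷ ps) (there z∈)  = drop-to w s ps z∈

  erase-loops : ∀ {x y} {P : Fin edges → Set} (w : Walk x y) → All P (walkEdges w) →
                Σ[ w′ ∈ Walk x y ] (Simple w′ × All P (walkEdges w′))
  erase-loops []             [] = [] , [] , []
  erase-loops (step {u} e p j w) (q ∷ qs) with erase-loops w qs
  ... | w′ , s , qs′ with any? (u Finₚ.≟_) (visited w′)
  ... | yes u∈ = drop-to w′ s qs′ u∈
  ... | no u∉  = step e p j w′ , step u∉ s , q ∷ qs′

  first-visited : ∀ {x y} (w : Walk x y) → x ∈ˡ visited w
  first-visited []             = here refl
  first-visited (step _ _ _ _) = here refl

  last-visited : ∀ {x y} (w : Walk x y) → y ∈ˡ visited w
  last-visited []             = here refl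
  last-visited (step _ _ _ w) = there (last-visited w)

  joins-shared : ∀ {e a b x y} → Joins G e a b → Joins G e x y → a ≡ x ⊎ a ≡ y
  joins-shared (inj₁ p) (inj₁ q) = inj₁ (cong proj₁ (trans (sym p) q))
  joins-shared (inj₁ p) (inj₂ q) = inj₂ (cong proj₁ (trans (sym p) q))
  joins-shared (inj₂ p) (inj₁ q) = inj₂ (cong proj₂ (trans (sym p) q))
  joins-shared (inj₂ p) (inj₂ q) = inj₁ (cong proj₂ (trans (sym p) q))

  ends-visited : ∀ {x y e a b} (w : Walk x y) → Joins G e a b → e ∈ˡ walkEdges w → a ∈ˡ visited w
  ends-visited (step _ _ j w) j′ (here refl) with joins-shared j′ j
  ... | inj₁ refl = here refl
  ... | inj₂ refl = there (first-visited w)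
  ends-visited (step _ _ _ w) j′ (there e∈) = there (ends-visited w j′ e∈)

  nodes-visited : ∀ {x y z} (w : Walk x y) → z ∈ˡ walkNodes w → z ∈ˡ visited w
  nodes-visited (step _ _ _ w) (here refl) = here refl
  nodes-visited (step _ _ _ w) (there z∈)  = there (nodes-visited w z∈)

  fresh : ∀ {A : Set} {x : A} {xs} → ¬ x ∈ˡ xs → All (x ≢_) xs
  fresh x∉ = All.tabulate λ {y} y∈ x≡y → x∉ (subst (_∈ˡ _) (sym x≡y) y∈)

  simple-edges : ∀ {x y} (w : Walk x y) → Simple w → ListU.Unique (walkEdges w)
  simple-edges []             []         = []
  simple-edges (step _ _ j w) (step u∉ s) = fresh (u∉ ∘ ends-visited w j) ∷ simple-edges w s

  simple-nodes : ∀ {x y} (w : Walk x y) → Simple w → ListU.Unique (walkNodes w)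
  simple-nodes []             []          = []
  simple-nodes (step _ _ j w) (step u∉ s) = fresh (u∉ ∘ nodes-visited w) ∷ simple-nodes w s

  last-fresh : ∀ {x y} (w : Walk x y) → Simple w → ¬ y ∈ˡ walkNodes w
  last-fresh (step _ _ _ w) (step u∉ s) (here refl) = u∉ (last-visited w)
  last-fresh (step _ _ _ w) (step u∉ s) (there y∈)  = last-fresh w s y∈

  avoiding-walk : ∀ {F : Edges (Fin nodes)} {e x y ℓ} → Avoiding ends S e F → Path F x y ℓ →
                  Σ[ w ∈ Walk x y ] All (e ≢_) (walkEdges w)
  avoiding-walk avoid (stop refl) = [] , []
  avoiding-walk avoid (go (along l) p _) with avoid l | avoiding-walk avoid p
  ... | e′ , e′∈ , e′≢e , eq | w , ps = step e′ e′∈ (inj₁ eq) w , (e′≢e ∘ sym) ∷ ps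
  avoiding-walk avoid (go (against l) p _) with avoid l | avoiding-walk avoid p
  ... | e′ , e′∈ , e′≢e , eq | w , ps = step e′ e′∈ (inj₂ eq) w , (e′≢e ∘ sym) ∷ ps

  module _ (d : Vec ℕ edges) where
    private E = select ends d S

    -- If the ends of an edge were joined by later edges, erasing loops from that walk and prefixing
    -- the edge would give a cycle. Erasure only drops edges, so the walk still avoids the one in
    -- front.
    acyclic-forest : Acyclic → Forest E
    acyclic-forest acyclic = bridges-forest E λ A {u} {v} eq (_ , p) →
      let (e , e∈ , joins , avoid) = split-select ends d S A eq
          (w₀ , ps₀)    = avoiding-walk avoid (flipPath p)
          (w , s , ps) = erase-loops w₀ ps₀
      in acyclic (step e e∈ (inj₁ joins) w)
           ((λ ()) , ps ∷ simple-edges w s , fresh (last-fresh w s) ∷ simple-nodes w s)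

    others-path : ∀ {F e x y} → Others ends d S e F → (w : Walk x y) → All (e ≢_) (walkEdges w) → Conn F x y
    others-path others [] [] = conn-refl
    others-path others (step e p (inj₁ eq) w) (q ∷ qs) =
      conn-trans (_ , single (along (others p (q ∘ sym) eq))) (others-path others w qs)
    others-path others (step e p (inj₂ eq) w) (q ∷ qs) =
      conn-trans (_ , single (against (others p (q ∘ sym) eq))) (others-path others w qs)

    -- The rest of a cycle joins the ends of its first edge while avoiding it, which `forest-bridge`
    -- excludes wherever that edge stands in the list.
    forest-acyclic : Forest E → Acyclic
    forest-acyclic f []                     (ne , _)             = ne refl
    forest-acyclic f (step e e∈ (inj₁ eq) w) (_ , (ps ∷ _) , _) with select-split ends d S e∈ eq
    ... | A , B , split , others = forest-bridge A (subst Forest split f) (conn-sym (others-path others w ps))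
    forest-acyclic f (step e e∈ (inj₂ eq) w) (_ , (ps ∷ _) , _) with select-split ends d S e∈ eq
    ... | A , B , split , others = forest-bridge A (subst Forest split f) (others-path others w ps)

    walk-path : ∀ {x y} (w : Walk x y) → Path E x y (walkLength d w)
    walk-path []                      = stop refl
    walk-path (step e p (inj₁ eq) w) = go (along (select-∈ ends d S p eq)) (walk-path w) ≤-refl
    walk-path (step e p (inj₂ eq) w) = go (against (select-∈ ends d S p eq)) (walk-path w) ≤-refl

    link-edge : ∀ {x y n} → Link E x y n → ∃[ e ] (e Subset.∈ S × Joins G e x y × lookup d e ≡ n)
    link-edge (along l)   = let (e , e∈ , eq , eq′) = ∈-select ends d S l in e , e∈ , inj₁ eq , eq′
    link-edge (against l) = let (e , e∈ , eq , eq′) = ∈-select ends d S l in e , e∈ , inj₂ eq , eq′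

    path-walk : ∀ {x y ℓ} → Path E x y ℓ → Σ[ w ∈ Walk x y ] walkLength d w ≤ ℓ
    path-walk (stop refl) = [] , z≤n
    path-walk (go l p le) with link-edge l | path-walk p
    ... | e , e∈ , j , refl | w , le′ = step e e∈ j w , ≤-trans (+-monoʳ-≤ (lookup d e) le′) le

    dist-distance : ∀ {x y δ} → Dist E x y δ → IsDistance d x y δ
    dist-distance (p , min) with path-walk p
    ... | w , le = (w , ≤-antisym le (min (walk-path w))) , λ w → min (walk-path w)

    distance-dist : ∀ {x y δ} → IsDistance d x y δ → Dist E x y δ
    distance-dist ((w , refl) , min) = walk-path w , λ p → let (w′ , le) = path-walk p in ≤-trans (min w′) le

-- Existence of distances and diameters.

Least : (ℕ → Set) → Set
Least P = (∃[ δ ] (P δ × (∀ {ℓ} → P ℓ → δ ≤ ℓ))) ⊎ (∀ {ℓ} → ¬ P ℓ)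

least-map : ∀ {P Q : ℕ → Set} → (∀ {ℓ} → P ℓ → Q ℓ) → (∀ {ℓ} → Q ℓ → P ℓ) → Least P → Least Q
least-map f g (inj₁ (δ , p , min)) = inj₁ (δ , f p , min ∘ g)
least-map f g (inj₂ ¬p)            = inj₂ (¬p ∘ g)

least-⊎ : ∀ {P Q : ℕ → Set} → Least P → Least Q → Least (λ ℓ → P ℓ ⊎ Q ℓ)
least-⊎ (inj₂ ¬p) (inj₂ ¬q)            = inj₂ [ ¬p , ¬q ]′
least-⊎ (inj₁ (δ , p , min)) (inj₂ ¬q) = inj₁ (δ , inj₁ p , [ min , ⊥-elim ∘ ¬q ]′)
least-⊎ (inj₂ ¬p) (inj₁ (δ , q , min)) = inj₁ (δ , inj₂ q , [ ⊥-elim ∘ ¬p , min ]′)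
least-⊎ (inj₁ (δ , p , min)) (inj₁ (δ′ , q , min′)) with ℕ.≤-total δ δ′
... | inj₁ le = inj₁ (δ , inj₁ p , [ min , ≤-trans le ∘ min′ ]′)
... | inj₂ le = inj₁ (δ′ , inj₂ q , [ ≤-trans le ∘ min , min′ ]′)

least-via : ∀ {V : Set} {E : Edges V} {i j w x y} → Least (Path E x i) → Least (Path E j y) → Least (Via E i j w x y)
least-via {w = w} (inj₁ (a , p , min)) (inj₁ (b , q , min′)) = inj₁ (a + w + b , (a , b , p , q , ≤-refl) ,
  λ (_ , _ , p′ , q′ , le) → ≤-trans (+-mono-≤ (+-monoˡ-≤ w (min p′)) (min′ q′)) le)
least-via (inj₂ ¬p) _         = inj₂ λ (_ , _ , p , _) → ¬p p
least-via (inj₁ _)  (inj₂ ¬q) = inj₂ λ (_ , _ , _ , q , _) → ¬q q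

cross-cons : ∀ {V : Set} {E : Edges V} {i j w x y ℓ} → Cross E i j w x y ℓ → Path ((i , j , w) ∷ E) x y ℓ
cross-cons (inj₁ p) = path-cons p
cross-cons (inj₂ (inj₁ (_ , _ , p , q , le))) =
  weaken le ((path-cons p ⧺ single (along (here refl))) ⧺ path-cons q)
cross-cons (inj₂ (inj₂ (_ , _ , p , q , le))) =
  weaken le ((path-cons p ⧺ single (against (here refl))) ⧺ path-cons q)

-- With one more edge, a path either avoids it or can be taken to cross it once, in one of two
-- directions. The minimum over these three cases comes from minima over the shorter list, without
-- any bound on the number of links.
least-path : ∀ {V : Set} → DecidableEquality V → (E : Edges V) → ∀ x y → Least (Path E x y)
least-path _≟_ [] x y with x ≟ y
... | yes eq = inj₁ (0 , stop eq , λ _ → z≤n)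
... | no ¬eq = inj₂ (¬eq ∘ path-[])
least-path _≟_ ((u , v , w) ∷ E) x y = least-map cross-cons cons-cross
  (least-⊎ (rec x y) (least-⊎ (least-via (rec x u) (rec v y)) (least-via (rec x v) (rec u y))))
  where rec = least-path _≟_ E

maximum : ∀ {n} → Fin n → (f : Fin n → ℕ) → ∃[ i ] (∀ j → f j ≤ f i)
maximum {suc zero} _ f = zero , λ { zero → ≤-refl }
maximum {suc (suc n)} _ f with maximum zero (f ∘ suc)
... | i , max with ℕ.≤-total (f zero) (f (suc i))
... | inj₁ le = suc i , λ { zero → le ; (suc j) → max j }
... | inj₂ le = zero , λ { zero → ≤-refl ; (suc j) → ≤-trans (max j) le }

module _ (G : Graph) (d : Vec ℕ (Graph.edges G)) (D : ℕ) (S : Subset (Graph.edges G)) where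
  open Graph G
  open Subgraph G S
  private E = select ends d S

  FeasibleIn : Set
  FeasibleIn = IsSpanningTree × ∃[ Δ ] (IsDiameter d Δ × Δ ≤ D)

  -- In a connected graph the first alternative of `anchored` always applies, which leaves `τ`
  -- arbitrary.
  feasible-alive : ∀ {t} {τ : Fin t → Fin nodes} → FeasibleIn → Alive D E τ × (∀ x y → Conn E x y)
  feasible-alive ((connected , acyclic) , Δ , (_ , max) , Δ≤D) = record
    { forest = acyclic-forest G S d acyclic ; near = λ {x} {y} → near x y ; anchored = λ x y → inj₁ (joined x y) } , joined
    where
    joined : ∀ x y → Conn E x y
    joined x y = _ , walk-path G S d (connected x y)
    near : ∀ x y → Conn E x y → Path E x y D
    near x y (_ , p) with least-path Finₚ._≟_ E x y
    ... | inj₁ (δ , q , min) = weaken (≤-trans (max x y δ (dist-distance G S d (q , min))) Δ≤D) q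
    ... | inj₂ ¬p            = contradiction p ¬p

  -- The node `x₀` is asked for because a diameter has to be attained by some pair of nodes.
  alive-feasible : ∀ {t} {τ : Fin t → Fin nodes} → Fin nodes → Alive D E τ → (∀ x y → Conn E x y) → FeasibleIn
  alive-feasible x₀ alive joined = (connected , forest-acyclic G S d forest) , Δ ,
    ((proj₁ widest , proj₁ (farthest (proj₁ widest)) , dist-distance G S d (proj₂ (distance _ _))) , max) ,
    proj₂ (proj₂ (distance _ _)) (near (joined _ _))
    where
    open Alive alive
    connected : Connected
    connected x y = proj₁ (path-walk G S d (proj₂ (joined x y)))
    distance : ∀ x y → ∃[ δ ] Dist E x y δ
    distance x y with least-path Finₚ._≟_ E x y
    ... | inj₁ (δ , q , min) = δ , q , min
    ... | inj₂ ¬p            = contradiction (proj₂ (joined x y)) ¬p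
    farthest : ∀ x → ∃[ y ] (∀ z → proj₁ (distance x z) ≤ proj₁ (distance x y))
    farthest x = maximum x₀ (proj₁ ∘ distance x)
    widest : ∃[ x ] (∀ z → proj₁ (distance z (proj₁ (farthest z))) ≤ proj₁ (distance x (proj₁ (farthest x))))
    widest = maximum x₀ λ x → proj₁ (distance x (proj₁ (farthest x)))
    Δ = proj₁ (distance (proj₁ widest) (proj₁ (farthest (proj₁ widest))))
    max : ∀ x y δ → IsDistance d x y δ → δ ≤ Δ
    max x y δ is = ≤-trans (proj₂ (distance-dist G S d is) (proj₁ (proj₂ (distance x y))))
      (≤-trans (proj₂ (farthest x) y) (proj₂ widest x))

-- Tables.

pairVars : ∀ {t} → (Fin t → Fin t → Var t) → List (Var t)
pairVars f = List.map (λ (i , j) → f i j) (List.cartesianProduct (List.allFin _) (List.allFin _))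

∈-pairVars : ∀ {t} (f : Fin t → Fin t → Var t) i j → f i j ∈ˡ pairVars f
∈-pairVars f i j = ∈ˡ.∈-map⁺ _ (∈ˡ.∈-cartesianProduct⁺ (∈ˡ.∈-allFin i) (∈ˡ.∈-allFin j))

allVars : ∀ t → List (Var t)
allVars t = pairVars same ++ pairVars conn ++ pairVars dist ++ List.map ecc (List.allFin t)

∈-allVars : ∀ {t} (v : Var t) → v ∈ˡ allVars t
∈-allVars (same i j) = ∈ˡ.∈-++⁺ˡ (∈-pairVars same i j)
∈-allVars (conn i j) = ∈ˡ.∈-++⁺ʳ (pairVars same) (∈ˡ.∈-++⁺ˡ (∈-pairVars conn i j))
∈-allVars (dist i j) = ∈ˡ.∈-++⁺ʳ (pairVars same) (∈ˡ.∈-++⁺ʳ (pairVars conn) (∈ˡ.∈-++⁺ˡ (∈-pairVars dist i j)))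
∈-allVars (ecc i)    = ∈ˡ.∈-++⁺ʳ (pairVars same) (∈ˡ.∈-++⁺ʳ (pairVars conn)
  (∈ˡ.∈-++⁺ʳ (pairVars dist) (∈ˡ.∈-map⁺ ecc (∈ˡ.∈-allFin i))))

-- A selection of edges, shared between the entries of different tables.
data Rope : Set where
  bit   : Bool → Rope
  empty : Rope
  _·_   : Rope → Rope → Rope

ropeBits : Rope → List Bool
ropeBits (bit b) = b ∷ []
ropeBits empty   = []
ropeBits (r · s) = ropeBits r ++ ropeBits s

ropeLeaves : Rope → ℕ
ropeLeaves (bit _) = 1
ropeLeaves empty   = 1
ropeLeaves (r · s) = ropeLeaves r + ropeLeaves s

prefix : ∀ {a} → Vec Bool a → Rope → Rope
prefix []      r = r
prefix (b ∷ X) r = bit b · prefix X r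

prefix-bits : ∀ {a} (X : Vec Bool a) r → ropeBits (prefix X r) ≡ toList X ++ ropeBits r
prefix-bits []      r = refl
prefix-bits (b ∷ X) r = cong (b ∷_) (prefix-bits X r)

prefix-leaves : ∀ {a} (X : Vec Bool a) r → ropeLeaves (prefix X r) ≡ a + ropeLeaves r
prefix-leaves []      r = refl
prefix-leaves (b ∷ X) r = cong suc (prefix-leaves X r)

record Entry (t : ℕ) : Set where
  constructor entry
  field
    accept    : ℕ
    signature : Var t → ℕ
    price     : ℕ
    rope      : Rope

  key : List ℕ
  key = List.map signature (allVars t)

open Entry using (accept; signature; price; rope; key)

Table : ℕ → Set
Table t = List (Entry t)

insert : ∀ {t} → Table t → Entry t → Table t
insert []       e = e ∷ []
insert (f ∷ fs) e with Listₚ.≡-dec ℕ._≟_ (key f) (key e)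
... | no _  = f ∷ insert fs e
... | yes _ with price f ∸ price e
... | zero  = f ∷ fs
... | suc _ = e ∷ fs

-- Weaker than membership of an entry, since that entry may later give way to a cheaper one with the
-- same signature. In this form the property survives every insertion.
Covers : ∀ {t} → Table t → (Var t → ℕ) → ℕ → Set
Covers tb σ n = ∃[ e ] (e ∈ˡ tb × (∀ v → signature e v ≡ σ v) × price e ≤ n)

Distinct : ∀ {t} → Table t → Set
Distinct = AllPairs λ e f → key e ≢ key f

map-∈-≡ : ∀ {A : Set} {f g : A → ℕ} xs → List.map f xs ≡ List.map g xs → ∀ {x} → x ∈ˡ xs → f x ≡ g x
map-∈-≡ (_ ∷ xs) eq (here refl) = Listₚ.∷-injectiveˡ eq
map-∈-≡ (_ ∷ xs) eq (there x∈)  = map-∈-≡ xs (Listₚ.∷-injectiveʳ eq) x∈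

key-injective : ∀ {t} (e f : Entry t) → key e ≡ key f → ∀ v → signature e v ≡ signature f v
key-injective {t} e f eq v = map-∈-≡ (allVars t) eq (∈-allVars v)

module _ {t : ℕ} where

  insert-all : ∀ {p} {P : Entry t → Set p} tb {e} → All P tb → P e → All P (insert tb e)
  insert-all []       []       q = q ∷ []
  insert-all (f ∷ fs) {e} (p ∷ ps) q with Listₚ.≡-dec ℕ._≟_ (key f) (key e)
  ... | no _  = p ∷ insert-all fs ps q
  ... | yes _ with price f ∸ price e
  ... | zero  = p ∷ ps
  ... | suc _ = q ∷ ps

  insert-covers : ∀ tb (e : Entry t) → Covers (insert tb e) (signature e) (price e)
  insert-covers []       e = e , here refl , (λ _ → refl) , ≤-refl
  insert-covers (f ∷ fs) e with Listₚ.≡-dec ℕ._≟_ (key f) (key e)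
  ... | no _ with insert-covers fs e
  ... | g , g∈ , eq , le = g , there g∈ , eq , le
  insert-covers (f ∷ fs) e | yes k≡ with price f ∸ price e in eq
  ... | zero  = f , here refl , key-injective f e k≡ , ℕ.m∸n≡0⇒m≤n eq
  ... | suc _ = e , here refl , (λ _ → refl) , ≤-refl

  insert-keeps : ∀ tb (e : Entry t) {σ n} → Covers tb σ n → Covers (insert tb e) σ n
  insert-keeps (f ∷ fs) e (g , g∈ , eq , le) with Listₚ.≡-dec ℕ._≟_ (key f) (key e)
  insert-keeps (f ∷ fs) e (.f , here refl , eq , le) | no _ = f , here refl , eq , le
  insert-keeps (f ∷ fs) e (g , there g∈ , eq , le)   | no _ with insert-keeps fs e (g , g∈ , eq , le)
  ... | h , h∈ , eq′ , le′ = h , there h∈ , eq′ , le′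
  insert-keeps (f ∷ fs) e (g , g∈ , eq , le) | yes k≡ with price f ∸ price e in eq∸
  insert-keeps (f ∷ fs) e (g , g∈ , eq , le) | yes k≡ | zero = g , g∈ , eq , le
  insert-keeps (f ∷ fs) e (g , there g∈ , eq , le) | yes k≡ | suc _ = g , there g∈ , eq , le
  insert-keeps (f ∷ fs) e (.f , here refl , eq , le) | yes k≡ | suc _ =
    e , here refl , (λ v → trans (sym (key-injective f e k≡ v)) (eq v)) ,
    ≤-trans (∸-positive eq∸) le

  insert-distinct : ∀ tb (e : Entry t) → Distinct tb → Distinct (insert tb e)
  insert-distinct []       e []       = [] ∷ []
  insert-distinct (f ∷ fs) e (u ∷ us) with Listₚ.≡-dec ℕ._≟_ (key f) (key e)
  ... | no k≢  = insert-all fs u k≢ ∷ insert-distinct fs e us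
  ... | yes k≡ with price f ∸ price e
  ... | zero  = u ∷ us
  ... | suc _ = subst (λ k → All (λ g → k ≢ key g) fs) k≡ u ∷ us

  insert-length : ∀ tb (e : Entry t) → length (insert tb e) ≤ suc (length tb)
  insert-length []       e = ≤-refl
  insert-length (f ∷ fs) e with Listₚ.≡-dec ℕ._≟_ (key f) (key e)
  ... | no _  = s≤s (insert-length fs e)
  ... | yes _ with price f ∸ price e
  ... | zero  = ℕ.n≤1+n _
  ... | suc _ = ℕ.n≤1+n _

record Template (s t a r : ℕ) : Set where
  constructor template
  field
    result : State (Input s t a) r
    choice : Vec Bool a

selectedCost : ∀ {X a} → Vec Bool a → (Fin a → AExp X) → AExp X
selectedCost []      f = alit 0
selectedCost (b ∷ X) f = (if b then f zero else alit 0) ⊕ selectedCost X (f ∘ suc)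

selectedCost-value : ∀ {X a} (ρ : X → ℕ) (Y : Vec Bool a) f (c : Vec ℕ a) → (∀ i → aeval ρ (f i) ≡ lookup c i) →
                     aeval ρ (selectedCost Y f) ≡ totalCost c Y
selectedCost-value ρ []          f []      eq = refl
selectedCost-value ρ (true ∷ Y)  f (x ∷ c) eq = cong₂ _+_ (eq zero) (selectedCost-value ρ Y (f ∘ suc) c (eq ∘ suc))
selectedCost-value ρ (false ∷ Y) f (x ∷ c) eq = selectedCost-value ρ Y (f ∘ suc) c (eq ∘ suc)

inputs : ∀ {s t a} → Entry s → Entry t → Vec ℕ a → Vec ℕ a → ℕ → Input s t a → ℕ
inputs e f d c D (sig₁ v)     = signature e v
inputs e f d c D (sig₂ v)     = signature f v
inputs e f d c D cost₁        = price e
inputs e f d c D cost₂        = price f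
inputs e f d c D (weightOf i) = lookup d i
inputs e f d c D (costOf i)   = lookup c i
inputs e f d c D limit        = D

module _ {s t a r : ℕ} where

  acceptExp priceExp okExp : Template s t a r → AExp (Input s t a)
  acceptExp T = connectedE (State.sig (Template.result T))
  priceExp T  = (avar cost₁ ⊕ avar cost₂) ⊕ selectedCost (Template.choice T) (avar ∘ costOf)
  okExp T     = State.ok (Template.result T)

  sigExp : Template s t a r → Sig (Input s t a) r
  sigExp T = State.sig (Template.result T)

  module _ (e : Entry s) (f : Entry t) (d c : Vec ℕ a) (D : ℕ) where
    private ρ = inputs e f d c D

    candidate : Template s t a r → Entry r
    candidate T = entry (aeval ρ (acceptExp T)) (aeval ρ ∘ sigExp T) (aeval ρ (priceExp T))
                        (prefix (Template.choice T) (rope e · rope f))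

    step-table : List (Template s t a r) → Table r → Table r
    step-table []       tb = tb
    step-table (T ∷ Ts) tb =
      ifN (aeval ρ (okExp T)) (step-table Ts tb) (insert (step-table Ts tb) (candidate T))

    step-all : ∀ {p} {P : Entry r → Set p} Ts {tb} → (∀ {T} → T ∈ˡ Ts → aeval ρ (okExp T) ≢ 0 → P (candidate T)) →
               All P tb → All P (step-table Ts tb)
    step-all []       h ps = ps
    step-all (T ∷ Ts) h ps with aeval ρ (okExp T) | h (here refl)
    ... | zero  | _ = step-all Ts (h ∘ there) ps
    ... | suc _ | p = insert-all _ (step-all Ts (h ∘ there) ps) (p λ ())

    step-distinct : ∀ Ts {tb} → Distinct tb → Distinct (step-table Ts tb)
    step-distinct []       u = u
    step-distinct (T ∷ Ts) u with aeval ρ (okExp T)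
    ... | zero  = step-distinct Ts u
    ... | suc _ = insert-distinct _ (candidate T) (step-distinct Ts u)

    step-keeps : ∀ Ts {tb σ n} → Covers tb σ n → Covers (step-table Ts tb) σ n
    step-keeps []       p = p
    step-keeps (T ∷ Ts) p with aeval ρ (okExp T)
    ... | zero  = step-keeps Ts p
    ... | suc _ = insert-keeps _ (candidate T) (step-keeps Ts p)

    step-covers : ∀ Ts {T tb} → T ∈ˡ Ts → aeval ρ (okExp T) ≡ 1 →
                  Covers (step-table Ts tb) (signature (candidate T)) (price (candidate T))
    step-covers (T ∷ Ts) (here refl) ok with aeval ρ (okExp T)
    step-covers (T ∷ Ts) (here refl) refl | _ = insert-covers (step-table Ts _) (candidate T)
    step-covers (T′ ∷ Ts) (there T∈) ok with aeval ρ (okExp T′)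
    ... | zero  = step-covers Ts T∈ ok
    ... | suc _ = insert-keeps _ (candidate T′) (step-covers Ts T∈ ok)

    step-length : ∀ Ts tb → length (step-table Ts tb) ≤ length Ts + length tb
    step-length []       tb = ≤-refl
    step-length (T ∷ Ts) tb with aeval ρ (okExp T)
    ... | zero  = ℕ.m≤n⇒m≤1+n (step-length Ts tb)
    ... | suc _ = ≤-trans (insert-length (step-table Ts tb) (candidate T)) (s≤s (step-length Ts tb))

  module _ (Ts : List (Template s t a r)) (d c : Vec ℕ a) (D : ℕ) where

    inner-table : Entry s → Table t → Table r → Table r
    inner-table e []       tb = tb
    inner-table e (f ∷ fs) tb = inner-table e fs (step-table e f d c D Ts tb)

    outer-table : Table s → Table t → Table r → Table r
    outer-table []       fs tb = tb
    outer-table (e ∷ es) fs tb = outer-table es fs (inner-table e fs tb)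

    module _ {p} {P : Entry r → Set p} where

      inner-all : ∀ e fs {tb} →
        (∀ {f T} → f ∈ˡ fs → T ∈ˡ Ts → aeval (inputs e f d c D) (okExp T) ≢ 0 → P (candidate e f d c D T)) →
        All P tb → All P (inner-table e fs tb)
      inner-all e []       h ps = ps
      inner-all e (f ∷ fs) h ps = inner-all e fs (h ∘ there) (step-all e f d c D Ts (h (here refl)) ps)

      outer-all : ∀ es fs {tb} →
        (∀ {e f T} → e ∈ˡ es → f ∈ˡ fs → T ∈ˡ Ts → aeval (inputs e f d c D) (okExp T) ≢ 0 → P (candidate e f d c D T)) →
        All P tb → All P (outer-table es fs tb)
      outer-all []       fs h ps = ps
      outer-all (e ∷ es) fs h ps = outer-all es fs (h ∘ there) (inner-all e fs (h (here refl)) ps)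

    inner-distinct : ∀ e fs {tb} → Distinct tb → Distinct (inner-table e fs tb)
    inner-distinct e []       u = u
    inner-distinct e (f ∷ fs) u = inner-distinct e fs (step-distinct e f d c D Ts u)

    outer-distinct : ∀ es fs {tb} → Distinct tb → Distinct (outer-table es fs tb)
    outer-distinct []       fs u = u
    outer-distinct (e ∷ es) fs u = outer-distinct es fs (inner-distinct e fs u)

    inner-keeps : ∀ e fs {tb σ n} → Covers tb σ n → Covers (inner-table e fs tb) σ n
    inner-keeps e []       p = p
    inner-keeps e (f ∷ fs) p = inner-keeps e fs (step-keeps e f d c D Ts p)

    outer-keeps : ∀ es fs {tb σ n} → Covers tb σ n → Covers (outer-table es fs tb) σ n
    outer-keeps []       fs p = p
    outer-keeps (e ∷ es) fs p = outer-keeps es fs (inner-keeps e fs p)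

    inner-covers : ∀ e fs {f T tb} → f ∈ˡ fs → T ∈ˡ Ts → aeval (inputs e f d c D) (okExp T) ≡ 1 →
      Covers (inner-table e fs tb) (signature (candidate e f d c D T)) (price (candidate e f d c D T))
    inner-covers e (f ∷ fs) (here refl) T∈ ok = inner-keeps e fs (step-covers e f d c D Ts T∈ ok)
    inner-covers e (f ∷ fs) (there f∈)  T∈ ok = inner-covers e fs f∈ T∈ ok

    outer-covers : ∀ es fs {e f T tb} → e ∈ˡ es → f ∈ˡ fs → T ∈ˡ Ts → aeval (inputs e f d c D) (okExp T) ≡ 1 →
      Covers (outer-table es fs tb) (signature (candidate e f d c D T)) (price (candidate e f d c D T))
    outer-covers (e ∷ es) fs (here refl) f∈ T∈ ok = outer-keeps es fs (inner-covers e fs f∈ T∈ ok)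
    outer-covers (e ∷ es) fs (there e∈)  f∈ T∈ ok = outer-covers es fs e∈ f∈ T∈ ok

-- The tables of a parse tree.

ref-nonzero : ∀ {n P} → Ref n P → n ≢ 0 → P
ref-nonzero (holds p) _  = p
ref-nonzero (fails _) ≢0 = contradiction refl ≢0

choices : ∀ a → List (Vec Bool a)
choices zero    = [] ∷ []
choices (suc a) = List.map (true ∷_) (choices a) ++ List.map (false ∷_) (choices a)

∈-choices : ∀ {a} (X : Vec Bool a) → X ∈ˡ choices a
∈-choices []          = here refl
∈-choices (true ∷ X)  = ∈ˡ.∈-++⁺ˡ (∈ˡ.∈-map⁺ _ (∈-choices X))
∈-choices (false ∷ X) = ∈ˡ.∈-++⁺ʳ _ (∈ˡ.∈-map⁺ _ (∈-choices X))

-- Stands for both operands at a leaf, which is processed like a rule whose operands have no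
-- terminals.
bare : Entry 0
bare = entry 1 (λ _ → 0) 0 empty

module _ {k : ℕ} {Γ : GraphClass k} where
  open GraphClass Γ

  leafTemplates : ∀ i → List (Template 0 0 (startAdds Γ i) (Primitive.arity (start i)))
  leafTemplates i = List.map (λ X → template (leafState {Γ = Γ} i X) X) (choices _)

  nodeTemplates : ∀ r → List (Template (Rule.left (rule r)) (Rule.right (rule r))
                                       (ruleAdds Γ r) (Rule.out (rule r)))
  nodeTemplates r = List.map (λ X → template (nodeState {Γ = Γ} r X) X) (choices _)

  table : ∀ {t} (T : ParseTree Γ t) → Labelling ℕ T → Labelling ℕ T → ℕ → Table t
  table (leaf i)     (leaf d)     (leaf c)     D = step-table bare bare d c D (leafTemplates i) []
  table (node r S T) (node d x y) (node c u v) D =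
    outer-table (nodeTemplates r) d c D (table S x u D) (table T y v D) []

  -- Measures the work of flattening the chosen rope. The 2 counts the `empty` ropes that the two
  -- copies of `bare` contribute at a leaf.
  treeLeaves : ∀ {t} → ParseTree Γ t → ℕ
  treeLeaves (leaf i)     = startAdds Γ i + 2
  treeLeaves (node r S T) = ruleAdds Γ r + (treeLeaves S + treeLeaves T)

  Spanning : ∀ {t} {T : ParseTree Γ t} → Labelling ℕ T → Labelling Bool T → Set
  Spanning {T = T} d S = ∀ x y → Conn (selectedEdges (build T) (flat d) (flat S)) x y

  record Realises {t} (T : ParseTree Γ t) (d c : Labelling ℕ T) (D : ℕ) (e : Entry t) : Set₁ where
    field
      chosen : Labelling Bool T
      alive  : AliveT D d chosen
      rep    : RepT d chosen (signature e)
      price≡ : price e ≡ cost c chosen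
      bits   : ropeBits (rope e) ≡ labelList chosen
      leaves : ropeLeaves (rope e) ≡ treeLeaves T
      spans  : Ref (accept e) (Spanning d chosen)

  table-sound : ∀ {t} (T : ParseTree Γ t) (d c : Labelling ℕ T) D → All (Realises T d c D) (table T d c D)
  table-sound (leaf i) (leaf d) (leaf c) D = step-all bare bare d c D (leafTemplates i) good []
    where
    ρ = inputs bare bare d c D
    good : ∀ {T} → T ∈ˡ leafTemplates i → aeval ρ (okExp T) ≢ 0 →
           Realises (leaf i) (leaf d) (leaf c) D (candidate bare bare d c D T)
    good T∈ ok with ∈ˡ.∈-map⁻ _ T∈
    ... | X , _ , refl = let (okR , rep) = leaf-summary {Γ = Γ} i d X ρ (λ _ → refl)
                             alive = ref-nonzero okR ok in record
      { chosen = leaf X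
      ; alive  = alive
      ; rep    = rep alive
      ; price≡ = selectedCost-value ρ X (avar ∘ costOf) c (λ _ → refl)
      ; bits   = trans (prefix-bits X (empty · empty)) (Listₚ.++-identityʳ _)
      ; leaves = prefix-leaves X (empty · empty)
      ; spans  = connected-ref ρ {State.sig (leafState {Γ = Γ} i X)} alive (rep alive)
      }
  table-sound (node r S T) (node d x y) (node c u v) D =
    outer-all (nodeTemplates r) d c D (table S x u D) (table T y v D) good []
    where
    good : ∀ {e f T₀} → e ∈ˡ table S x u D → f ∈ˡ table T y v D → T₀ ∈ˡ nodeTemplates r →
           aeval (inputs e f d c D) (okExp T₀) ≢ 0 →
           Realises (node r S T) (node d x y) (node c u v) D (candidate e f d c D T₀)
    good {e} {f} e∈ f∈ T∈ ok with ∈ˡ.∈-map⁻ _ T∈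
    ... | X , _ , refl = let
        module E = Realises (All.lookup (table-sound S x u D) e∈)
        module F = Realises (All.lookup (table-sound T y v D) f∈)
        ρ = inputs e f d c D
        (okR , rep) = node-summary {Γ = Γ} r {S} {T} {x} {y} {E.chosen} {F.chosen} d X ρ (λ _ → refl) E.alive F.alive E.rep F.rep
        alive = ref-nonzero okR ok in record
      { chosen = node X E.chosen F.chosen
      ; alive  = alive
      ; rep    = rep alive
      ; price≡ = trans (+-comm (price e + price f) _)
          (cong₂ _+_ (selectedCost-value ρ X (avar ∘ costOf) c (λ _ → refl)) (cong₂ _+_ E.price≡ F.price≡))
      ; bits   = trans (prefix-bits X (rope e · rope f)) (cong (toList X ++_) (cong₂ _++_ E.bits F.bits))
      ; leaves = trans (prefix-leaves X (rope e · rope f)) (cong (ruleAdds Γ r +_) (cong₂ _+_ E.leaves F.leaves))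
      ; spans  = connected-ref ρ {State.sig (nodeState {Γ = Γ} r X)} alive (rep alive)
      }

  table-distinct : ∀ {t} (T : ParseTree Γ t) (d c : Labelling ℕ T) D → Distinct (table T d c D)
  table-distinct (leaf i)     (leaf d)     (leaf c)     D = step-distinct bare bare d c D (leafTemplates i) []
  table-distinct (node r S T) (node d x y) (node c u v) D =
    outer-distinct (nodeTemplates r) d c D (table S x u D) (table T y v D) []

  -- An exchange argument. The entries `e₁` and `e₂` found below may realise selections other than
  -- `S₁` and `S₂`, but their signatures represent these as well. The code run on them therefore
  -- computes the summary of the given selection, and only prices remain to be compared.
  table-complete : ∀ {t} (T : ParseTree Γ t) (d c : Labelling ℕ T) D (S : Labelling Bool T) → AliveT D d S →
    ∃[ e ] (e ∈ˡ table T d c D × RepT d S (signature e) × price e ≤ cost c S)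
  table-complete (leaf i) (leaf d) (leaf c) D (leaf X) alive =
    let ρ = inputs bare bare d c D
        T = template (leafState {Γ = Γ} i X) X
        (okR , rep) = leaf-summary {Γ = Γ} i d X ρ (λ _ → refl)
        (e , e∈ , eq , le) = step-covers bare bare d c D (leafTemplates i) {T} {[]}
          (∈ˡ.∈-map⁺ _ (∈-choices X)) (ref-yes okR alive)
    in e , e∈ , rep-ext (sym ∘ eq) (rep alive) ,
       ≤-trans le (≤-reflexive (selectedCost-value ρ X (avar ∘ costOf) c (λ _ → refl)))
  table-complete (node r S T) (node d x y) (node c u v) D (node X S₁ S₂) alive =
    let (alive₁ , alive₂) = node-alive⁻ {Γ = Γ} {r = r} {S} {T} {d} {x} {y} {X} {S₁} {S₂} alive
        (e₁ , e₁∈ , rep₁ , le₁) = table-complete S x u D S₁ alive₁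
        (e₂ , e₂∈ , rep₂ , le₂) = table-complete T y v D S₂ alive₂
        ρ = inputs e₁ e₂ d c D
        T₀ = template (nodeState {Γ = Γ} r X) X
        (okR , rep) = node-summary {Γ = Γ} r {S} {T} {x} {y} {S₁} {S₂} d X ρ (λ _ → refl) alive₁ alive₂ rep₁ rep₂
        (e , e∈ , eq , le) = outer-covers (nodeTemplates r) d c D (table S x u D) (table T y v D) {e₁} {e₂} {T₀} {[]}
          e₁∈ e₂∈ (∈ˡ.∈-map⁺ _ (∈-choices X)) (ref-yes okR alive)
    in e , e∈ , rep-ext (sym ∘ eq) (rep alive) , ≤-trans le (≤-trans
       (≤-reflexive (trans (+-comm (price e₁ + price e₂) _)
         (cong (_+ (price e₁ + price e₂)) (selectedCost-value ρ X (avar ∘ costOf) c (λ _ → refl)))))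
       (+-monoʳ-≤ (totalCost c X) (+-mono-≤ le₁ le₂)))

-- The answer from the table of the root.

module _ {t : ℕ} where

  better : Entry t → Maybe (Entry t) → Maybe (Entry t)
  better e nothing  = ifN (accept e) nothing (just e)
  better e (just f) = just (ifN (accept e) f (ifN (price f ∸ price e) f e))

  best : Table t → Maybe (Entry t) → Maybe (Entry t)
  best []       cur = cur
  best (e ∷ es) cur = best es (better e cur)

  -- The loop invariant of `best`, with `In` the entries inspected so far. `Lift` is there because
  -- `P` will be `Realises`, which lives one universe higher.
  Cheapest : ∀ {p} → (Entry t → Set p) → (Entry t → Set) → Maybe (Entry t) → Set p
  Cheapest P In nothing  = Lift _ (∀ f → In f → accept f ≡ 0)
  Cheapest P In (just e) = P e × accept e ≢ 0 × (∀ f → In f → accept f ≢ 0 → price e ≤ price f)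

  Seen : (Entry t → Set) → Entry t → Entry t → Set
  Seen In e f = In f ⊎ f ≡ e

  better-cheapest : ∀ {p} {P : Entry t → Set p} {In} e {cur} → P e → Cheapest P In cur → Cheapest P (Seen In e) (better e cur)
  better-cheapest e {nothing} pe (Level.lift h) with accept e in eq
  ... | zero  = Level.lift λ { f (inj₁ i) → h f i ; f (inj₂ refl) → eq }
  ... | suc _ = pe , (suc≢0 eq) ,
    λ { g (inj₁ i) g≢0 → contradiction (h g i) g≢0 ; g (inj₂ refl) _ → ≤-refl }
  better-cheapest e {just f} pe (pf , ≢0 , min) with accept e in eq
  ... | zero  = pf , ≢0 , λ { g (inj₁ i) g≢0 → min g i g≢0 ; g (inj₂ refl) g≢0 → contradiction eq g≢0 }
  ... | suc _ with price f ∸ price e in eq∸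
  ... | zero  = pf , ≢0 , λ { g (inj₁ i) g≢0 → min g i g≢0 ; g (inj₂ refl) _ → ℕ.m∸n≡0⇒m≤n eq∸ }
  ... | suc _ = pe , (suc≢0 eq) , λ
    { g (inj₁ i) g≢0 → ≤-trans (∸-positive eq∸) (min g i g≢0)
    ; g (inj₂ refl) _ → ≤-refl }

  cheapest-⊆ : ∀ {p} {P : Entry t → Set p} {In In′ : Entry t → Set} cur → (∀ f → In′ f → In f) →
               Cheapest P In cur → Cheapest P In′ cur
  cheapest-⊆ nothing  sub (Level.lift h)         = Level.lift λ f i → h f (sub f i)
  cheapest-⊆ (just _) sub (p , ≢0 , min) = p , ≢0 , λ f i → min f (sub f i)

  best-cheapest : ∀ {p} {P : Entry t → Set p} {In} tb {cur} → All P tb → Cheapest P In cur →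
                  Cheapest P (λ f → In f ⊎ f ∈ˡ tb) (best tb cur)
  best-cheapest []       {cur} []       h = cheapest-⊆ cur (λ { f (inj₁ i) → i }) h
  best-cheapest (e ∷ es) {cur} (p ∷ ps) h = cheapest-⊆ (best es (better e cur))
    (λ { f (inj₁ i) → inj₁ (inj₁ i) ; f (inj₂ (here eq)) → inj₁ (inj₂ eq) ; f (inj₂ (there f∈)) → inj₂ f∈ })
    (best-cheapest es ps (better-cheapest e p h))

module _ {k : ℕ} {Γ : GraphClass k} {t : ℕ} (T : ParseTree Γ t) (d c : Labelling ℕ T) (D : ℕ) where

  private
    G = TGraph.graph (build T)
    Feasible : Subset (Graph.edges G) → Set
    Feasible = FeasibleIn G (flat d) D

  Correct : Maybe (Entry t) → Set
  Correct nothing  = ∀ S → ¬ Feasible S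
  Correct (just e) = Σ[ S ∈ Labelling Bool T ] (ropeBits (rope e) ≡ labelList S × ropeLeaves (rope e) ≡ treeLeaves T ×
    Feasible (flat S) × (∀ S′ → Feasible S′ → totalCost (flat c) (flat S) ≤ totalCost (flat c) S′))

  feasible-entry : ∀ S → Feasible S → ∃[ e ] (e ∈ˡ table T d c D × accept e ≢ 0 × price e ≤ totalCost (flat c) S)
  feasible-entry S f with unflat T S
  ... | S′ , refl with feasible-alive G (flat d) D (flat S′) {τ = terminal (build T)} f
  ... | alive , spans with table-complete T d c D S′ alive
  ... | e , e∈ , rep , le = e , e∈ , accepted , ≤-trans le (≤-reflexive (sym (flat-cost c S′)))
    where
    module R = Realises (All.lookup (table-sound T d c D) e∈)
    ≢0 : ∀ {n P} → Ref n P → P → n ≢ 0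
    ≢0 (holds _)  _ = λ ()
    ≢0 (fails ¬p) p = contradiction p ¬p
    -- The entry may come from another selection, but the signature decides connectedness.
    accepted : accept e ≢ 0
    accepted = ≢0 R.spans λ x y → spans-chosen x y
      where
      spans-chosen : Spanning d R.chosen
      spans-chosen x y with Alive.anchored R.alive x y
      ... | inj₁ c = c
      ... | inj₂ ((i , c) , (j , c′)) = conn-trans c (conn-trans (transfer (Rep.conn-ref rep i j) (Rep.conn-ref R.rep i j) (spans _ _)) (conn-sym c′))
        where
        transfer : ∀ {n P Q} → Ref n P → Ref n Q → P → Q
        transfer (holds _)  (holds q) _ = q
        transfer (fails ¬p) _         p = contradiction p ¬p

  best-correct : Correct (best (table T d c D) nothing)
  best-correct with best (table T d c D) nothing
                  | best-cheapest {In = λ _ → ⊥} (table T d c D) (table-sound T d c D) (Level.lift λ _ ())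
  ... | nothing | Level.lift none = λ S f → let (e , e∈ , ≢0 , _) = feasible-entry S f in ≢0 (none e (inj₂ e∈))
  ... | just e  | R , ≢0 , min = chosen , bits , leaves ,
    alive-feasible G (flat d) D (flat chosen) (build-node T) alive (ref-nonzero spans ≢0) ,
    λ S′ f → let (e′ , e′∈ , ≢0′ , le) = feasible-entry S′ f in
      ≤-trans (≤-reflexive (trans (flat-cost c chosen) (sym price≡))) (≤-trans (min e′ (inj₂ e′∈) ≢0′) le)
    where open Realises R

-- The program.

pattern eqKeyᶠ   = zero
pattern insertᶠ  = suc zero
pattern innerᶠ   = suc (suc zero)
pattern outerᶠ   = suc (suc (suc zero))
pattern processᶠ = suc (suc (suc (suc zero)))
pattern bestᶠ    = suc (suc (suc (suc (suc zero))))
pattern flattenᶠ = suc (suc (suc (suc (suc (suc zero)))))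

signatureOf : Vec ℕ 7
signatureOf = 2 ∷ 2 ∷ 7 ∷ 7 ∷ 4 ∷ 2 ∷ 2 ∷ []

Expr : ℕ → Set
Expr = Exp signatureOf

module _ {x : ℕ} where

  v₀ : Expr (1 + x)
  v₀ = var zero
  v₁ : Expr (2 + x)
  v₁ = var (suc zero)
  v₂ : Expr (3 + x)
  v₂ = var (suc (suc zero))
  v₃ : Expr (4 + x)
  v₃ = var (suc (suc (suc zero)))
  v₄ : Expr (5 + x)
  v₄ = var (suc (suc (suc (suc zero))))
  v₅ : Expr (6 + x)
  v₅ = var (suc (suc (suc (suc (suc zero)))))
  v₆ : Expr (7 + x)
  v₆ = var (suc (suc (suc (suc (suc (suc zero))))))

  acceptOf keyOf priceOf ropeOf : Expr x → Expr x
  acceptOf e = fst e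
  keyOf e    = fst (snd e)
  priceOf e  = fst (snd (snd e))
  ropeOf e   = snd (snd (snd e))

  -- The membership proof serves as the position, so looking up a component of a key compiles to a
  -- fixed chain of projections.
  at : ∀ {A : Set} {a : A} {as} → a ∈ˡ as → Expr x → Expr x
  at (here _)  e = fst e
  at (there p) e = at p (snd e)

  nth : ∀ {n} → Fin n → Expr x → Expr x
  nth zero    e = fst e
  nth (suc i) e = nth i (snd e)

  dropping : ℕ → Expr x → Expr x
  dropping zero    e = e
  dropping (suc n) e = dropping n (snd e)

  switch : (n : ℕ) → Expr x → (Fin n → Expr x) → Expr x
  switch zero    e b = lit 0
  switch (suc n) e b = ifZero e (b zero) (switch n (monus e (lit 1)) (b ∘ suc))

  compile : ∀ {X : Set} → (X → Expr x) → AExp X → Expr x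
  compile f (avar y)    = f y
  compile f (alit n)    = lit n
  compile f (a ⊕ b)     = add (compile f a) (compile f b)
  compile f (a ⊖ b)     = monus (compile f a) (compile f b)
  compile f (if0 a b c) = ifZero (compile f a) (compile f b) (compile f c)

  compileList : ∀ {X A : Set} → (X → Expr x) → (A → AExp X) → List A → Expr x
  compileList f s []       = lit 0
  compileList f s (a ∷ as) = pair (compile f (s a)) (compileList f s as)

  prefixExp : ∀ {a} → Vec Bool a → Expr x → Expr x
  prefixExp []      e = e
  prefixExp (b ∷ X) e = pair (lit (if b then 1 else 0)) (prefixExp X e)

  -- The encoding of `bare`: accepted, with the empty key 0, the price 0 and the code 2 of the empty
  -- rope.
  bareExp : Expr x
  bareExp = pair (lit 1) (pair (lit 0) (pair (lit 0) (lit 2)))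

  record Sources : Set where
    constructor sources
    field
      first second weights costs limitExp : Expr x

    inputExp : ∀ {s t a} → Input s t a → Expr x
    inputExp (sig₁ v)     = at (∈-allVars v) (keyOf first)
    inputExp (sig₂ v)     = at (∈-allVars v) (keyOf second)
    inputExp cost₁        = priceOf first
    inputExp cost₂        = priceOf second
    inputExp (weightOf i) = nth i weights
    inputExp (costOf i)   = nth i costs
    inputExp limit        = limitExp

    candidateExp : ∀ {s t a r} → Template s t a r → Expr x
    candidateExp {r = r} T = pair (compile inputExp (acceptExp T))
      (pair (compileList inputExp (sigExp T) (allVars r))
        (pair (compile inputExp (priceExp T))
          (prefixExp (Template.choice T) (pair (ropeOf first) (ropeOf second)))))

    -- The code of the remaining templates occurs twice, but only one copy is run.
    stepExp : ∀ {s t a r} → List (Template s t a r) → Expr x → Expr x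
    stepExp []       tb = tb
    stepExp (T ∷ Ts) tb = ifZero (compile inputExp (okExp T)) (stepExp Ts tb)
      (call insertᶠ (stepExp Ts tb ∷ candidateExp T ∷ []))

-- `eqKeyBody` answers 0 for equal keys; numbers are equal if both truncated differences vanish.
-- `flattenBody` prepends the bits of a rope to an accumulator, which makes it linear whatever the
-- shape of the rope; the test against 1 separates bits from the code 2 of the empty rope.
eqKeyBody insertBody bestBody flattenBody : Expr 2
eqKeyBody = ifPair v₀
  (ifPair v₁
    (ifZero (monus (fst v₀) (fst v₁))
      (ifZero (monus (fst v₁) (fst v₀)) (call eqKeyᶠ (snd v₀ ∷ snd v₁ ∷ [])) (lit 1))
      (lit 1))
    (lit 1))
  (ifPair v₁ (lit 1) (lit 0))
insertBody = ifPair v₀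
  (ifZero (call eqKeyᶠ (keyOf (fst v₀) ∷ keyOf v₁ ∷ []))
    (ifZero (monus (priceOf (fst v₀)) (priceOf v₁)) v₀ (pair v₁ (snd v₀)))
    (pair (fst v₀) (call insertᶠ (snd v₀ ∷ v₁ ∷ []))))
  (pair v₁ (lit 0))
bestBody = ifPair v₀
  (call bestᶠ (snd v₀ ∷
    ifZero (acceptOf (fst v₀)) v₁
      (ifPair v₁ (ifZero (monus (priceOf v₁) (priceOf (fst v₀))) v₁ (fst v₀)) (fst v₀)) ∷ []))
  v₁
flattenBody = ifPair v₀
  (call flattenᶠ (fst v₀ ∷ call flattenᶠ (snd v₀ ∷ v₁ ∷ []) ∷ []))
  (ifZero (monus v₀ (lit 1)) (pair v₀ v₁) v₁)

-- The arguments are the number of the rule, the two operand tables, the table under construction,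
-- the weights, the costs and the limit. In `innerBody` an entry takes the place of the first table.
outerBody : Expr 7
outerBody = ifPair v₁
  (call outerᶠ (v₀ ∷ snd v₁ ∷ v₂ ∷
    call innerᶠ (v₀ ∷ fst v₁ ∷ v₂ ∷ v₃ ∷ v₄ ∷ v₅ ∷ v₆ ∷ []) ∷ v₄ ∷ v₅ ∷ v₆ ∷ []))
  v₃

module _ {k : ℕ} (Γ : GraphClass k) where
  open GraphClass Γ

  innerSources : Sources {7}
  innerSources = sources v₁ (fst v₂)
    v₄ v₅
    v₆

  innerStep : Fin (length rules) → Expr 7
  innerStep r = Sources.stepExp innerSources (nodeTemplates {Γ = Γ} r) v₃

  innerBody : Expr 7
  innerBody = ifPair v₂
    (call innerᶠ (v₀ ∷ v₁ ∷ snd v₂ ∷ switch _ v₀ innerStep ∷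
      v₄ ∷ v₅ ∷
      v₆ ∷ []))
    v₃

  leafSources : Sources {4}
  leafSources = sources bareExp bareExp v₁ v₂ v₃

  -- Besides the table, processing a subtree returns what is left of the lists of weights and costs,
  -- so that the next subtree starts with its own labels in front.
  processLeaf : Fin (length startGraphs) → Expr 4
  processLeaf i = pair (Sources.stepExp leafSources (leafTemplates {Γ = Γ} i) (lit 0))
    (pair (dropping a v₁) (dropping a v₂))
    where a = startAdds Γ i

  processNode : Fin (length rules) → Expr 4
  processNode r = bind
    (call processᶠ (fst (snd v₀) ∷ dropping a v₁ ∷ dropping a v₂ ∷ v₃ ∷ []))
    (bind
      (call processᶠ (snd (snd v₁) ∷ fst (snd v₀) ∷ snd (snd v₀) ∷ v₄ ∷ []))
      (pair
        -- Under two binders `v₂` is the parse tree, while `v₁` and `v₀` are the results for its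
        -- subtrees. The lists `v₃` and `v₄` are passed undropped, because the labels of the rule's
        -- own edges stand at their front.
        (call outerᶠ (fst v₂ ∷ fst v₁ ∷ fst v₀ ∷ lit 0 ∷
          v₃ ∷ v₄ ∷ v₅ ∷ []))
        (snd v₀)))
    where a = ruleAdds Γ r

  processBody : Expr 4
  processBody = ifPair v₀ (switch _ (fst v₀) processNode) (switch _ v₀ processLeaf)

  program : Program
  program = record
    { functions = 7
    ; arities   = signatureOf
    ; body      = λ { eqKeyᶠ   → eqKeyBody
                    ; insertᶠ  → insertBody
                    ; innerᶠ   → innerBody
                    ; outerᶠ   → outerBody
                    ; processᶠ → processBody
                    ; bestᶠ    → bestBody
                    ; flattenᶠ → flattenBody
                    }
    ; main      = bind
        (call processᶠ (fst (snd v₀) ∷ fst (snd (snd v₀)) ∷ fst (snd (snd (snd v₀))) ∷ snd (snd (snd (snd v₀))) ∷ []))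
        (bind (call bestᶠ (fst v₀ ∷ lit 0 ∷ []))
          (ifPair v₀ (pair (lit 1) (call flattenᶠ (ropeOf v₀ ∷ lit 0 ∷ []))) (lit 0)))
    }

encodeList : ∀ {A : Set} → (A → Val) → List A → Val
encodeList f []       = num 0
encodeList f (x ∷ xs) = f x ∙ encodeList f xs

encodeVec-toList : ∀ {A : Set} {m} (f : A → Val) (v : Vec A m) → encodeVec f v ≡ encodeList f (toList v)
encodeVec-toList f []      = refl
encodeVec-toList f (x ∷ v) = cong (f x ∙_) (encodeVec-toList f v)

encodeBit : Bool → Val
encodeBit b = num (if b then 1 else 0)

-- Bits are 0 and 1, so 2 is free to stand for the empty rope.
encodeRope : Rope → Val
encodeRope (bit b) = encodeBit b
encodeRope empty   = num 2
encodeRope (r · s) = encodeRope r ∙ encodeRope s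

encodeEntry : ∀ {t} → Entry t → Val
encodeEntry e = num (accept e) ∙ encodeList num (key e) ∙ num (price e) ∙ encodeRope (rope e)

encodeTable : ∀ {t} → Table t → Val
encodeTable = encodeList encodeEntry

encodeChoice : ∀ {t} → Maybe (Entry t) → Val
encodeChoice nothing  = num 0
encodeChoice (just e) = encodeEntry e

-- Running expressions within a time bound.

module Running (P : Program) where
  open Program P
  open Semantics P

  record Run {x} (ρ : Vec Val x) (e : Exp arities x) (v : Val) (T : ℕ) : Set where
    constructor ran
    field
      {time}     : ℕ
      derivation : ρ ⊢ e ⇓ v ⟨ time ⟩
      within     : time ≤ T

  record Runs {x y} (ρ : Vec Val x) (es : Vec (Exp arities x) y) (vs : Vec Val y) (T : ℕ) : Set where
    constructor ran
    field
      {time}     : ℕ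
      derivation : ρ ⊢* es ⇓ vs ⟨ time ⟩
      within     : time ≤ T

  private
    both : ∀ {a b c d} → a ≤ b → c ≤ d → 1 + a + c ≤ 1 + b + d
    both p q = s≤s (+-mono-≤ p q)

  relax : ∀ {x} {ρ : Vec Val x} {e v S T} → Run ρ e v S → S ≤ T → Run ρ e v T
  relax (ran d p) q = ran d (≤-trans p q)

  module _ {x : ℕ} {ρ : Vec Val x} where

    r-var : ∀ {i} → Run ρ (var i) (lookup ρ i) 1
    r-var = ran var ≤-refl

    r-lit : ∀ {n} → Run ρ (lit n) (num n) 1
    r-lit = ran lit ≤-refl

    r-add : ∀ {a b m n S T} → Run ρ a (num m) S → Run ρ b (num n) T → Run ρ (add a b) (num (m + n)) (1 + S + T)
    r-add (ran d p) (ran d′ p′) = ran (add d d′) (both p p′)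

    r-monus : ∀ {a b m n S T} → Run ρ a (num m) S → Run ρ b (num n) T → Run ρ (monus a b) (num (m ∸ n)) (1 + S + T)
    r-monus (ran d p) (ran d′ p′) = ran (monus d d′) (both p p′)

    r-pair : ∀ {a b v w S T} → Run ρ a v S → Run ρ b w T → Run ρ (pair a b) (v ∙ w) (1 + S + T)
    r-pair (ran d p) (ran d′ p′) = ran (pair d d′) (both p p′)

    r-fst : ∀ {a v w T} → Run ρ a (v ∙ w) T → Run ρ (fst a) v (1 + T)
    r-fst (ran d p) = ran (fst d) (s≤s p)

    r-snd : ∀ {a v w T} → Run ρ a (v ∙ w) T → Run ρ (snd a) w (1 + T)
    r-snd (ran d p) = ran (snd d) (s≤s p)

    r-zero : ∀ {a b b′ v S T} → Run ρ a (num 0) S → Run ρ b v T → Run ρ (ifZero a b b′) v (1 + S + T)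
    r-zero (ran d p) (ran d′ p′) = ran (zeroYes d d′) (both p p′)

    r-suc : ∀ {a b b′ n v S T} → Run ρ a (num (suc n)) S → Run ρ b′ v T → Run ρ (ifZero a b b′) v (1 + S + T)
    r-suc (ran d p) (ran d′ p′) = ran (zeroNo d d′) (both p p′)

    r-isPair : ∀ {a b b′ u w v S T} → Run ρ a (u ∙ w) S → Run ρ b v T → Run ρ (ifPair a b b′) v (1 + S + T)
    r-isPair (ran d p) (ran d′ p′) = ran (pairYes d d′) (both p p′)

    r-isNum : ∀ {a b b′ n v S T} → Run ρ a (num n) S → Run ρ b′ v T → Run ρ (ifPair a b b′) v (1 + S + T)
    r-isNum (ran d p) (ran d′ p′) = ran (pairNo d d′) (both p p′)

    r-bind : ∀ {a b u v S T} → Run ρ a u S → Run (u ∷ ρ) b v T → Run ρ (bind a b) v (1 + S + T)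
    r-bind (ran d p) (ran d′ p′) = ran (bind d d′) (both p p′)

    r-call : ∀ {g as vs v S T} → Runs ρ as vs S → Run vs (body g) v T → Run ρ (call g as) v (1 + S + T)
    r-call (ran d p) (ran d′ p′) = ran (call d d′) (both p p′)

    r-[] : Runs ρ [] [] 0
    r-[] = ran [] z≤n

    infixr 5 _r∷_
    _r∷_ : ∀ {y a v S T} {as : Vec (Exp arities x) y} {vs} → Run ρ a v S → Runs ρ as vs T → Runs ρ (a ∷ as) (v ∷ vs) (S + T)
    ran d p r∷ ran d′ p′ = ran (d ∷ d′) (+-mono-≤ p p′)

-- Turns a linear inequality into an equation for the ring solver, once the difference of the two
-- sides is named.
by-slack : ∀ {m n} k → m + k ≡ n → m ≤ n
by-slack {m} k eq = subst (m ≤_) eq (m≤m+n m k)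

-- Cost functions, determined by the code and by bounds on table sizes, not by computed values.

acost : ∀ {X} → (X → ℕ) → AExp X → ℕ
acost τ (avar y)    = τ y
acost τ (alit n)    = 1
acost τ (a ⊕ b)     = 1 + acost τ a + acost τ b
acost τ (a ⊖ b)     = 1 + acost τ a + acost τ b
-- Both branches are charged, so that the bound does not depend on the outcome of the test.
acost τ (if0 a b c) = 1 + acost τ a + (acost τ b + acost τ c)

acosts : ∀ {X A : Set} → (X → ℕ) → (A → AExp X) → List A → ℕ
acosts τ s []       = 1
acosts τ s (a ∷ as) = 1 + acost τ (s a) + acosts τ s as

depth : ∀ {A : Set} {a : A} {as} → a ∈ˡ as → ℕ
depth (here _)  = 1
depth (there p) = suc (depth p)

-- The selector is evaluated anew at each test, under one more subtraction that costs 2 steps; hence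
-- the growing second argument. The number of cases depends on the class alone.
switchCost : ℕ → ℕ → ℕ
switchCost zero    S = 0
switchCost (suc n) S = 1 + S + switchCost n (1 + S + 1)

inputTime : ∀ {s t a} → ℕ → Input s t a → ℕ
inputTime S (sig₁ v)     = depth (∈-allVars v) + (2 + S)
inputTime S (sig₂ v)     = depth (∈-allVars v) + (2 + S)
inputTime S cost₁        = 3 + S
inputTime S cost₂        = 3 + S
inputTime S (weightOf i) = suc (toℕ i) + S
inputTime S (costOf i)   = suc (toℕ i) + S
inputTime S limit        = S

candidateCost templateCost : ∀ {s t a r} → ℕ → Template s t a r → ℕ
candidateCost {a = a} {r} S T = 1 + acost τ (acceptExp T) +
  (1 + acosts τ (sigExp T) (allVars r) + (1 + acost τ (priceExp T) + (a * 2 + (1 + (3 + S) + (3 + S)))))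
  where τ = inputTime S
templateCost S T = 3 + acost (inputTime S) (okExp T) + candidateCost S T

insertUnit : ℕ → ℕ
insertUnit t = 60 + suc (length (allVars t)) * 30

-- `N` bounds the table throughout the step, so every template is charged for an insertion into a
-- table of length `N`.
stepCost : ∀ {s t a r} → ℕ → List (Template s t a r) → ℕ → ℕ
stepCost S []       N = 0
stepCost {r = r} S (T ∷ Ts) N = stepCost S Ts N + (templateCost S T + suc N * insertUnit r)

around : ∀ a b c q r → a + b ≤ c → a + (q + (b + r)) ≤ c + (q + r)
around a b c q r le = ≤-trans
  (≤-reflexive (solve 4 (λ a b q r → a :+ (q :+ (b :+ r)) := a :+ b :+ (q :+ r)) refl a b q r))
  (+-monoˡ-≤ (q + r) le)
  where open +-*-Solver

before : ∀ a b c q r → a + b ≤ c → a + (q + b) ≤ c + (q + r)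
before a b c q r le = ≤-trans (+-monoʳ-≤ a (+-monoʳ-≤ q (m≤m+n b r))) (around a b c q r le)

skip : ∀ o s c x u → 1 + o + (s + c) ≤ s + (c + (3 + o + x + u))
skip o s c x u = by-slack (2 + x + u) (solve 5 (λ o s c x u →
  con 1 :+ o :+ (s :+ c) :+ (con 2 :+ x :+ u) := s :+ (c :+ (con 3 :+ o :+ x :+ u))) refl o s c x u)
  where open +-*-Solver

take : ∀ o s c x u → 1 + o + (1 + ((s + c) + (x + 0)) + u) ≤ s + (c + (3 + o + x + u))
take o s c x u = by-slack 1 (solve 5 (λ o s c x u →
  con 1 :+ o :+ (con 1 :+ ((s :+ c) :+ (x :+ con 0)) :+ u) :+ con 1 := s :+ (c :+ (con 3 :+ o :+ x :+ u)))
  refl o s c x u)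
  where open +-*-Solver

-- Running times of the functions of the program.

module _ {k : ℕ} (Γ : GraphClass k) where
  open GraphClass Γ
  open Running (program Γ)

  module _ {x : ℕ} {ρ : Vec Val x} where

    r-cond : ∀ {a b b′ n v S T T′} → Run ρ a (num n) S → (n ≡ 0 → Run ρ b v T) → (n ≢ 0 → Run ρ b′ v T′) →
             Run ρ (ifZero a b b′) v (1 + S + (T + T′))
    r-cond {n = zero}  {S = S} {T} {T′} ra rb rb′ = relax (r-zero ra (rb refl)) (+-monoʳ-≤ (1 + S) (m≤m+n T T′))
    r-cond {n = suc _} {S = S} {T} {T′} ra rb rb′ = relax (r-suc ra (rb′ λ ())) (+-monoʳ-≤ (1 + S) (m≤n+m T′ T))

    r-nonzero : ∀ {a b b′ n v S T} → Run ρ a (num n) S → n ≢ 0 → Run ρ b′ v T → Run ρ (ifZero a b b′) v (1 + S + T)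
    r-nonzero {n = zero}  ra ≢0 rb = contradiction refl ≢0
    r-nonzero {n = suc _} ra ≢0 rb = r-suc ra rb

    r-null : ∀ {a b b′ n v S T} → Run ρ a (num n) S → n ≡ 0 → Run ρ b v T → Run ρ (ifZero a b b′) v (1 + S + T)
    r-null ra refl rb = r-zero ra rb

    r-if : ∀ {A : Set} (enc : A → Val) {x y a b b′ n S T T′} → Run ρ a (num n) S → Run ρ b (enc x) T → Run ρ b′ (enc y) T′ →
           Run ρ (ifZero a b b′) (enc (ifN n x y)) (1 + S + (T + T′))
    r-if enc {n = zero}  {S} {T} {T′} ra rb rb′ = relax (r-zero ra rb) (+-monoʳ-≤ (1 + S) (m≤m+n T T′))
    r-if enc {n = suc _} {S} {T} {T′} ra rb rb′ = relax (r-suc ra rb′) (+-monoʳ-≤ (1 + S) (m≤n+m T′ T))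

    compile-run : ∀ {X : Set} {f : X → Expr x} {τ : X → ℕ} {env : X → ℕ} → (∀ y → Run ρ (f y) (num (env y)) (τ y)) →
                  ∀ a → Run ρ (compile f a) (num (aeval env a)) (acost τ a)
    compile-run h (avar y) = h y
    compile-run h (alit n) = r-lit
    compile-run h (a ⊕ b)  = r-add (compile-run h a) (compile-run h b)
    compile-run h (a ⊖ b)  = r-monus (compile-run h a) (compile-run h b)
    compile-run h (if0 a b c) = r-if num (compile-run h a) (compile-run h b) (compile-run h c)

    compileList-run : ∀ {X A : Set} {f : X → Expr x} {τ : X → ℕ} {env : X → ℕ} {s : A → AExp X} →
      (∀ y → Run ρ (f y) (num (env y)) (τ y)) →
      ∀ as → Run ρ (compileList f s as) (encodeList num (List.map (aeval env ∘ s) as)) (acosts τ s as)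
    compileList-run h []       = r-lit
    compileList-run {s = s} h (a ∷ as) = r-pair (compile-run h (s a)) (compileList-run h as)

    at-run : ∀ {A : Set} {σ : A → ℕ} {a as S e} (p : a ∈ˡ as) → Run ρ e (encodeList num (List.map σ as)) S →
             Run ρ (at p e) (num (σ a)) (depth p + S)
    at-run (here refl)  r = r-fst r
    at-run {S = S} (there p) r = relax (at-run p (r-snd r)) (≤-reflexive (ℕ.+-suc (depth p) S))

    nth-run : ∀ {n} {v : Vec ℕ n} {rest S e} i → Run ρ e (encodeList num (toList v ++ rest)) S →
              Run ρ (nth i e) (num (lookup v i)) (suc (toℕ i) + S)
    nth-run {v = x ∷ v} zero    r = r-fst r
    nth-run {v = x ∷ v} {S = S} (suc i) r = relax (nth-run {v = v} i (r-snd r)) (≤-reflexive (cong suc (ℕ.+-suc (toℕ i) S)))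

    dropping-run : ∀ {n} (v : Vec ℕ n) {rest S e} → Run ρ e (encodeList num (toList v ++ rest)) S →
                   Run ρ (dropping n e) (encodeList num rest) (n + S)
    dropping-run []      r = r
    dropping-run {n = suc n} (x ∷ v) {S = S} r = relax (dropping-run v (r-snd r)) (≤-reflexive (ℕ.+-suc n S))

    switch-run : ∀ {n S T v e} {b : Fin n → Expr x} i → Run ρ e (num (toℕ i)) S → Run ρ (b i) v T →
                 Run ρ (switch n e b) v (switchCost n S + T)
    switch-run {suc n} {S} {T} zero    re rb = relax (r-zero re rb) (+-monoˡ-≤ T (m≤m+n (1 + S) _))
    switch-run {suc n} {S} {T} {b = b} (suc i) re rb =
      relax (r-suc re (switch-run {b = b ∘ suc} i (r-monus re r-lit) rb))
        (≤-reflexive (sym (+-assoc (1 + S) (switchCost n (1 + S + 1)) T)))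

    prefix-run : ∀ {a r S e} (X : Vec Bool a) → Run ρ e (encodeRope r) S →
                 Run ρ (prefixExp X e) (encodeRope (prefix X r)) (a * 2 + S)
    prefix-run []      re = re
    prefix-run (b ∷ X) re = r-pair r-lit (prefix-run X re)

    entry-key : ∀ {t} {e : Entry t} {x S} → Run ρ x (encodeEntry e) S → Run ρ (keyOf x) (encodeList num (key e)) (2 + S)
    entry-key r = r-fst (r-snd r)

    entry-price : ∀ {t} {e : Entry t} {x S} → Run ρ x (encodeEntry e) S → Run ρ (priceOf x) (num (price e)) (3 + S)
    entry-price r = r-fst (r-snd (r-snd r))

    entry-rope : ∀ {t} {e : Entry t} {x S} → Run ρ x (encodeEntry e) S → Run ρ (ropeOf x) (encodeRope (rope e)) (3 + S)
    entry-rope r = r-snd (r-snd (r-snd r))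

  eqKey-run : ∀ xs ys → ∃[ n ] (Run (encodeList num xs ∷ encodeList num ys ∷ []) eqKeyBody (num n) (suc (length xs) * 30) ×
                                 (n ≡ 0 → xs ≡ ys) × (n ≢ 0 → xs ≢ ys))
  eqKey-run [] [] = 0 , relax (r-isNum r-var (r-isNum r-var r-lit)) (m≤m+n _ _) , (λ _ → refl) , λ ne → contradiction refl ne
  eqKey-run [] (y ∷ ys) = 1 , relax (r-isNum r-var (r-isPair r-var r-lit)) (m≤m+n _ _) , (λ ()) , λ _ ()
  eqKey-run (x ∷ xs) [] = 1 , relax (r-isPair r-var (r-isNum r-var r-lit)) (m≤m+n _ _) , (λ ()) , λ _ ()
  eqKey-run (x ∷ xs) (y ∷ ys) with eqKey-run xs ys | x Data.Nat.≟ y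
  ... | _ | no x≢y = 1 ,
    relax (r-isPair r-var (r-isPair r-var (r-cond (r-monus (r-fst r-var) (r-fst r-var))
      (λ z → r-nonzero (r-monus (r-fst r-var) (r-fst r-var))
        (λ z′ → x≢y (≤-antisym (ℕ.m∸n≡0⇒m≤n z) (ℕ.m∸n≡0⇒m≤n z′))) r-lit)
      (λ _ → r-lit)))) (m≤m+n _ _) ,
    (λ ()) , λ _ eq → x≢y (Listₚ.∷-injectiveˡ eq)
  ... | n , rec , eq , ne | yes refl = n ,
    relax (r-isPair r-var (r-isPair r-var (r-zero (zeroed (r-monus (r-fst r-var) (r-fst r-var)))
      (r-zero (zeroed (r-monus (r-fst r-var) (r-fst r-var))) (r-call (r-snd r-var r∷ r-snd r-var r∷ r-[]) rec)))))
      (m≤n+m _ 9) ,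
    (λ z → cong (x ∷_) (eq z)) , λ z → ne z ∘ Listₚ.∷-injectiveʳ
    where
    zeroed : ∀ {z e S} {ρ : Vec Val z} → Run ρ e (num (x ∸ x)) S → Run ρ e (num 0) S
    zeroed {e = e} {S} {ρ} = subst (λ m → Run ρ e (num m) S) (ℕ.n∸n≡0 x)

  -- Keys over the same number of terminals have the same length, so a single bound serves all
  -- comparisons.
  key-run : ∀ {t} (f e : Entry t) → ∃[ n ]
    (Run (encodeList num (key f) ∷ encodeList num (key e) ∷ []) eqKeyBody (num n) (suc (length (allVars t)) * 30) ×
     (n ≡ 0 → key f ≡ key e) × (n ≢ 0 → key f ≢ key e))
  key-run {t} f e = let (n , r , spec) = eqKey-run (key f) (key e) in
    n , relax r (≤-reflexive (cong (λ n → suc n * 30) (Listₚ.length-map (signature f) (allVars t)))) , spec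

  Compares : ℕ → ℕ → Set
  Compares t K = ∀ (f e : Entry t) → ∃[ n ] (Run (encodeList num (key f) ∷ encodeList num (key e) ∷ []) eqKeyBody (num n) K ×
                   (n ≡ 0 → key f ≡ key e) × (n ≢ 0 → key f ≢ key e))

  insert-within : ∀ {t K} → Compares t K → (tb : Table t) (e : Entry t) →
    Run (encodeTable tb ∷ encodeEntry e ∷ []) insertBody (encodeTable (insert tb e)) (suc (length tb) * (60 + K))
  insert-within cmp []       e = relax (r-isNum r-var (r-pair r-var r-lit)) (m≤m+n 5 _)
  insert-within {t} {K} cmp (f ∷ fs) e with cmp f e
  ... | n , test , eq , ne with Listₚ.≡-dec ℕ._≟_ (key f) (key e)
  ... | no k≢ =
    relax (r-isPair r-var (r-nonzero (r-call (entry-key {e = f} (r-fst r-var) r∷ entry-key {e = e} r-var r∷ r-[]) test) (k≢ ∘ eq)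
      (r-pair (r-fst r-var) (r-call (r-snd r-var r∷ r-var r∷ r-[]) (insert-within cmp fs e)))))
      (around 11 7 60 K (suc (length fs) * (60 + K)) (m≤m+n 18 42))
  ... | yes k≡ with price f ∸ price e in eq∸
  ... | zero  = relax (r-isPair r-var (r-null (r-call (entry-key {e = f} (r-fst r-var) r∷ entry-key {e = e} r-var r∷ r-[]) test)
      (≤-antisym (ℕ.≮⇒≥ λ n>0 → ne (ℕ.m<n⇒n≢0 n>0) k≡) z≤n)
      (r-null (r-monus (entry-price {e = f} (r-fst r-var)) (entry-price {e = e} r-var)) eq∸ r-var)))
      (before 11 12 60 K (suc (length fs) * (60 + K)) (m≤m+n 23 37))
  ... | suc _ = relax (r-isPair r-var (r-null (r-call (entry-key {e = f} (r-fst r-var) r∷ entry-key {e = e} r-var r∷ r-[]) test)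
      (≤-antisym (ℕ.≮⇒≥ λ n>0 → ne (ℕ.m<n⇒n≢0 n>0) k≡) z≤n)
      (r-nonzero (r-monus (entry-price {e = f} (r-fst r-var)) (entry-price {e = e} r-var))
        (suc≢0 eq∸) (r-pair r-var (r-snd r-var)))))
      (before 11 15 60 K (suc (length fs) * (60 + K)) (m≤m+n 26 34))

  insert-run : ∀ {t} (tb : Table t) (e : Entry t) →
    Run (encodeTable tb ∷ encodeEntry e ∷ []) insertBody (encodeTable (insert tb e)) (suc (length tb) * insertUnit t)
  insert-run = insert-within key-run

  -- `S` bounds the time to fetch any one source. The lists of weights and costs may continue with
  -- labels of other parse tree nodes, whence `restᵈ` and `restᶜ`.
  record Ready {x s t a} (ρ : Vec Val x) (src : Sources {x}) (e : Entry s) (f : Entry t) (d c : Vec ℕ a) (D S : ℕ) : Set where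
    open Sources src
    field
      {restᵈ restᶜ} : List ℕ
      first-run     : Run ρ first (encodeEntry e) S
      second-run    : Run ρ second (encodeEntry f) S
      weights-run   : Run ρ weights (encodeList num (toList d ++ restᵈ)) S
      costs-run     : Run ρ costs (encodeList num (toList c ++ restᶜ)) S
      limit-run     : Run ρ limitExp (num D) S

    input-run : ∀ y → Run ρ (inputExp y) (num (inputs e f d c D y)) (inputTime S y)
    input-run (sig₁ v)     = at-run {σ = signature e} (∈-allVars v) (entry-key {e = e} first-run)
    input-run (sig₂ v)     = at-run {σ = signature f} (∈-allVars v) (entry-key {e = f} second-run)
    input-run cost₁        = entry-price {e = e} first-run
    input-run cost₂        = entry-price {e = f} second-run
    input-run (weightOf i) = nth-run {v = d} i weights-run
    input-run (costOf i)   = nth-run {v = c} i costs-run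
    input-run limit        = limit-run

    candidate-run : ∀ {r} (T : Template s t a r) →
                    Run ρ (candidateExp T) (encodeEntry (candidate e f d c D T)) (candidateCost S T)
    candidate-run {r} T = r-pair (compile-run input-run (acceptExp T))
      (r-pair (compileList-run input-run (allVars r))
        (r-pair (compile-run input-run (priceExp T))
          (prefix-run (Template.choice T) (r-pair (entry-rope {e = e} first-run) (entry-rope {e = f} second-run)))))

    step-run : ∀ {r} (Ts : List (Template s t a r)) {tb tbE S′ N} → Run ρ tbE (encodeTable tb) S′ →
               length Ts + length tb ≤ N →
               Run ρ (stepExp Ts tbE) (encodeTable (step-table e f d c D Ts tb)) (S′ + stepCost S Ts N)
    step-run []       {S′ = S′} r le = relax r (m≤m+n S′ 0)
    step-run {r} (T ∷ Ts) {tb} {tbE} {S′} {N} rtb le with aeval (inputs e f d c D) (okExp T) | compile-run input-run (okExp T)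
    ... | zero  | ok = relax (r-zero ok (step-run Ts {tb} rtb (ℕ.<⇒≤ le)))
      (skip (acost (inputTime S) (okExp T)) S′ (stepCost S Ts N) (candidateCost S T) (suc N * insertUnit r))
    ... | suc _ | ok = relax (r-suc ok (r-call (step-run Ts {tb} rtb (ℕ.<⇒≤ le) r∷ candidate-run T r∷ r-[])
        (relax (insert-run (step-table e f d c D Ts tb) (candidate e f d c D T))
          (*-monoˡ-≤ (insertUnit r) (s≤s (≤-trans (step-length e f d c D Ts tb) (ℕ.<⇒≤ le)))))))
      (take (acost (inputTime S) (okExp T)) S′ (stepCost S Ts N) (candidateCost S T) (suc N * insertUnit r))

innerSum : ∀ s t r → 1 + 1 + (1 + (1 + (1 + (2 + ((s + (1 + t)) + 3)))) + r) ≤ (30 + s + t) + r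
innerSum s t r = by-slack 19 (solve 3 (λ s t r →
  con 1 :+ con 1 :+ (con 1 :+ (con 1 :+ (con 1 :+ (con 2 :+ ((s :+ (con 1 :+ t)) :+ con 3)))) :+ r) :+ con 19
    := (con 30 :+ s :+ t) :+ r) refl s t r)
  where open +-*-Solver

outerSum : ∀ i r → 1 + 1 + (1 + (1 + (2 + (1 + ((9 + i) + 3)))) + r) ≤ (40 + i) + r
outerSum i r = by-slack 21 (solve 2 (λ i r →
  con 1 :+ con 1 :+ (con 1 :+ (con 1 :+ (con 2 :+ (con 1 :+ ((con 9 :+ i) :+ con 3)))) :+ r) :+ con 21
    := (con 40 :+ i) :+ r) refl i r)
  where open +-*-Solver

nodeSum : ∀ w a o s t W → 60 + w + (a + a) + o ≤ W →
  1 + 1 + (w + (1 + (1 + (3 + ((a + 1) + ((a + 1) + 1))) + s * W) + (1 + (11 + t * W) + (1 + (11 + o) + 2)))) ≤ suc (s + t) * W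
nodeSum w a o s t W le = ≤-trans
  (by-slack 24 (solve 6 (λ w a o s t W →
    con 1 :+ con 1 :+ (w :+ (con 1 :+ (con 1 :+ (con 3 :+ ((a :+ con 1) :+ ((a :+ con 1) :+ con 1))) :+ s :* W) :+
      (con 1 :+ (con 11 :+ t :* W) :+ (con 1 :+ (con 11 :+ o) :+ con 2)))) :+ con 24
    := (con 60 :+ w :+ (a :+ a) :+ o) :+ (s :+ t) :* W) refl w a o s t W))
  (+-monoˡ-≤ ((s + t) * W) le)
  where open +-*-Solver

flattenSum : ∀ r s → 1 + 1 + (1 + (2 + ((1 + 3 + s) + 0)) + r) + 12 ≤ (r + 12) + (s + 12)
flattenSum r s = by-slack 3 (solve 2 (λ r s →
  con 1 :+ con 1 :+ (con 1 :+ (con 2 :+ ((con 1 :+ con 3 :+ s) :+ con 0)) :+ r) :+ con 12 :+ con 3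
    := (r :+ con 12) :+ (s :+ con 12)) refl r s)
  where open +-*-Solver

module _ {k : ℕ} (Γ : GraphClass k) where
  open GraphClass Γ
  open Running (program Γ)

  module _ (r : Fin (length rules)) where
    private
      Ts = nodeTemplates {Γ = Γ} r
      J  = length Ts

    innerUnit outerUnit : ℕ → ℕ
    innerUnit N = 30 + switchCost (length rules) 1 + stepCost 2 Ts N
    outerUnit N = 40 + suc N * innerUnit N

    module _ (d c : Vec ℕ (ruleAdds Γ r)) (restᵈ restᶜ : List ℕ) (D : ℕ) where
      private
        ds = encodeList num (toList d ++ restᵈ)
        cs = encodeList num (toList c ++ restᶜ)

      inner-length : ∀ e fs tb → length (inner-table Ts d c D e fs tb) ≤ length fs * J + length tb
      inner-length e []       tb = ≤-refl
      inner-length e (f ∷ fs) tb = ≤-trans (inner-length e fs (step-table e f d c D Ts tb))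
        (≤-trans (+-monoʳ-≤ (length fs * J) (step-length e f d c D Ts tb))
          (≤-reflexive (trans (sym (+-assoc (length fs * J) J (length tb)))
            (cong (_+ length tb) (+-comm (length fs * J) J)))))

      inner-run : ∀ {N} e fs tb → length fs * J + length tb ≤ N →
        Run (num (toℕ r) ∷ encodeEntry e ∷ encodeTable fs ∷ encodeTable tb ∷ ds ∷ cs ∷ num D ∷ []) (innerBody Γ)
            (encodeTable (inner-table Ts d c D e fs tb)) (suc (length fs) * innerUnit N)
      inner-run e [] tb le = relax (r-isNum r-var r-var) (m≤m+n 3 _)
      inner-run {N} e (f ∷ fs) tb le =
        relax (r-isPair r-var (r-call
          (r-var r∷ r-var r∷ r-snd r-var r∷
           switch-run Γ {b = innerStep Γ} r r-var
             (Ready.step-run ready Ts {tb} {N = N} r-var (≤-trans (+-monoˡ-≤ (length tb) (m≤m+n J (length fs * J))) le)) r∷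
           r-var r∷ r-var r∷ r-var r∷ r-[])
          (inner-run {N} e fs (step-table e f d c D Ts tb) shorter)))
          (innerSum (switchCost (length rules) 1) (stepCost 2 Ts N) (suc (length fs) * innerUnit N))
        where
        shorter : length fs * J + length (step-table e f d c D Ts tb) ≤ N
        shorter = ≤-trans (+-monoʳ-≤ (length fs * J) (step-length e f d c D Ts tb))
          (≤-trans (≤-reflexive (trans (sym (+-assoc (length fs * J) J (length tb)))
            (cong (_+ length tb) (+-comm (length fs * J) J)))) le)
        ready : Ready Γ (num (toℕ r) ∷ encodeEntry e ∷ encodeTable (f ∷ fs) ∷ encodeTable tb ∷ ds ∷ cs ∷ num D ∷ [])
                        (innerSources Γ) e f d c D 2
        ready = record { restᵈ = restᵈ ; restᶜ = restᶜ
          ; first-run = relax r-var (s≤s z≤n) ; second-run = r-fst r-var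
          ; weights-run = relax r-var (s≤s z≤n) ; costs-run = relax r-var (s≤s z≤n) ; limit-run = relax r-var (s≤s z≤n) }

      outer-run : ∀ {N} es fs tb → length fs ≤ N → length es * (length fs * J) + length tb ≤ N →
        Run (num (toℕ r) ∷ encodeTable es ∷ encodeTable fs ∷ encodeTable tb ∷ ds ∷ cs ∷ num D ∷ []) outerBody
            (encodeTable (outer-table Ts d c D es fs tb)) (suc (length es) * outerUnit N)
      outer-run []       fs tb le le′ = relax (r-isNum r-var r-var) (m≤m+n 3 _)
      outer-run {N} (e ∷ es) fs tb le le′ =
        relax (r-isPair r-var (r-call
          (r-var r∷ r-snd r-var r∷ r-var r∷
           r-call (r-var r∷ r-fst r-var r∷ r-var r∷ r-var r∷ r-var r∷ r-var r∷ r-var r∷ r-[])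
             (relax (inner-run {N} e fs tb (≤-trans (+-monoˡ-≤ (length tb) (m≤m+n F (length es * F))) le′))
                    (*-monoˡ-≤ (innerUnit N) (s≤s le))) r∷
           r-var r∷ r-var r∷ r-var r∷ r-[])
          (outer-run {N} es fs (inner-table Ts d c D e fs tb) le shorter)))
          (outerSum (suc N * innerUnit N) (suc (length es) * outerUnit N))
        where
        F = length fs * J
        shorter : length es * F + length (inner-table Ts d c D e fs tb) ≤ N
        shorter = ≤-trans (+-monoʳ-≤ (length es * F) (inner-length e fs tb))
          (≤-trans (≤-reflexive (trans (sym (+-assoc (length es * F) F (length tb)))
            (cong (_+ length tb) (+-comm (length es * F) F)))) le′)

    -- There are at most `B * (B * J)` candidates, which bounds every intermediate table; the
    -- summand `B` is added so that the same number also bounds the operand tables, as `outer-run`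
    -- requires. The final `B` is a bound on distinct signatures, not on candidates.
    nodeCost : ℕ → ℕ
    nodeCost B = 60 + switchCost (length rules) 2 + (a + a) + suc B * outerUnit (B + B * (B * J))
      where a = ruleAdds Γ r

  -- The 7 is the time to construct `bareExp`, the most expensive of the sources at a leaf.
  leafCost : Fin (length startGraphs) → ℕ
  leafCost i = 1 + 1 + (switchCost (length startGraphs) 1 +
    (1 + (1 + stepCost 7 Ts (length Ts + 0)) + (1 + (a + 1) + (a + 1))))
    where
    Ts = leafTemplates {Γ = Γ} i
    a = startAdds Γ i

  module _ {B D W : ℕ} (small : ∀ {t} (T : ParseTree Γ t) d c → length (table T d c D) ≤ B)
           (leaf≤ : ∀ i → leafCost i ≤ W) (node≤ : ∀ r → nodeCost r B ≤ W) where

    process-run : ∀ {t} (T : ParseTree Γ t) (d c : Labelling ℕ T) (restᵈ restᶜ : List ℕ) →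
      Run (encodeParse T ∷ encodeList num (labelList d ++ restᵈ) ∷ encodeList num (labelList c ++ restᶜ) ∷ num D ∷ []) (processBody Γ)
          (encodeTable (table T d c D) ∙ encodeList num restᵈ ∙ encodeList num restᶜ) (size T * W)
    process-run (leaf i) (leaf d) (leaf c) restᵈ restᶜ =
      relax (r-isNum r-var (switch-run Γ {b = processLeaf Γ} i r-var
        (r-pair (Ready.step-run ready (leafTemplates {Γ = Γ} i) {[]} r-lit ≤-refl)
          (r-pair (dropping-run Γ d r-var) (dropping-run Γ c r-var)))))
        (≤-trans (leaf≤ i) (m≤m+n W 0))
      where
      bare-run : ∀ {x} {ρ : Vec Val x} → Run ρ bareExp (encodeEntry bare) 7
      bare-run = r-pair r-lit (r-pair r-lit (r-pair r-lit r-lit))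
      ready : Ready Γ (encodeFin i ∷ encodeList num (toList d ++ restᵈ) ∷ encodeList num (toList c ++ restᶜ) ∷ num D ∷ [])
                      (leafSources Γ) bare bare d c D 7
      ready = record { restᵈ = restᵈ ; restᶜ = restᶜ ; first-run = bare-run ; second-run = bare-run
        ; weights-run = relax r-var (s≤s z≤n) ; costs-run = relax r-var (s≤s z≤n) ; limit-run = relax r-var (s≤s z≤n) }
    process-run (node r S T) (node d x y) (node c u v) restᵈ restᶜ =
      relax (r-isPair r-var (switch-run Γ {b = processNode Γ} r (r-fst r-var)
        (r-bind (r-call
            (r-fst (r-snd r-var) r∷ dropping-run Γ d (regroup d x y restᵈ refl) r∷ dropping-run Γ c (regroup c u v restᶜ refl) r∷ r-var r∷ r-[])
            (process-run S x u (labelList y ++ restᵈ) (labelList v ++ restᶜ)))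
          (r-bind (r-call (r-snd (r-snd r-var) r∷ r-fst (r-snd r-var) r∷ r-snd (r-snd r-var) r∷ r-var r∷ r-[])
              (process-run T y v restᵈ restᶜ))
            (r-pair (r-call (r-fst r-var r∷ r-fst r-var r∷ r-fst r-var r∷ r-lit r∷ regroup d x y restᵈ refl r∷ regroup c u v restᶜ refl r∷ r-var r∷ r-[])
                (relax (outer-run r d c _ _ D {N} (table S x u D) (table T y v D) []
                    (≤-trans (small T y v) (m≤m+n B _)) fits)
                  (*-monoˡ-≤ (outerUnit r N) (s≤s (small S x u)))))
              (r-snd r-var))))))
        (nodeSum (switchCost (length rules) 2) (ruleAdds Γ r) (suc B * outerUnit r N) (size S) (size T) W (node≤ r))
      where
      J = length (nodeTemplates {Γ = Γ} r)
      N = B + B * (B * J)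
      fits : length (table S x u D) * (length (table T y v D) * J) + 0 ≤ N
      fits = ≤-trans (≤-reflexive (ℕ.+-identityʳ _))
        (≤-trans (*-mono-≤ (small S x u) (*-monoˡ-≤ J (small T y v))) (m≤n+m _ B))
      regroup : ∀ {z i} {ρ : Vec Val z} {r S T} (d : Vec ℕ (ruleAdds Γ r)) (x : Labelling {Γ = Γ} ℕ S) (y : Labelling {Γ = Γ} ℕ T) rest →
        lookup ρ i ≡ encodeList num (labelList (node {r = r} d x y) ++ rest) →
        Run ρ (var i) (encodeList num (toList d ++ (labelList x ++ (labelList y ++ rest)))) 1
      regroup {ρ = ρ} {r} d x y rest eq = subst (λ v → Run ρ _ v 1) (trans eq (cong (encodeList num)
        (trans (Listₚ.++-assoc (toList d) (labelList x ++ labelList y) rest)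
          (cong (toList d ++_) (Listₚ.++-assoc (labelList x) (labelList y) rest))))) r-var

  best-run : ∀ {t} (tb : Table t) cur →
    Run (encodeTable tb ∷ encodeChoice cur ∷ []) bestBody (encodeChoice (best tb cur)) (suc (length tb) * 40)
  best-run []       cur = relax (r-isNum r-var r-var) (m≤m+n 3 37)
  best-run (e ∷ es) cur =
    relax (r-isPair r-var (r-call (r-snd r-var r∷ better-run cur r∷ r-[]) (best-run es (better e cur))))
      (m≤n+m _ 14)
    where
    better-run : ∀ cur → Run (encodeTable (e ∷ es) ∷ encodeChoice cur ∷ []) _ (encodeChoice (better e cur)) 21
    better-run nothing  = relax (r-if Γ encodeChoice {x = nothing} {just e} (r-fst (r-fst r-var)) r-var (r-isNum r-var (r-fst r-var)))
      (m≤m+n 9 12)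
    better-run (just f) = r-if Γ encodeEntry {x = f} (r-fst (r-fst r-var)) r-var
      (r-isPair r-var (r-if Γ encodeEntry {x = f} {e} (r-monus (entry-price Γ {e = f} r-var) (entry-price Γ {e = e} (r-fst r-var))) r-var (r-fst r-var)))

  -- Each rope keeps 12 units in reserve. Two subropes bring two reserves and their union needs one,
  -- so 12 units are free for the 9 steps spent at an inner node; the bound thus counts leaves only.
  flatten-run : ∀ r bs → ∃[ T ] (Run (encodeRope r ∷ encodeList encodeBit bs ∷ []) flattenBody
                                      (encodeList encodeBit (ropeBits r ++ bs)) T × T + 12 ≤ ropeLeaves r * 24)
  flatten-run (bit true)  bs = 9 , r-isNum r-var (r-zero (r-monus r-var r-lit) (r-pair r-var r-var)) , m≤m+n _ _
  flatten-run (bit false) bs = 9 , r-isNum r-var (r-zero (r-monus r-var r-lit) (r-pair r-var r-var)) , m≤m+n _ _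
  flatten-run empty       bs = 7 , r-isNum r-var (r-suc (r-monus r-var r-lit) r-var) , m≤m+n _ _
  flatten-run (r · s)     bs with flatten-run s bs
  ... | S , s-run , s≤ with flatten-run r (ropeBits s ++ bs)
  ... | R , r-run , r≤ = _ ,
    subst (λ bs′ → Run (encodeRope (r · s) ∷ encodeList encodeBit bs ∷ []) flattenBody (encodeList encodeBit bs′)
                       (1 + 1 + (1 + (2 + ((1 + 3 + S) + 0)) + R))) (sym (Listₚ.++-assoc (ropeBits r) (ropeBits s) bs))
      (r-isPair r-var (r-call (r-fst r-var r∷ r-call (r-snd r-var r∷ r-var r∷ r-[]) s-run r∷ r-[]) r-run)) ,
    ≤-trans (flattenSum R S) (≤-trans (+-mono-≤ r≤ s≤) (≤-reflexive (sym (ℕ.*-distribʳ-+ 24 (ropeLeaves r) (ropeLeaves s)))))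

-- The number of signatures.

code : ∀ {A : Set} {b} (σ : A → ℕ) → (∀ a → σ a < b) → (as : List A) → Fin (b ^ length as)
code σ σ<b []       = zero
code σ σ<b (a ∷ as) = Fin.combine (Fin.fromℕ< (σ<b a)) (code σ σ<b as)

code-injective : ∀ {A : Set} {b} {σ σ′ : A → ℕ} (h : ∀ a → σ a < b) (h′ : ∀ a → σ′ a < b) (as : List A) →
                 code σ h as ≡ code σ′ h′ as → List.map σ as ≡ List.map σ′ as
code-injective h h′ []       eq = refl
code-injective h h′ (a ∷ as) eq =
  let (eq₁ , eq₂) = Finₚ.combine-injective (Fin.fromℕ< (h a)) (code _ h as) (Fin.fromℕ< (h′ a)) (code _ h′ as) eq
  in cong₂ _∷_ (Finₚ.fromℕ<-injective _ _ (h a) (h′ a) eq₁) (code-injective h h′ as eq₂)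

distinct-lookup : ∀ {t} (tb : Table t) → Distinct tb → ∀ i j → key (List.lookup tb i) ≡ key (List.lookup tb j) → i ≡ j
distinct-lookup (e ∷ tb) u        zero    zero    eq = refl
distinct-lookup (e ∷ tb) (u ∷ _) zero    (suc j) eq =
  contradiction eq (All.lookup u (∈ˡ.∈-lookup {xs = tb} j))
distinct-lookup (e ∷ tb) (u ∷ _) (suc i) zero    eq =
  contradiction (sym eq) (All.lookup u (∈ˡ.∈-lookup {xs = tb} i))
distinct-lookup (e ∷ tb) (_ ∷ u) (suc i) (suc j) eq = cong suc (distinct-lookup tb u i j eq)

-- Pigeonhole: a signature with values below `b` is read as the digits of a number in base `b`, and
-- entries with different keys get different numbers.
distinct-length : ∀ {t b} (tb : Table t) → Distinct tb → (∀ {e} → e ∈ˡ tb → ∀ v → signature e v < b) →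
                  length tb ≤ b ^ length (allVars t)
distinct-length {t} {b} tb u bounded = Finₚ.injective⇒≤ {f = f} λ {i} {j} eq →
  distinct-lookup tb u i j (code-injective (small i) (small j) (allVars t) eq)
  where
  small : ∀ i v → signature (List.lookup tb i) v < b
  small i = bounded (∈ˡ.∈-lookup {xs = tb} i)
  f : Fin (length tb) → Fin (b ^ length (allVars t))
  f i = code _ (small i) (allVars t)

length-allVars : ∀ t → length (allVars t) ≡ t * t + (t * t + (t * t + t))
length-allVars t = trans (Listₚ.length-++ (pairVars same) {pairVars conn ++ pairVars dist ++ List.map ecc (List.allFin t)}) (cong₂ _+_ (length-pairVars same)
  (trans (Listₚ.length-++ (pairVars conn) {pairVars dist ++ List.map ecc (List.allFin t)}) (cong₂ _+_ (length-pairVars conn)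
    (trans (Listₚ.length-++ (pairVars dist) {List.map ecc (List.allFin t)}) (cong₂ _+_ (length-pairVars dist)
      (trans (Listₚ.length-map ecc (List.allFin t)) (Listₚ.length-tabulate {n = t} id)))))))
  where
  length-product : ∀ {A B : Set} (xs : List A) (ys : List B) →
                   length (List.cartesianProduct xs ys) ≡ length xs * length ys
  length-product []       ys = refl
  length-product (x ∷ xs) ys = trans (Listₚ.length-++ (List.map (x ,_) ys))
    (cong₂ _+_ (Listₚ.length-map (x ,_) ys) (length-product xs ys))
  length-pairVars : (f : Fin t → Fin t → Var t) → length (pairVars f) ≡ t * t
  length-pairVars f = trans (Listₚ.length-map _ (List.cartesianProduct (List.allFin t) (List.allFin t)))
    (trans (length-product (List.allFin t) (List.allFin t))
      (cong₂ _*_ (Listₚ.length-tabulate {n = t} id) (Listₚ.length-tabulate {n = t} id)))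

module _ {k : ℕ} {Γ : GraphClass k} where
  open GraphClass Γ

  arity≤ : ∀ {t} → ParseTree Γ t → t ≤ k
  arity≤ (leaf i)     = Primitive.arity≤k (start i)
  arity≤ (node r _ _) = Rule.out≤k (rule r)

  table-length : ∀ {t} .{{_ : NonZero k}} (T : ParseTree Γ t) d c D → length (table T d c D) ≤ (2 + D) ^ (4 * (k * k))
  table-length {t} T d c D = ≤-trans
    (distinct-length (table T d c D) (table-distinct T d c D) λ e∈ →
      let open Realises (All.lookup (table-sound T d c D) e∈) in signature-bound alive rep)
    -- The factor 4 collects `same`, `conn` and `dist` at t² each, and `ecc` at t, where t ≤ k ≤ k².
    (ℕ.^-monoʳ-≤ (2 + D) (≤-trans (≤-reflexive (length-allVars t))
      (+-mono-≤ t²≤ (+-mono-≤ t²≤ (+-mono-≤ t²≤ (≤-trans (≤-trans t≤k (ℕ.m≤m*n k k)) (m≤m+n (k * k) 0)))))))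
    where
    t≤k = arity≤ T
    t²≤ = *-mono-≤ t≤k t≤k

-- The time bound.

upper : ∀ n (f : Fin n → ℕ) → ∃[ K ] (∀ i → f i ≤ K)
upper zero    f = 0 , λ ()
upper (suc n) f with upper n (f ∘ suc)
... | K , h = f zero + K , λ { zero → m≤m+n _ _ ; (suc i) → ≤-trans (h i) (m≤n+m K _) }

≤-times : ∀ {m} n → 1 ≤ n → m ≤ m * n
≤-times {m} n 1≤n = ≤-trans (≤-reflexive (sym (ℕ.*-identityʳ m))) (*-monoʳ-≤ m 1≤n)

stepRate : ∀ {s t a r} → ℕ → List (Template s t a r) → ℕ
stepRate S []                 = 0
stepRate {r = r} S (T ∷ Ts) = stepRate S Ts + (templateCost S T + insertUnit r)

stepCost-linear : ∀ {s t a r} S (Ts : List (Template s t a r)) N → stepCost S Ts N ≤ stepRate S Ts * suc N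
stepCost-linear S []       N = z≤n
stepCost-linear {r = r} S (T ∷ Ts) N = ≤-trans
  (+-mono-≤ (stepCost-linear S Ts N) (+-mono-≤ (≤-times {templateCost S T} (suc N) (s≤s z≤n))
    (≤-reflexive (ℕ.*-comm (suc N) (insertUnit r)))))
  (≤-reflexive (trans
    (cong (stepRate S Ts * suc N +_) (sym (ℕ.*-distribʳ-+ (suc N) (templateCost S T) (insertUnit r))))
    (sym (ℕ.*-distribʳ-+ (suc N) (stepRate S Ts) (templateCost S T + insertUnit r)))))

-- The polynomial behind nodeCost, with q = 1 + B for tables of at most B entries.
quintic : ∀ B J u w κ (f : ℕ → ℕ) → (∀ N → f N ≤ κ * suc N) → let N = B + B * (B * J) in
  u + suc B * (40 + suc N * (30 + w + f N)) ≤ (u + (70 + w + κ) * ((1 + J) * (1 + J))) * suc B ^ 5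
quintic B J u w κ f linear = ≤-trans
  (+-mono-≤ (≤-times {u} (q ^ 5) (ℕ.m^n>0 q 5)) (*-monoʳ-≤ q outer))
  (≤-reflexive (solve 4 (λ u c j q →
    u :* (q :^ 5) :+ q :* (c :* (((con 1 :+ j) :* (q :* q)) :* ((con 1 :+ j) :* (q :* q))))
      := (u :+ c :* ((con 1 :+ j) :* (con 1 :+ j))) :* (q :^ 5)) refl u (70 + w + κ) J q))
  where
  open +-*-Solver
  q = suc B
  N = B + B * (B * J)
  n = (1 + J) * (q * q)
  N<n : suc N ≤ n
  N<n = +-mono-≤ (≤-times {q} q (s≤s z≤n)) (≤-trans (*-mono-≤ (ℕ.n≤1+n B) (*-monoˡ-≤ J (ℕ.n≤1+n B)))
    (≤-reflexive (solve 2 (λ q j → q :* (q :* j) := j :* (q :* q)) refl q J)))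
  inner : 30 + w + f N ≤ (30 + w + κ) * n
  inner = ≤-trans (+-mono-≤ (≤-times {30 + w} n (≤-trans (s≤s z≤n) N<n)) (≤-trans (linear N) (*-monoʳ-≤ κ N<n)))
    (≤-reflexive (sym (ℕ.*-distribʳ-+ n (30 + w) κ)))
  outer : 40 + suc N * (30 + w + f N) ≤ (70 + w + κ) * (n * n)
  outer = ≤-trans (+-mono-≤ (≤-times {40} (n * n) (*-mono-≤ (≤-trans (s≤s z≤n) N<n) (≤-trans (s≤s z≤n) N<n)))
                           (*-mono-≤ N<n inner))
    (≤-reflexive (solve 3 (λ w κ n → con 40 :* (n :* n) :+ n :* ((con 30 :+ w :+ κ) :* n)
      := (con 70 :+ w :+ κ) :* (n :* n)) refl w κ n))

^-distribʳ-* : ∀ m n e → (m * n) ^ e ≡ m ^ e * n ^ e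
^-distribʳ-* m n zero    = refl
^-distribʳ-* m n (suc e) = trans (cong (m * n *_) (^-distribʳ-* m n e))
  (solve 4 (λ m n x y → m :* n :* (x :* y) := m :* x :* (n :* y)) refl m n (m ^ e) (n ^ e))
  where open +-*-Solver

-- From `2 + D ≤ 3 * (1 ⊔ D)`, and a factor 2 for the successor, everything but a power of `1 ⊔ D`
-- moves into a factor that depends on `e` alone. The maximum with 1 keeps the bound positive for
-- `D = 0`.
tables-power : ∀ D e → suc ((2 + D) ^ e) ^ 5 ≤ (2 ^ 5 * 3 ^ (e * 5)) * (1 ⊔ D) ^ (e * 5)
tables-power D e = ≤-trans (ℕ.^-monoˡ-≤ 5 q≤) (≤-reflexive (begin
  (2 * (3 * M) ^ e) ^ 5                ≡⟨ ^-distribʳ-* 2 ((3 * M) ^ e) 5 ⟩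
  2 ^ 5 * ((3 * M) ^ e) ^ 5            ≡⟨ cong (2 ^ 5 *_) (ℕ.^-*-assoc (3 * M) e 5) ⟩
  2 ^ 5 * (3 * M) ^ (e * 5)            ≡⟨ cong (2 ^ 5 *_) (^-distribʳ-* 3 M (e * 5)) ⟩
  2 ^ 5 * (3 ^ (e * 5) * M ^ (e * 5))  ≡⟨ sym (ℕ.*-assoc (2 ^ 5) (3 ^ (e * 5)) (M ^ (e * 5))) ⟩
  (2 ^ 5 * 3 ^ (e * 5)) * M ^ (e * 5)  ∎))
  where
  open ≡-Reasoning
  M = 1 ⊔ D
  base : 2 + D ≤ 3 * M
  base = ≤-trans (+-mono-≤ (ℕ.m≤m⊔n 1 D) (+-mono-≤ (ℕ.m≤m⊔n 1 D) (ℕ.m≤n⊔m 1 D)))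
    (≤-reflexive (cong (λ x → M + (M + x)) (sym (ℕ.+-identityʳ M))))
  q≤ : suc ((2 + D) ^ e) ≤ 2 * (3 * M) ^ e
  q≤ = +-mono-≤ (≤-trans (ℕ.m^n>0 (2 + D) e) (ℕ.^-monoˡ-≤ e base))
    (≤-trans (ℕ.^-monoˡ-≤ e base) (m≤m+n ((3 * M) ^ e) 0))

module _ {k : ℕ} (Γ : GraphClass k) where
  open GraphClass Γ
  open Running (program Γ)

  nodeRate : Fin (length rules) → ℕ
  nodeRate r = u + (70 + switchCost (length rules) 1 + stepRate 2 Ts) * ((1 + length Ts) * (1 + length Ts))
    where
    Ts = nodeTemplates {Γ = Γ} r
    a  = ruleAdds Γ r
    u  = 60 + switchCost (length rules) 2 + (a + a)

  nodeCost-bound : ∀ r B → nodeCost Γ r B ≤ nodeRate r * suc B ^ 5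
  nodeCost-bound r B = quintic B (length Ts)
    (60 + switchCost (length rules) 2 + (a + a)) (switchCost (length rules) 1) (stepRate 2 Ts) (stepCost 2 Ts)
    (stepCost-linear 2 Ts)
    where
    Ts = nodeTemplates {Γ = Γ} r
    a  = ruleAdds Γ r

  rate : ℕ
  rate = proj₁ (upper _ nodeRate) + proj₁ (upper _ (leafCost Γ))

  leavesRate : ℕ
  leavesRate = proj₁ (upper _ (ruleAdds Γ)) + proj₁ (upper _ λ i → startAdds Γ i + 2)

  treeLeaves-bound : ∀ {t} (T : ParseTree Γ t) → treeLeaves T ≤ size T * leavesRate
  treeLeaves-bound (leaf i) = ≤-trans (proj₂ (upper _ λ i → startAdds Γ i + 2) i)
    (≤-trans (m≤n+m _ (proj₁ (upper _ (ruleAdds Γ)))) (m≤m+n leavesRate 0))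
  treeLeaves-bound (node r S T) = +-mono-≤
    (≤-trans (proj₂ (upper _ (ruleAdds Γ)) r) (m≤m+n _ _))
    (≤-trans (+-mono-≤ (treeLeaves-bound S) (treeLeaves-bound T)) (≤-reflexive (sym (ℕ.*-distribʳ-+ leavesRate (size S) (size T)))))

  -- Per parse tree node: `rate` for the tables, 24 for each rope leaf to be flattened, and 80 made
  -- up of 40 for the fixed work of `main` and 40 per entry for the search of the best one.
  constant : ℕ
  constant = rate + leavesRate * 24 + 80


-- The running time of the whole program.

mainSum : ∀ a b c → 1 + (1 + 17 + a) + (1 + (1 + 3 + b) + (10 + c)) ≤ 40 + a + b + c
mainSum a b c = by-slack 6 (solve 3 (λ a b c →
  con 1 :+ (con 1 :+ con 17 :+ a) :+ (con 1 :+ (con 1 :+ con 3 :+ b) :+ (con 10 :+ c)) :+ con 6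
    := con 40 :+ a :+ b :+ c) refl a b c)
  where open +-*-Solver

collect : ∀ s q r l → 40 * (s * q) + s * (r * q) + (s * q) * 40 + (s * l) * q * 24 ≡ s * (r + l * 24 + 80) * q
collect = solve 4 (λ s q r l →
  con 40 :* (s :* q) :+ s :* (r :* q) :+ (s :* q) :* con 40 :+ (s :* l) :* q :* con 24
    := s :* (r :+ l :* con 24 :+ con 80) :* q) refl
  where open +-*-Solver

size≥1 : ∀ {k} {Γ : GraphClass k} {t} (T : ParseTree Γ t) → 1 ≤ size T
size≥1 (leaf _)     = s≤s z≤n
size≥1 (node _ _ _) = s≤s z≤n

module _ {k : ℕ} (Γ : GraphClass k) {t : ℕ} (T : ParseTree Γ t) (D : ℕ) where
  open Running (program Γ)
  open Program (program Γ) using (main)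

  IsAnswer : (X : TGraph t) → Vec ℕ (TGraph.edges X) → Vec ℕ (TGraph.edges X) → Maybe (Subset (TGraph.edges X)) → Set
  IsAnswer X d c nothing  = ∀ S → ¬ FeasibleIn (TGraph.graph X) d D S
  IsAnswer X d c (just S) = FeasibleIn (TGraph.graph X) d D S ×
    (∀ S′ → FeasibleIn (TGraph.graph X) d D S′ → totalCost c S ≤ totalCost c S′)

  inputVal : (X : TGraph t) → Vec ℕ (TGraph.edges X) → Vec ℕ (TGraph.edges X) → Val
  inputVal X d c = encodeGraph (TGraph.graph X) ∙ encodeParse T ∙ encodeVec num d ∙ encodeVec num c ∙ num D

  Solved : (X : TGraph t) → Vec ℕ (TGraph.edges X) → Vec ℕ (TGraph.edges X) → ℕ → Set
  Solved X d c U = ∃[ answer ] (Run (inputVal X d c ∷ []) main (encodeAnswer answer) U × IsAnswer X d c answer)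

  output-run : (d c : Labelling ℕ T) {ρ₁ ρ₂ : Val} (m : Maybe (Entry t)) → Correct T d c D m →
    ∃[ answer ] (Run (encodeChoice m ∷ ρ₁ ∷ ρ₂ ∷ [])
                     (ifPair v₀ (pair (lit 1) (call flattenᶠ (ropeOf v₀ ∷ lit 0 ∷ []))) (lit 0))
                     (encodeAnswer answer) (10 + treeLeaves T * 24) ×
                 IsAnswer (build T) (flat d) (flat c) answer)
  output-run d c nothing  none = nothing , relax (r-isNum r-var r-lit) (m≤m+n 3 _) , none
  output-run d c {ρ₁} {ρ₂} (just e) (S , bits , leaves , feasible , minimal) with flatten-run Γ (rope e) []
  ... | U , run , le = just (flat S) ,
    relax (r-isPair r-var (r-pair r-lit (r-call (entry-rope Γ {e = e} r-var r∷ r-lit r∷ r-[])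
      (subst (λ v → Run (encodeRope (rope e) ∷ num 0 ∷ []) flattenBody v U) decoded run))))
      (+-monoʳ-≤ 10 (≤-trans (m≤m+n U 12) (≤-trans le (≤-reflexive (cong (_* 24) leaves))))) ,
    feasible , minimal
    where
    decoded : encodeList encodeBit (ropeBits (rope e) ++ []) ≡ encodeVec encodeBit (flat S)
    decoded = trans (cong (encodeList encodeBit) (trans (Listₚ.++-identityʳ _) (trans bits (sym (flat-toList S)))))
      (sym (encodeVec-toList encodeBit (flat S)))

  module _ {B W : ℕ} (small : ∀ {t} (T : ParseTree Γ t) d c → length (table T d c D) ≤ B)
           (leaf≤ : ∀ i → leafCost Γ i ≤ W) (node≤ : ∀ r → nodeCost Γ r B ≤ W) where

    main-run : (d c : Labelling ℕ T) → Solved (build T) (flat d) (flat c)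
      (40 + size T * W + suc B * 40 + treeLeaves T * 24)
    main-run d c with output-run d c {encodeTable (table T d c D) ∙ num 0 ∙ num 0} {inputVal (build T) (flat d) (flat c)}
                        (best (table T d c D) nothing) (best-correct T d c D)
    ... | answer , run , correct = answer ,
      relax (r-bind (r-call
          (r-fst (r-snd r-var) r∷ listed d (r-fst (r-snd (r-snd r-var))) r∷
           listed c (r-fst (r-snd (r-snd (r-snd r-var)))) r∷ r-snd (r-snd (r-snd (r-snd r-var))) r∷ r-[])
          (process-run Γ small leaf≤ node≤ T d c [] []))
        (r-bind (r-call (r-fst r-var r∷ r-lit r∷ r-[])
          (relax (best-run Γ (table T d c D) nothing) (*-monoˡ-≤ 40 (s≤s (small T d c))))) run))
        (mainSum (size T * W) (suc B * 40) (treeLeaves T * 24)) , correct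
      where
      listed : ∀ {x} {ρ : Vec Val x} {e S} (d : Labelling ℕ T) → Run ρ e (encodeVec num (flat d)) S →
               Run ρ e (encodeList num (labelList d ++ [])) S
      listed {ρ = ρ} {e} {S} d = subst (λ v → Run ρ e v S) (trans (encodeVec-toList num (flat d))
        (cong (encodeList num) (trans (flat-toList d) (sym (Listₚ.++-identityʳ _)))))

  solved : .{{_ : NonZero k}} → (d c : Labelling ℕ T) →
           Solved (build T) (flat d) (flat c) (size T * constant Γ * suc ((2 + D) ^ (4 * (k * k))) ^ 5)
  solved d c = let (answer , run , correct) = main-run {B} {rate Γ * Q} (λ T d c → table-length T d c D) leaf≤ node≤ d c in
    answer , relax run (≤-trans
      (+-mono-≤ (+-mono-≤ (+-monoˡ-≤ (size T * (rate Γ * Q)) (*-monoʳ-≤ 40 one≤)) (*-monoˡ-≤ 40 B≤))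
                (*-monoˡ-≤ 24 (≤-trans (treeLeaves-bound Γ T) (≤-times Q Q≥1))))
      (≤-reflexive (collect (size T) Q (rate Γ) (leavesRate Γ)))) , correct
    where
    B = (2 + D) ^ (4 * (k * k))
    Q = suc B ^ 5
    Q≥1 : 1 ≤ Q
    Q≥1 = ℕ.m^n>0 (suc B) 5
    leaf≤ : ∀ i → leafCost Γ i ≤ rate Γ * Q
    leaf≤ i = ≤-trans (proj₂ (upper _ (leafCost Γ)) i) (≤-trans (m≤n+m _ (proj₁ (upper _ (nodeRate Γ)))) (≤-times Q Q≥1))
    node≤ : ∀ r → nodeCost Γ r B ≤ rate Γ * Q
    node≤ r = ≤-trans (nodeCost-bound Γ r B) (*-monoˡ-≤ Q (≤-trans (proj₂ (upper _ (nodeRate Γ)) r) (m≤m+n _ _)))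
    one≤ : 1 ≤ size T * Q
    one≤ = *-mono-≤ (size≥1 T) Q≥1
    B≤ : suc B ≤ size T * Q
    B≤ = ≤-trans (≤-times {suc B} (suc B ^ 4) (ℕ.m^n>0 (suc B) 4)) (≤-trans (≤-times (size T) (size≥1 T)) (≤-reflexive (ℕ.*-comm Q (size T))))

-- Transports the result from `build T` to the graph of the instance. With `X` a variable the
-- equation can be matched, after which `unflat` presents plain vectors of weights and costs as
-- labellings.
solved-graph : ∀ {k} .{{_ : NonZero k}} (Γ : GraphClass k) {t} (T : ParseTree Γ t) D (X : TGraph t) → build T ≡ X →
  (d c : Vec ℕ (TGraph.edges X)) → Solved Γ T D X d c (size T * constant Γ * suc ((2 + D) ^ (4 * (k * k))) ^ 5)
solved-graph Γ T D _ refl d c with unflat T d | unflat T c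
... | x , refl | y , refl = solved Γ T D x y

-- For tables of (2 + D)^(4k²) entries the fifth power gives the exponent 20k², which is at most
-- 20k⁴ since k ≥ 1. The linear size of the parse tree turns `s` into `ℓ * n`, and what depends on
-- `ℓ` and the class alone is gathered in front.
time-bound : ∀ k ℓ n s K D .{{_ : NonZero k}} → s ≤ ℓ * n →
  s * K * suc ((2 + D) ^ (4 * (k * k))) ^ 5 ≤
  (ℓ * K * (2 ^ 5 * 3 ^ (4 * (k * k) * 5))) * (n * k ^ (2 * k + 4) * (1 ⊔ D) ^ (20 * k ^ 4))
time-bound k ℓ n s K D s≤ = ≤-trans
  (*-mono-≤ (*-monoˡ-≤ K s≤) (≤-trans (tables-power D (4 * (k * k)))
    (*-monoʳ-≤ F (ℕ.^-monoʳ-≤ (1 ⊔ D) {{M≢0}} exponent))))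
  (≤-trans (≤-reflexive (solve 5 (λ ℓ n K F M → (ℓ :* n :* K) :* (F :* M) := (ℓ :* K :* F) :* (n :* M)) refl ℓ n K F _))
    (*-monoʳ-≤ (ℓ * K * F) (*-monoˡ-≤ ((1 ⊔ D) ^ (20 * k ^ 4)) (≤-times {n} (k ^ (2 * k + 4)) (ℕ.m^n>0 k (2 * k + 4))))))
  where
  open +-*-Solver
  F = 2 ^ 5 * 3 ^ (4 * (k * k) * 5)
  M≢0 : NonZero (1 ⊔ D)
  M≢0 = >-nonZero (ℕ.m≤m⊔n 1 D)
  exponent : 4 * (k * k) * 5 ≤ 20 * k ^ 4
  exponent = ≤-trans (≤-reflexive (solve 1 (λ x → con 4 :* x :* con 5 := con 20 :* x) refl (k * k)))
    (*-monoʳ-≤ 20 (≤-trans (≤-times {k * k} (k * k) (*-mono-≤ k≥1 k≥1))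
      (≤-reflexive (solve 1 (λ k → k :* k :* (k :* k) := k :^ 4) refl k))))
    where
    k≥1 : 1 ≤ k
    k≥1 = >-nonZero⁻¹ k

theorem8p2 : ∃[ a ] ((k : ℕ) → .{{_ : NonZero k}} → (Γ : GraphClass k) →
    ∃[ P ] ((ℓ : ℕ) → ∃[ C ] ((I : Instance Γ) → let open Instance I in
    size parse ≤ ℓ * nodes →
    SolvesWithin P I (C * (nodes * k ^ (2 * k + 4) * (1 ⊔ 𝒟) ^ (a * k ^ 4))))))
-- The program depends on the class only; the ratio `ℓ` of the parse tree size to the number of
-- nodes enters through the constant alone.
theorem8p2 = 20 , λ k Γ → program Γ , λ ℓ → ℓ * constant Γ * (2 ^ 5 * 3 ^ (4 * (k * k) * 5)) , λ I size≤ →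
  let open Instance I
      (answer , run , correct) = solved-graph Γ parse 𝒟 ⟦ parse ⟧ (build-correct parse) d c
  in answer , Running.Run.time run , Running.Run.derivation run , isSolution I answer correct ,
     ≤-trans (Running.Run.within run) (time-bound k ℓ nodes (size parse) (constant Γ) 𝒟 size≤)
  where
  isSolution : ∀ {k} .{{_ : NonZero k}} {Γ : GraphClass k} (I : Instance Γ) → let open Instance I in ∀ answer →
               IsAnswer Γ parse 𝒟 ⟦ parse ⟧ d c answer → IsSolution answer
  isSolution I nothing  none    = none
  isSolution I (just S) correct = correct
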